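{- Let $\eta$ be an $\mathrm{ATL}^{+}$ state formula (in negation normal form) and let $\mathcal{T}^{\eta}$ be the final tableau produced for $\eta$ by the tableau procedure described in the context. If $\mathcal{T}^{\eta}$ is open (some state of $\mathcal{T}^{\eta}$ contains $\eta$), then $\eta$ is satisfiable, i.e. there exist a concurrent game model $\mathcal{M}$ and a state $s$ with $\mathcal{M},s\models\eta$.
   Context: Agents and models. Fix a finite non-empty set of agents $\mathbb{A}=\{1,\dots,k\}$ and a set $\mathrm{Prop}$ of atomic propositions. A concurrent game model (CGM) is $\mathcal{M}=(\mathbb{A},\mathsf{St},\{\mathsf{Act}_a\}_{a},\{\mathsf{act}_a\}_{a},\mathsf{out},\mathrm{Prop},L)$ where $\mathsf{St}$ is a non-empty set of states, $\mathsf{act}_a(s)\subseteq\mathsf{Act}_a$ is the non-empty set of actions available to $a$ at $s$, $\mathsf{out}(s,\sigma)$ is the unique successor state of $s$ under an action profile $\sigma$ (one available action per agent), and $L:\mathsf{St}\to\mathcal{P}(\mathrm{Prop})$. For $A\subseteq\mathbb{A}$ an $A$-action at $s$ is a tuple of available actions of the agents in $A$. Plays are infinite sequences of states each obtained from the previous one by some action profile; histories are finite prefixes. A (perfect-recall) strategy of $A$ assigns to every history $h$ an $A$-action available at its last state; a play $\lambda$ is consistent with it if each step $\lambda_i\to\lambda_{i+1}$ is produced by an action profile extending the $A$-action prescribed for $\lambda_0\dots\lambda_i$. An $A$-co-strategy assigns to each history $h$ and each strategy $F_A$ of $A$ an action tuple of $\mathbb{A}\setminus A$ available at the last state of $h$;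 a play is consistent with a co-strategy $F^c$ if for some strategy $F_A$ of $A$ each step is produced by the profile combining $F_A(\lambda_{\le i})$ and $F^c(\lambda_{\le i},F_A)$. Syntax (negation normal form). State formulae: $\varphi::=l\mid\varphi\vee\varphi\mid\varphi\wedge\varphi\mid\langle\langle A\rangle\rangle\Phi\mid[[A]]\Phi$ with $l$ a literal ($p$ or $\neg p$, $p\in\mathrm{Prop}$) and $A\subseteq\mathbb{A}$; path formulae: $\Phi::=\varphi\mid\bigcirc\varphi\mid\Box\varphi\mid\varphi\,\mathcal{U}\,\varphi\mid\Phi\vee\Phi\mid\Phi\wedge\Phi$. $\top$ abbreviates $p\vee\neg p$, $\bot$ its negation. Semantics is standard: $\mathcal{M},s\models\langle\langle A\rangle\rangle\Phi$ iff some strategy of $A$ makes every consistent play from $s$ satisfy $\Phi$; $\mathcal{M},s\models[[A]]\Phi$ iff some $A$-co-strategy makes every consistent play from $s$ satisfy $\Phi$; a state formula holds on a play iff it holds at its first state; $\bigcirc,\Box,\mathcal{U}$, $\wedge$, $\vee$ on plays are as in LTL. Decomposition. For path formulae define $\mathsf{dec}(\Phi)$, a set of pairs (state formula, path formula): $\mathsf{dec}(\varphi)=\{\langle\varphi,\top\rangle\}$ for a state formula $\varphi$; $\mathsf{dec}(\bigcirc\varphi)=\{\langle\top,\varphi\rangle\}$; $\mathsf{dec}(\Box\varphi)=\{\langle\varphi,\Box\varphi\rangle\}$; $\mathsf{dec}(\varphi\,\mathcal{U}\,\psi)=\{\langle\varphi,\varphi\,\mathcal{U}\,\psi\rangle,\langle\psi,\top\rangle\}$;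 $\mathsf{dec}(\Phi_1\wedge\Phi_2)=\{\langle\psi_i\wedge\psi_j,\Psi_i\wedge\Psi_j\rangle:\langle\psi_i,\Psi_i\rangle\in\mathsf{dec}(\Phi_1),\langle\psi_j,\Psi_j\rangle\in\mathsf{dec}(\Phi_2)\}$; $\mathsf{dec}(\Phi_1\vee\Phi_2)=\mathsf{dec}(\Phi_1)\cup\mathsf{dec}(\Phi_2)\cup\{\langle\psi_i\wedge\psi_j,\Psi_i\vee\Psi_j\rangle:\langle\psi_i,\Psi_i\rangle\in\mathsf{dec}(\Phi_1),\langle\psi_j,\Psi_j\rangle\in\mathsf{dec}(\Phi_2),\Psi_i\neq\top\neq\Psi_j\}$. A $\gamma$-formula is one of the form $\langle\langle A\rangle\rangle\Phi$ or $[[A]]\Phi$ where the main operator of $\Phi$ is not $\bigcirc$; its $\gamma$-components are, for $\langle\psi,\Psi\rangle\in\mathsf{dec}(\Phi)$: $\psi$ if $\Psi=\top$, and otherwise $\psi\wedge\langle\langle A\rangle\rangle\bigcirc\langle\langle A\rangle\rangle\Psi$ (resp. $\psi\wedge[[A]]\bigcirc[[A]]\Psi$). Other components: $\varphi\wedge\psi$ has $\alpha$-components $\varphi,\psi$; $[[\mathbb{A}]]\bigcirc\psi$ has $\alpha$-component $\langle\langle\emptyset\rangle\rangle\bigcirc\psi$; $\varphi\vee\psi$ has $\beta$-components $\varphi,\psi$; $\langle\langle A\rangle\rangle\bigcirc\psi$ and $[[A]]\bigcirc\psi$ ($A\neq\mathbb{A}$) have successor component $\psi$ and are called primitive successor formulae.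 The closure $cl(\eta)$ is the least set containing $\eta,\top,\bot$ and closed under taking all these components. Full expansions. For a set $\Gamma$ of state formulae, a full expansion of $\Gamma$ is a set $\Delta$ with $\Gamma\subseteq\Delta\subseteq cl(\Gamma)$, not containing $\bot$ nor any pair $\varphi,\neg\varphi$, such that: $\varphi\wedge\psi\in\Delta$ implies $\varphi,\psi\in\Delta$; $\varphi\vee\psi\in\Delta$ implies $\varphi\in\Delta$ or $\psi\in\Delta$; every $\gamma$-formula $\xi\in\Delta$ has at least one $\gamma$-component in $\Delta$, and exactly one of them, denoted $\gamma(\xi,\Delta)$, is designated as linked to $\xi$. Tableau procedure for input $\eta$. Pretableau: nodes are prestates (sets of formulae) and states (full expansions), identified with their labels; start with the prestate $\{\eta\}$ and apply the two rules until saturation. (SR) For a prestate $\Gamma$ and each full expansion $\Delta$ of $\Gamma$: if $\Delta$ contains no formula of the form $\langle\langle A\rangle\rangle\bigcirc\varphi$ or $[[A]]\bigcirc\varphi$, add $\langle\langle\mathbb{A}\rangle\rangle\bigcirc\top$ to it; add the state $\Delta$ (or reuse an existing state with the same label) and an edge $\Gamma\Rightarrow\Delta$. (Next) For a state $\Delta$, list its primitive successor formulae as $\langle\langle A_0\rangle\rangle\bigcirc\varphi_0,\dots,\langle\langle A_{m-1}\rangle\rangle\bigcirc\varphi_{m-1},[[A'_0]]\bigcirc\psi_0,\dots,[[A'_{l-1}]]\bigcirc\psi_{l-1}$ (with $A'_q\neq\mathbb{A}$); let $r=m+l$ and $D(\Delta)=\{0,\dots,r-1\}^{\mathbb{A}}$.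 For $\sigma\in D(\Delta)$ let $N(\sigma)=\{a:\sigma_a\ge m\}$ and $\mathrm{co}(\sigma)=(\sum_{a\in N(\sigma)}(\sigma_a-m))\bmod l$. Create the prestate $\Gamma_\sigma=\{\varphi_p:\sigma_a=p\text{ for all }a\in A_p\}\cup\{\psi_q:\mathrm{co}(\sigma)=q,\ \mathbb{A}\setminus A'_q\subseteq N(\sigma)\}$ (adding $\top$ if it is empty, reusing an existing identical prestate) and an edge $\Delta\xrightarrow{\sigma}\Gamma_\sigma$. Initial tableau: delete all prestates, putting $\Delta\xrightarrow{\sigma}\Delta'$ whenever $\Delta\xrightarrow{\sigma}\Gamma\Rightarrow\Delta'$. Elimination: repeatedly delete one state $\Delta$ from the current tableau if (ER1) for some $\sigma\in D(\Delta)$ no remaining state $\Delta'$ has $\Delta\xrightarrow{\sigma}\Delta'$, or (ER2) $\Delta$ contains a potential eventuality (i.e. a $\gamma$-formula) not realized at $\Delta$ in the current tableau. Realization: define $Real(\Phi,\Theta)$ for a path formula $\Phi$ and a set $\Theta$ by $Real(\Phi\wedge\Psi)=Real(\Phi)\wedge Real(\Psi)$, $Real(\Phi\vee\Psi)=Real(\Phi)\vee Real(\Psi)$, $Real(\varphi,\Theta)$ iff $\varphi\in\Theta$ ($\varphi$ a state formula), $Real(\bigcirc\varphi,\Theta)=$ false, $Real(\Box\varphi,\Theta)$ iff $\varphi\in\Theta$, $Real(\varphi\,\mathcal{U}\,\psi,\Theta)$ iff $\psi\in\Theta$. Realization is defined inductively: $\xi=\langle\langle A\rangle\rangle\Phi$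 (resp. $[[A]]\Phi$) in $\Delta$ is realized at $\Delta$ if $Real(\Phi,\Delta)$ holds, or if $\gamma(\xi,\Delta)$ is $\psi\wedge\langle\langle A\rangle\rangle\bigcirc\xi'$ (resp. $\psi\wedge[[A]]\bigcirc\xi'$) and for every $\sigma\in D(\Delta)$ with $\sigma_a=p$ for all $a\in A$, where $\langle\langle A\rangle\rangle\bigcirc\xi'$ is the $p$-th listed formula (resp. every $\sigma$ with $\mathrm{co}(\sigma)=q$ and $\mathbb{A}\setminus A\subseteq N(\sigma)$, where $[[A]]\bigcirc\xi'$ is the $q$-th listed unavoidable formula), some remaining $\Delta'$ with $\Delta\xrightarrow{\sigma}\Delta'$ has $\xi'$ realized at $\Delta'$. When no elimination applies, the result is the final tableau; it is open if some of its states contains $\eta$, closed otherwise.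
   Formalization: Full expansions are also required to contain ⟨⟨∅⟩⟩○ψ whenever they contain [[𝔸]]○ψ (its α-component); without this the claim fails, e.g. for [[𝔸]]○p ∧ ⟨⟨∅⟩⟩○¬p. Atomic propositions are the natural numbers. -}

module Defs where

open import Data.Nat using (ℕ; zero; suc; _+_; _*_; _∸_; _≤_; _<_; _≤ᵇ_)
open import Data.Nat.DivMod using (_%_)
open import Data.Bool using (Bool; true; false; if_then_else_; _∨_)
open import Data.Fin using (Fin; toℕ)
open import Data.Fin.Subset using (Subset; _∈_; _∉_) renaming (⊤ to full; ⊥ to empty)
open import Data.List using (List; []; _∷_; [_]; _++_; map; concatMap; length; lookup; allFin)
open import Data.Nat.ListAction using (sum)
open import Data.List.NonEmpty using (List⁺; _∷_; _⁺∷ʳ_; last)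
open import Data.List.Membership.Propositional using () renaming (_∈_ to _∈ˡ_)
open import Data.List.Relation.Unary.Unique.Propositional using (Unique)
open import Data.Product using (Σ; _×_; _,_; proj₁; proj₂)
open import Data.Sum using (_⊎_)
open import Data.Unit using (⊤)
open import Data.Empty using (⊥)
open import Relation.Nullary using (¬_)
open import Relation.Binary.PropositionalEquality using (_≡_; _≢_)

-- Syntax of ATL+ in negation normal form, over k agents (Fin k)
-- and atomic propositions ℕ.  Coalitions are subsets of Fin k.

Coal : ℕ → Set
Coal k = Subset k

data Lit : Set where
  pos : ℕ → Lit
  neg : ℕ → Lit

mutual
  data SF (k : ℕ) : Set where
    lit   : Lit → SF k
    _∨ₛ_  : SF k → SF k → SF k
    _∧ₛ_  : SF k → SF k → SF k
    ⟪_⟫_  : Coal k → PF k → SF k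
    ⟦_⟧_  : Coal k → PF k → SF k

  data PF (k : ℕ) : Set where
    st    : SF k → PF k
    ○_    : SF k → PF k
    □_    : SF k → PF k
    _U_   : SF k → SF k → PF k
    _∨ₚ_  : PF k → PF k → PF k
    _∧ₚ_  : PF k → PF k → PF k

-- ⊤ abbreviates p ∨ ¬p, ⊥ its (NNF) negation p ∧ ¬p, for the fixed atom p = 0.
⊤ₛ : ∀ {k} → SF k
⊤ₛ = lit (pos 0) ∨ₛ lit (neg 0)

⊥ₛ : ∀ {k} → SF k
⊥ₛ = lit (pos 0) ∧ₛ lit (neg 0)

⊤ₚ : ∀ {k} → PF k
⊤ₚ = st ⊤ₛ

isTopP : ∀ {k} → PF k → Bool
isTopP (st (lit (pos zero) ∨ₛ lit (neg zero))) = true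
isTopP _ = false

record CGM (k : ℕ) : Set₁ where
  field
    St     : Set
    Act    : Fin k → Set
    act    : (a : Fin k) → St → Act a → Set
    act-ne : (a : Fin k) (s : St) → Σ (Act a) (act a s)
    out    : St → ((a : Fin k) → Act a) → St
    L      : St → ℕ → Set

module Sem {k : ℕ} (M : CGM k) where
  open CGM M

  Profile : Set
  Profile = (a : Fin k) → Act a

  Avail : St → Profile → Set
  Avail s σ = ∀ a → act a s (σ a)

  Step : St → St → Set
  Step s s' = Σ Profile λ σ → Avail s σ × out s σ ≡ s'

  Chain : St → List St → Set
  Chain s [] = ⊤
  Chain s (s' ∷ ss) = Step s s' × Chain s' ss

  IsHist : List⁺ St → Set
  IsHist (s ∷ ss) = Chain s ss

  AAct : Coal k → St → Set
  AAct A s = (a : Fin k) → a ∈ A → Σ (Act a) (act a s)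

  CoAct : Coal k → St → Set
  CoAct A s = (a : Fin k) → a ∉ A → Σ (Act a) (act a s)

  Strategy : Coal k → Set
  Strategy A = (h : List⁺ St) → .(IsHist h) → AAct A (last h)

  CoStrategy : Coal k → Set
  CoStrategy A = (h : List⁺ St) → .(IsHist h) → Strategy A → CoAct A (last h)

  Play : Set
  Play = ℕ → St

  pre : Play → ℕ → List⁺ St
  pre π zero = π 0 ∷ []
  pre π (suc i) = pre π i ⁺∷ʳ π (suc i)

  ConsS : (A : Coal k) → Strategy A → St → Play → Set
  ConsS A F s π = π 0 ≡ s ×
    (∀ i → (ih : IsHist (pre π i)) → Σ Profile λ σ → Avail (π i) σ ×
       (∀ a (p : a ∈ A) → σ a ≡ proj₁ (F (pre π i) ih a p)) ×
       out (π i) σ ≡ π (suc i))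

  ConsC : (A : Coal k) → CoStrategy A → St → Play → Set
  ConsC A Fc s π = Σ (Strategy A) λ F → π 0 ≡ s ×
    (∀ i → (ih : IsHist (pre π i)) → Σ Profile λ σ → Avail (π i) σ ×
       (∀ a (p : a ∈ A) → σ a ≡ proj₁ (F (pre π i) ih a p)) ×
       (∀ a (p : a ∉ A) → σ a ≡ proj₁ (Fc (pre π i) ih F a p)) ×
       out (π i) σ ≡ π (suc i))

  mutual
    _⊨_ : St → SF k → Set
    s ⊨ lit (pos p) = L s p
    s ⊨ lit (neg p) = ¬ L s p
    s ⊨ (φ ∨ₛ ψ) = (s ⊨ φ) ⊎ (s ⊨ ψ)
    s ⊨ (φ ∧ₛ ψ) = (s ⊨ φ) × (s ⊨ ψ)
    s ⊨ (⟪ A ⟫ Φ) = Σ (Strategy A) λ F → ∀ π → ConsS A F s π → π ⊨ₚ Φ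
    s ⊨ (⟦ A ⟧ Φ) = Σ (CoStrategy A) λ Fc → ∀ π → ConsC A Fc s π → π ⊨ₚ Φ

    _⊨ₚ_ : Play → PF k → Set
    π ⊨ₚ st φ = π 0 ⊨ φ
    π ⊨ₚ (○ φ) = π 1 ⊨ φ
    π ⊨ₚ (□ φ) = ∀ i → π i ⊨ φ
    π ⊨ₚ (φ U ψ) = Σ ℕ λ i → (π i ⊨ ψ) × (∀ j → j < i → π j ⊨ φ)
    π ⊨ₚ (Φ ∨ₚ Ψ) = (π ⊨ₚ Φ) ⊎ (π ⊨ₚ Ψ)
    π ⊨ₚ (Φ ∧ₚ Ψ) = (π ⊨ₚ Φ) × (π ⊨ₚ Ψ)

Satisfiable : ∀ {k} → SF k → Set₁
Satisfiable {k} η = Σ (CGM k) λ M → Σ (CGM.St M) λ s → Sem._⊨_ M s η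

dec : ∀ {k} → PF k → List (SF k × PF k)
dec (st φ) = [ (φ , ⊤ₚ) ]
dec (○ φ) = [ (⊤ₛ , st φ) ]
dec (□ φ) = [ (φ , □ φ) ]
dec (φ U ψ) = (φ , φ U ψ) ∷ (ψ , ⊤ₚ) ∷ []
dec (Φ₁ ∧ₚ Φ₂) =
  concatMap (λ x → map (λ y → (proj₁ x ∧ₛ proj₁ y , proj₂ x ∧ₚ proj₂ y)) (dec Φ₂)) (dec Φ₁)
dec (Φ₁ ∨ₚ Φ₂) = dec Φ₁ ++ dec Φ₂ ++
  concatMap (λ x → concatMap (λ y →
      if isTopP (proj₂ x) ∨ isTopP (proj₂ y) then []
      else [ (proj₁ x ∧ₛ proj₁ y , proj₂ x ∨ₚ proj₂ y) ]) (dec Φ₂)) (dec Φ₁)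

NotNext : ∀ {k} → PF k → Set
NotNext (○ _) = ⊥
NotNext _ = ⊤

data IsGamma {k : ℕ} : SF k → Set where
  gD : ∀ {A Φ} → NotNext Φ → IsGamma (⟪ A ⟫ Φ)
  gB : ∀ {A Φ} → NotNext Φ → IsGamma (⟦ A ⟧ Φ)

compD : ∀ {k} → Coal k → SF k → PF k → SF k
compD A ψ Ψ = if isTopP Ψ then ψ else (ψ ∧ₛ (⟪ A ⟫ (○ (⟪ A ⟫ Ψ))))

compB : ∀ {k} → Coal k → SF k → PF k → SF k
compB A ψ Ψ = if isTopP Ψ then ψ else (ψ ∧ₛ (⟦ A ⟧ (○ (⟦ A ⟧ Ψ))))

data GammaComp {k : ℕ} : SF k → SF k → Set where
  gcD : ∀ {A Φ ψ Ψ} → NotNext Φ → (ψ , Ψ) ∈ˡ dec Φ → GammaComp (⟪ A ⟫ Φ) (compD A ψ Ψ)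
  gcB : ∀ {A Φ ψ Ψ} → NotNext Φ → (ψ , Ψ) ∈ˡ dec Φ → GammaComp (⟦ A ⟧ Φ) (compB A ψ Ψ)

data Comp {k : ℕ} : SF k → SF k → Set where
  αˡ : ∀ {φ ψ} → Comp (φ ∧ₛ ψ) φ
  αʳ : ∀ {φ ψ} → Comp (φ ∧ₛ ψ) ψ
  α𝔸 : ∀ {ψ} → Comp (⟦ full ⟧ (○ ψ)) (⟪ empty ⟫ (○ ψ))
  βˡ : ∀ {φ ψ} → Comp (φ ∨ₛ ψ) φ
  βʳ : ∀ {φ ψ} → Comp (φ ∨ₛ ψ) ψ
  γc : ∀ {ξ χ} → GammaComp ξ χ → Comp ξ χ
  sD : ∀ {A ψ} → Comp (⟪ A ⟫ (○ ψ)) ψ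
  sB : ∀ {A ψ} → A ≢ full → Comp (⟦ A ⟧ (○ ψ)) ψ

data Cl {k : ℕ} (Γ : SF k → Set) : SF k → Set where
  base : ∀ {φ} → Γ φ → Cl Γ φ
  top  : Cl Γ ⊤ₛ
  bot  : Cl Γ ⊥ₛ
  comp : ∀ {φ ψ} → Cl Γ φ → Comp φ ψ → Cl Γ ψ

-- A label: a set of state formulae together with the designation
-- ξ ↦ γ(ξ,Δ) of linked γ-components (only meaningful on γ-formulae in Δ).
record Label (k : ℕ) : Set₁ where
  constructor ⟨_,_⟩
  field
    set  : SF k → Set
    link : SF k → SF k
open Label public

record FullExp {k : ℕ} (Γ : SF k → Set) : Set₁ where
  field
    lab     : Label k
    sup     : ∀ φ → Γ φ → set lab φ
    sub     : ∀ φ → set lab φ → Cl Γ φ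
    no⊥     : ¬ set lab ⊥ₛ
    noclash : ∀ p → set lab (lit (pos p)) → set lab (lit (neg p)) → ⊥
    andC    : ∀ φ ψ → set lab (φ ∧ₛ ψ) → set lab φ × set lab ψ
    allA    : ∀ ψ → set lab (⟦ full ⟧ (○ ψ)) → set lab (⟪ empty ⟫ (○ ψ))
    orC     : ∀ φ ψ → set lab (φ ∨ₛ ψ) → set lab φ ⊎ set lab ψ
    gamC    : ∀ ξ → IsGamma ξ → set lab ξ → GammaComp ξ (link lab ξ) × set lab (link lab ξ)
open FullExp public

-- identity of labels (states are identified with their labels)
_≈_ : ∀ {k} → Label k → Label k → Set
Δ ≈ Δ' = (∀ φ → (set Δ φ → set Δ' φ) × (set Δ' φ → set Δ φ)) ×
         (∀ ξ → IsGamma ξ → set Δ ξ → link Δ ξ ≡ link Δ' ξ)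

NoNext : ∀ {k} → (SF k → Set) → Set
NoNext X = ∀ A φ → ¬ X (⟪ A ⟫ (○ φ)) × ¬ X (⟦ A ⟧ (○ φ))

HasNext : ∀ {k} → (SF k → Set) → Set
HasNext {k} X = Σ (Coal k) λ A → Σ (SF k) λ φ → X (⟪ A ⟫ (○ φ)) ⊎ X (⟦ A ⟧ (○ φ))

SRRel : ∀ {k} {Γ : SF k → Set} → FullExp Γ → Label k → Set
SRRel {k} E Δ =
  (NoNext (set (lab E)) ×
     Δ ≈ ⟨ (λ φ → set (lab E) φ ⊎ φ ≡ ⟪ full ⟫ (○ ⊤ₛ)) , link (lab E) ⟩)
  ⊎ (HasNext (set (lab E)) × Δ ≈ lab E)

-- A listing of the primitive successor formulae of a state:
-- (A₀,φ₀) … (A_{m-1},φ_{m-1}) for ⟪A_p⟫○φ_p and (A'₀,ψ₀) … for ⟦A'_q⟧○ψ_q.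
RawListing : ℕ → Set
RawListing k = List (Coal k × SF k) × List (Coal k × SF k)

ValidListing : ∀ {k} → Label k → RawListing k → Set
ValidListing {k} Δ (ds , bs) =
  (∀ (A : Coal k) φ → (set Δ (⟪ A ⟫ (○ φ)) → (A , φ) ∈ˡ ds) × ((A , φ) ∈ˡ ds → set Δ (⟪ A ⟫ (○ φ)))) ×
  (∀ (A : Coal k) ψ → ((A ≢ full × set Δ (⟦ A ⟧ (○ ψ))) → (A , ψ) ∈ˡ bs) ×
                      ((A , ψ) ∈ˡ bs → A ≢ full × set Δ (⟦ A ⟧ (○ ψ)))) ×
  Unique ds × Unique bs

_mod′_ : ℕ → ℕ → ℕ
x mod′ zero = x
x mod′ suc l = x % suc l

Real : ∀ {k} → PF k → (SF k → Set) → Set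
Real (st φ) Θ = Θ φ
Real (○ φ) Θ = ⊥
Real (□ φ) Θ = Θ φ
Real (φ U ψ) Θ = Θ ψ
Real (Φ ∧ₚ Ψ) Θ = Real Φ Θ × Real Ψ Θ
Real (Φ ∨ₚ Ψ) Θ = Real Φ Θ ⊎ Real Ψ Θ

-- The tableau procedure for η, relative to the choice `ord` of the
-- listing of primitive successor formulae at each state.

module Tableau {k : ℕ} (η : SF k) (ord : Label k → RawListing k) where

  dias : Label k → List (Coal k × SF k)
  dias Δ = proj₁ (ord Δ)

  boxes : Label k → List (Coal k × SF k)
  boxes Δ = proj₂ (ord Δ)

  m : Label k → ℕ
  m Δ = length (dias Δ)

  l : Label k → ℕ
  l Δ = length (boxes Δ)

  D : Label k → Set
  D Δ = Fin k → Fin (m Δ + l Δ)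

  InN : (Δ : Label k) → D Δ → Fin k → Set
  InN Δ σ a = m Δ ≤ toℕ (σ a)

  co : (Δ : Label k) → D Δ → ℕ
  co Δ σ = sum (map (λ a → if m Δ ≤ᵇ toℕ (σ a) then toℕ (σ a) ∸ m Δ else 0) (allFin k)) mod′ l Δ

  Γσ₀ : (Δ : Label k) → D Δ → SF k → Set
  Γσ₀ Δ σ φ =
    (Σ (Fin (m Δ)) λ p → proj₂ (lookup (dias Δ) p) ≡ φ ×
        (∀ a → a ∈ proj₁ (lookup (dias Δ) p) → toℕ (σ a) ≡ toℕ p))
    ⊎ (Σ (Fin (l Δ)) λ q → proj₂ (lookup (boxes Δ) q) ≡ φ × co Δ σ ≡ toℕ q ×
        (∀ a → a ∉ proj₁ (lookup (boxes Δ) q) → InN Δ σ a))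

  Γσ : (Δ : Label k) → D Δ → SF k → Set
  Γσ Δ σ φ = Γσ₀ Δ σ φ ⊎ (φ ≡ ⊤ₛ × ¬ Σ (SF k) (Γσ₀ Δ σ))

  Edge : (Δ : Label k) → D Δ → Label k → Set₁
  Edge Δ σ Δ' = Σ (FullExp (Γσ Δ σ)) λ E → SRRel E Δ'

  data StR : Label k → Set₁ where
    init : ∀ {Δ} → (E : FullExp (λ φ → φ ≡ η)) → SRRel E Δ → StR Δ
    next : ∀ {Δ Δ'} → StR Δ → (σ : D Δ) → Edge Δ σ Δ' → StR Δ'

  GoodOrd : Set₁
  GoodOrd = (∀ Δ → StR Δ → ValidListing Δ (ord Δ)) ×
            (∀ Δ Δ' → StR Δ → StR Δ' → Δ ≈ Δ' → ord Δ ≡ ord Δ')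

  data Realized (S : Label k → Set₁) : SF k → Label k → Set₁ where
    nowD : ∀ {A Φ Δ} → Real Φ (set Δ) → Realized S (⟪ A ⟫ Φ) Δ
    nowB : ∀ {A Φ Δ} → Real Φ (set Δ) → Realized S (⟦ A ⟧ Φ) Δ
    laterD : ∀ {A Φ Δ ψ ξ'} →
      link Δ (⟪ A ⟫ Φ) ≡ (ψ ∧ₛ (⟪ A ⟫ (○ ξ'))) →
      (p : Fin (m Δ)) → lookup (dias Δ) p ≡ (A , ξ') →
      (∀ (σ : D Δ) → (∀ a → a ∈ A → toℕ (σ a) ≡ toℕ p) →
         Σ (Label k) λ Δ' → S Δ' × Edge Δ σ Δ' × Realized S ξ' Δ') →
      Realized S (⟪ A ⟫ Φ) Δ
    laterB : ∀ {A Φ Δ ψ ξ'} →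
      link Δ (⟦ A ⟧ Φ) ≡ (ψ ∧ₛ (⟦ A ⟧ (○ ξ'))) →
      (q : Fin (l Δ)) → lookup (boxes Δ) q ≡ (A , ξ') →
      (∀ (σ : D Δ) → co Δ σ ≡ toℕ q → (∀ a → a ∉ A → InN Δ σ a) →
         Σ (Label k) λ Δ' → S Δ' × Edge Δ σ Δ' × Realized S ξ' Δ') →
      Realized S (⟦ A ⟧ Φ) Δ

  ER1 : (Label k → Set₁) → Label k → Set₁
  ER1 S Δ = Σ (D Δ) λ σ → ¬ Σ (Label k) λ Δ' → S Δ' × Edge Δ σ Δ'

  ER2 : (Label k → Set₁) → Label k → Set₁
  ER2 S Δ = Σ (SF k) λ ξ → IsGamma ξ × set Δ ξ × ¬ Realized S ξ Δ

  data ElimRun : (Label k → Set₁) → Set₂ where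
    start : ElimRun StR
    del   : ∀ {S} → ElimRun S → (Δ : Label k) → S Δ → ER1 S Δ ⊎ ER2 S Δ →
            ElimRun (λ Δ'' → S Δ'' × ¬ (Δ'' ≈ Δ))

  Final : (Label k → Set₁) → Set₁
  Final S = ∀ Δ → S Δ → ¬ (ER1 S Δ ⊎ ER2 S Δ)

  Open : (Label k → Set₁) → Set₁
  Open S = Σ (Label k) λ Δ → S Δ × set Δ η

{-# OPTIONS --safe #-}
-- The model has as states the tableau states paired with a scheduler that serves all γ-formulae
-- in round-robin order: while the formula being served is unrealised, successors are chosen along
-- its realisation. A strategy for ξ = ⟪A⟫Φ or ⟦A⟧Φ recomputes from the history the formula that
-- ξ has become along the linked components and plays the listed successor formula. The path
-- formulae met in this way only shrink, hence eventually stay constant; once the constant formula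
-- has been served, Real holds at some state and the □-parts hold from there on, which makes it
-- true, and decompositions carry truth back to the start of the play.
--
-- Labels are arbitrary predicates and finality of the tableau is a negative statement, so nothing
-- can be chosen from the tableau directly. But all labels live in a finite closure, so the finite
-- structure needed for the model is found by exhaustive search, the tableau showing that it
-- cannot fail to exist.
--
-- Whether a formula with ∨ₚ stays constant along a play is not decidable. When an ∨ₚ-free component is
-- available the strategy switches to it and the question disappears. Otherwise excluded
-- middle follows from the existence of listings: the ∨ₚ-free component can be added to
-- the label on condition that an arbitrary proposition P holds, and the listing of the state
-- so obtained decides P.
module Submission where

open import Data.Bool using (true; false; if_then_else_; T; _∨_)
open import Data.Bool.Properties using (T?)
import Data.Bool.Properties as Boolₚ
open import Data.Empty using (⊥; ⊥-elim)
open import Data.Fin using (Fin; zero; suc; toℕ)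
import Data.Fin.Properties as Finₚ
open import Data.Fin.Subset using (_∈_; _∉_) renaming (⊤ to full; ⊥ to empty)
open import Data.Fin.Subset.Properties using (_∈?_; ∉⊥)
open import Data.List using (List; []; _∷_; [_]; _++_; map; concatMap; length; filter; cartesianProduct; cartesianProductWith; lookup; allFin; tabulate)
open import Data.List.Membership.Propositional using (find; lose) renaming (_∈_ to _∈ˡ_)
open import Data.List.Membership.Propositional.Properties
open import Data.List.NonEmpty using (List⁺; _∷_)
open import Data.List.Properties using (length-filter; map-cong; map-tabulate; tabulate-cong)
open import Data.List.Relation.Unary.All using (All; []; _∷_; all?)
import Data.List.Relation.Unary.All as All
open import Data.List.Relation.Unary.AllPairs using (_∷_)
open import Data.List.Relation.Unary.Any using (Any; here; there; any?)
import Data.List.Relation.Unary.Any as Any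
open import Data.List.Relation.Unary.Unique.Propositional using (Unique)
open import Data.Maybe using (Maybe; just; nothing)
import Data.Maybe as Maybe
import Data.Maybe.Properties as Maybeₚ
open import Data.Nat using (ℕ; zero; suc; _+_; _≤_; _<_; z≤n; s≤s; _∸_; _≤ᵇ_; NonZero)
open import Data.Nat.DivMod using (_mod_; _%_; m<n⇒m%n≡m; m%n<n; %-distribˡ-+; m%n%n≡m%n; [m+n]%n≡m%n)
open import Data.Nat.Induction using (<-wellFounded)
open import Data.Nat.ListAction using (sum)
import Data.Nat.Properties as ℕₚ
open import Data.Product using (Σ; _×_; _,_; proj₁; proj₂; ∃; uncurry)
import Data.Product.Properties as ×ₚ
open import Data.Sum using (_⊎_; inj₁; inj₂)
open import Data.Unit using (⊤; tt)
open import Data.Vec using (Vec; []; _∷_; there) renaming (lookup to vlookup; tabulate to vtabulate)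
open import Data.Vec.Properties using (lookup∘tabulate)
import Data.Vec.Properties as Vecₚ
open import Defs
open import Function using (id; _∘_)
open import Induction.WellFounded using (Acc; acc)
open import Level using (Level)
open import Relation.Binary.PropositionalEquality using (_≡_; _≢_; refl; sym; trans; cong; subst; cong₂; module ≡-Reasoning)
open import Relation.Nullary using (¬_; Dec; yes; no)
open import Relation.Nullary.Decidable using (map′; _×-dec_; _⊎-dec_; _→-dec_; ¬?)

-- A tableau state may hold several eventualities, each realised along successors of its own, while
-- a game has only one successor per action profile. Hence a game state must record which
-- eventuality now chooses the successor. The others survive such a detour as obligations, but
-- possibly rewritten by decompositions. This dictates the induction on a rank of path formulae:
-- either an obligation has changed, so that it is discharged or its rank has dropped, or it is
-- still the same formula when its turn comes. The initial fuel of a goal is the stage at which the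
-- iteration defining realisation becomes stationary on the finitely many codes.
--
-- Finality yields doubly negated facts only, while satisfiability asks for actual strategies.
-- Double negation is therefore removed only at decidable statements, and the tableau must be
-- replaced by something about which everything of interest is decidable: lists of codes, for which
-- `ord`, a function into finite lists, makes even reachability a terminating computation.

private variable
  a b p : Level
  k : ℕ

-- Double negation, finite comprehension and finite fixed points

return : {A : Set a} → A → ¬ ¬ A
return x k = k x

_>>=_ : {A : Set a} {B : Set b} → ¬ ¬ A → (A → ¬ ¬ B) → ¬ ¬ B
(m >>= f) k = m (λ x → f x k)

¬¬-em : {P : Set p} → ¬ ¬ (P ⊎ ¬ P)
¬¬-em k = k (inj₂ (λ x → k (inj₁ x)))

stable : {P : Set p} → Dec P → ¬ ¬ P → P
stable (yes x) _ = x
stable (no ¬x) k = ⊥-elim (k ¬x)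

_≐_on_ : {A : Set} → List A → (A → Set p) → List A → Set p
ys ≐ P on xs = ∀ x → (x ∈ˡ ys → (x ∈ˡ xs × P x)) × (x ∈ˡ xs → P x → x ∈ˡ ys)

sublists : {A : Set} → List A → List (List A)
sublists [] = [ [] ]
sublists (x ∷ xs) = map (x ∷_) (sublists xs) ++ sublists xs

-- Each element costs one doubly negated case distinction. Membership in `sublists xs` places the
-- result among finitely many candidates, over which a search can run.
comprehension : {A : Set} (P : A → Set p) (xs : List A) →
                ¬ ¬ Σ (List A) λ ys → ys ∈ˡ sublists xs × (ys ≐ P on xs)
comprehension P [] = return ([] , here refl , λ x → (λ ()) , (λ ()))
comprehension P (x ∷ xs) = do
  ys , m , eq ← comprehension P xs
  inj₁ px ← ¬¬-em {P = P x}
    where inj₂ ¬px → return (ys , ∈-++⁺ʳ _ m , λ y →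
                       (λ i → there (proj₁ (proj₁ (eq y) i)) , proj₂ (proj₁ (eq y) i)) ,
                       λ { (here refl) py → ⊥-elim (¬px py) ; (there i) py → proj₂ (eq y) i py })
  return (x ∷ ys , ∈-++⁺ˡ (∈-map⁺ (x ∷_) m) , λ y →
    (λ { (here refl) → here refl , px
       ; (there i) → there (proj₁ (proj₁ (eq y) i)) , proj₂ (proj₁ (eq y) i) }) ,
    λ { (here refl) py → here refl ; (there i) py → there (proj₂ (eq y) i py) })

-- Action profiles are searched as vectors: functions on `Fin k` could be exhausted only up to
-- pointwise equality.
∀Vec? : ∀ {r} n {P : Vec (Fin r) n → Set} → (∀ v → Dec (P v)) → Dec (∀ v → P v)
∀Vec? zero P? = map′ (λ x → λ { [] → x }) (λ f → f []) (P? [])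
∀Vec? (suc n) P? =
  map′ (λ f → λ { (x ∷ v) → f x v }) (λ f x v → f (x ∷ v))
       (Finₚ.all? (λ x → ∀Vec? n (λ v → P? (x ∷ v))))

∃Vec? : ∀ {r} n {P : Vec (Fin r) n → Set} → (∀ v → Dec (P v)) → Dec (∃ P)
∃Vec? zero P? = map′ ([] ,_) (λ { ([] , x) → x }) (P? [])
∃Vec? (suc n) P? =
  map′ (λ { (x , v , y) → (x ∷ v) , y }) (λ { ((x ∷ v) , y) → x , v , y })
       (Finₚ.any? (λ x → ∃Vec? n (λ v → P? (x ∷ v))))

module _ {A : Set} {P Q : A → Set} (P? : ∀ x → Dec (P x)) (Q? : ∀ x → Dec (Q x))
         (P⊆Q : ∀ x → P x → Q x) where

  filter-mono : ∀ xs → length (filter P? xs) ≤ length (filter Q? xs)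
  filter-mono [] = z≤n
  filter-mono (x ∷ xs) with P? x | Q? x
  ... | yes px | yes qx = s≤s (filter-mono xs)
  ... | yes px | no ¬qx = ⊥-elim (¬qx (P⊆Q x px))
  ... | no ¬px | yes qx = ℕₚ.m≤n⇒m≤1+n (filter-mono xs)
  ... | no ¬px | no ¬qx = filter-mono xs

  filter-strict : ∀ xs → ¬ All (λ x → Q x → P x) xs → length (filter P? xs) < length (filter Q? xs)
  filter-strict [] ¬all = ⊥-elim (¬all [])
  filter-strict (x ∷ xs) ¬all with P? x | Q? x
  ... | yes px | yes qx = s≤s (filter-strict xs (λ ps → ¬all ((λ _ → px) ∷ ps)))
  ... | yes px | no ¬qx = ⊥-elim (¬qx (P⊆Q x px))
  ... | no ¬px | yes qx = s≤s (filter-mono xs)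
  ... | no ¬px | no ¬qx = filter-strict xs (λ ps → ¬all ((λ qx → ⊥-elim (¬qx qx)) ∷ ps))

module Approximants {A : Set} (F : (A → Set) → (A → Set))
  (mono : ∀ {P Q : A → Set} → (∀ x → P x → Q x) → ∀ x → F P x → F Q x)
  (F? : ∀ {P : A → Set} → (∀ x → Dec (P x)) → ∀ x → Dec (F P x))
  (univ : List A) where

  It : ℕ → A → Set
  It zero x = ⊥
  It (suc n) = F (It n)

  It? : ∀ n x → Dec (It n x)
  It? zero x = no λ ()
  It? (suc n) = F? (It? n)

  It-up : ∀ n x → It n x → It (suc n) x
  It-up (suc n) = mono (It-up n)

  private
    count : ℕ → ℕ
    count n = length (filter (It? n) univ)

    -- Each stage that is not closed adds an element of `univ` to the next one, so `count` grows
    -- whenever fuel is spent. Without fuel a further growth would exceed `length univ`.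
    search : ∀ fuel n → length univ ≤ fuel + count n →
             ∃ λ n → ∀ x → x ∈ˡ univ → It (suc n) x → It n x
    search fuel n le with all? (λ x → It? (suc n) x →-dec It? n x) univ
    ... | yes closed = n , λ x i → All.lookup closed i
    search zero n le | no ¬closed = ⊥-elim (ℕₚ.<-irrefl refl (ℕₚ.<-≤-trans
      (filter-strict (It? n) (It? (suc n)) (It-up n) univ ¬closed)
      (ℕₚ.≤-trans (length-filter (It? (suc n)) univ) le)))
    search (suc fuel) n le | no ¬closed = search fuel (suc n) (ℕₚ.≤-trans le
      (subst (_≤ fuel + count (suc n)) (ℕₚ.+-suc fuel (count n))
        (ℕₚ.+-monoʳ-≤ fuel (filter-strict (It? n) (It? (suc n)) (It-up n) univ ¬closed))))

  abstract
    stage : ℕ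
    stage = proj₁ (search (length univ) 0 (ℕₚ.m≤m+n _ _))

    stage-closed : ∀ x → x ∈ˡ univ → It (suc stage) x → It stage x
    stage-closed = proj₂ (search (length univ) 0 (ℕₚ.m≤m+n _ _))

-- Decidable equality of formulae

_≟L_ : (x y : Lit) → Dec (x ≡ y)
pos m ≟L pos n = map′ (cong pos) (λ { refl → refl }) (m ℕₚ.≟ n)
pos _ ≟L neg _ = no λ ()
neg _ ≟L pos _ = no λ ()
neg m ≟L neg n = map′ (cong neg) (λ { refl → refl }) (m ℕₚ.≟ n)

_≟C_ : ∀ {k} (A B : Coal k) → Dec (A ≡ B)
_≟C_ = Vecₚ.≡-dec Boolₚ._≟_

private
  both : ∀ {A B C : Set} {f : A → B → C} →
         (∀ {x y x′ y′} → f x y ≡ f x′ y′ → x ≡ x′ × y ≡ y′) →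
         ∀ {x y x′ y′} → Dec (x ≡ x′) → Dec (y ≡ y′) → Dec (f x y ≡ f x′ y′)
  both inj (yes refl) (yes refl) = yes refl
  both inj (no x≢) _ = no λ eq → x≢ (proj₁ (inj eq))
  both inj (yes _) (no y≢) = no λ eq → y≢ (proj₂ (inj eq))

mutual
  _≟S_ : ∀ {k} (φ ψ : SF k) → Dec (φ ≡ ψ)
  lit x ≟S lit y = map′ (cong lit) (λ { refl → refl }) (x ≟L y)
  (φ ∨ₛ ψ) ≟S (φ′ ∨ₛ ψ′) = both (λ { refl → refl , refl }) (φ ≟S φ′) (ψ ≟S ψ′)
  (φ ∧ₛ ψ) ≟S (φ′ ∧ₛ ψ′) = both (λ { refl → refl , refl }) (φ ≟S φ′) (ψ ≟S ψ′)
  (⟪ A ⟫ Φ) ≟S (⟪ B ⟫ Ψ) = both (λ { refl → refl , refl }) (A ≟C B) (Φ ≟P Ψ)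
  (⟦ A ⟧ Φ) ≟S (⟦ B ⟧ Ψ) = both (λ { refl → refl , refl }) (A ≟C B) (Φ ≟P Ψ)
  (lit _) ≟S (_ ∨ₛ _) = no λ ()
  (lit _) ≟S (_ ∧ₛ _) = no λ ()
  (lit _) ≟S (⟪ _ ⟫ _) = no λ ()
  (lit _) ≟S (⟦ _ ⟧ _) = no λ ()
  (_ ∨ₛ _) ≟S (lit _) = no λ ()
  (_ ∨ₛ _) ≟S (_ ∧ₛ _) = no λ ()
  (_ ∨ₛ _) ≟S (⟪ _ ⟫ _) = no λ ()
  (_ ∨ₛ _) ≟S (⟦ _ ⟧ _) = no λ ()
  (_ ∧ₛ _) ≟S (lit _) = no λ ()
  (_ ∧ₛ _) ≟S (_ ∨ₛ _) = no λ ()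
  (_ ∧ₛ _) ≟S (⟪ _ ⟫ _) = no λ ()
  (_ ∧ₛ _) ≟S (⟦ _ ⟧ _) = no λ ()
  (⟪ _ ⟫ _) ≟S (lit _) = no λ ()
  (⟪ _ ⟫ _) ≟S (_ ∨ₛ _) = no λ ()
  (⟪ _ ⟫ _) ≟S (_ ∧ₛ _) = no λ ()
  (⟪ _ ⟫ _) ≟S (⟦ _ ⟧ _) = no λ ()
  (⟦ _ ⟧ _) ≟S (lit _) = no λ ()
  (⟦ _ ⟧ _) ≟S (_ ∨ₛ _) = no λ ()
  (⟦ _ ⟧ _) ≟S (_ ∧ₛ _) = no λ ()
  (⟦ _ ⟧ _) ≟S (⟪ _ ⟫ _) = no λ ()

  _≟P_ : ∀ {k} (Φ Ψ : PF k) → Dec (Φ ≡ Ψ)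
  st φ ≟P st ψ = map′ (cong st) (λ { refl → refl }) (φ ≟S ψ)
  (○ φ) ≟P (○ ψ) = map′ (cong ○_) (λ { refl → refl }) (φ ≟S ψ)
  (□ φ) ≟P (□ ψ) = map′ (cong □_) (λ { refl → refl }) (φ ≟S ψ)
  (φ U ψ) ≟P (φ′ U ψ′) = both (λ { refl → refl , refl }) (φ ≟S φ′) (ψ ≟S ψ′)
  (Φ ∨ₚ Ψ) ≟P (Φ′ ∨ₚ Ψ′) = both (λ { refl → refl , refl }) (Φ ≟P Φ′) (Ψ ≟P Ψ′)
  (Φ ∧ₚ Ψ) ≟P (Φ′ ∧ₚ Ψ′) = both (λ { refl → refl , refl }) (Φ ≟P Φ′) (Ψ ≟P Ψ′)
  (st _) ≟P (○ _) = no λ ()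
  (st _) ≟P (□ _) = no λ ()
  (st _) ≟P (_ U _) = no λ ()
  (st _) ≟P (_ ∨ₚ _) = no λ ()
  (st _) ≟P (_ ∧ₚ _) = no λ ()
  (○ _) ≟P (st _) = no λ ()
  (○ _) ≟P (□ _) = no λ ()
  (○ _) ≟P (_ U _) = no λ ()
  (○ _) ≟P (_ ∨ₚ _) = no λ ()
  (○ _) ≟P (_ ∧ₚ _) = no λ ()
  (□ _) ≟P (st _) = no λ ()
  (□ _) ≟P (○ _) = no λ ()
  (□ _) ≟P (_ U _) = no λ ()
  (□ _) ≟P (_ ∨ₚ _) = no λ ()
  (□ _) ≟P (_ ∧ₚ _) = no λ ()
  (_ U _) ≟P (st _) = no λ ()
  (_ U _) ≟P (○ _) = no λ ()
  (_ U _) ≟P (□ _) = no λ ()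
  (_ U _) ≟P (_ ∨ₚ _) = no λ ()
  (_ U _) ≟P (_ ∧ₚ _) = no λ ()
  (_ ∨ₚ _) ≟P (st _) = no λ ()
  (_ ∨ₚ _) ≟P (○ _) = no λ ()
  (_ ∨ₚ _) ≟P (□ _) = no λ ()
  (_ ∨ₚ _) ≟P (_ U _) = no λ ()
  (_ ∨ₚ _) ≟P (_ ∧ₚ _) = no λ ()
  (_ ∧ₚ _) ≟P (st _) = no λ ()
  (_ ∧ₚ _) ≟P (○ _) = no λ ()
  (_ ∧ₚ _) ≟P (□ _) = no λ ()
  (_ ∧ₚ _) ≟P (_ U _) = no λ ()
  (_ ∧ₚ _) ≟P (_ ∨ₚ _) = no λ ()

-- The two path quantifiers

data Mod (k : ℕ) : Set where
  dia box : Coal k → Mod k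

mk : Mod k → PF k → SF k
mk (dia A) Φ = ⟪ A ⟫ Φ
mk (box A) Φ = ⟦ A ⟧ Φ

nxt : Mod k → PF k → SF k
nxt μ Ψ = mk μ (○ (mk μ Ψ))

compM : Mod k → SF k → PF k → SF k
compM μ ψ Ψ = if isTopP Ψ then ψ else (ψ ∧ₛ nxt μ Ψ)

-- ⟦𝔸⟧○φ is not a primitive successor formula: it acts through its α-component ⟪∅⟫○φ.
norm : Mod k → Mod k
norm (dia A) = dia A
norm (box A) with A ≟C full
... | yes _ = dia empty
... | no _ = box A

data NextView {k} : PF k → Set where
  isNext : ∀ φ → NextView (○ φ)
  notNext : ∀ {Φ} → NotNext Φ → NextView Φ

nextView : (Φ : PF k) → NextView Φ
nextView (st _) = notNext tt
nextView (○ φ) = isNext φ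
nextView (□ _) = notNext tt
nextView (_ U _) = notNext tt
nextView (_ ∨ₚ _) = notNext tt
nextView (_ ∧ₚ _) = notNext tt

gammaM : ∀ (μ : Mod k) {Φ} → NotNext Φ → IsGamma (mk μ Φ)
gammaM (dia A) = gD
gammaM (box A) = gB

gammaComp : ∀ (μ : Mod k) {Φ ψ Ψ} → NotNext Φ → (ψ , Ψ) ∈ˡ dec Φ → GammaComp (mk μ Φ) (compM μ ψ Ψ)
gammaComp (dia A) = gcD
gammaComp (box A) = gcB

gammaComp⁻ : ∀ (μ : Mod k) {Φ χ} → GammaComp (mk μ Φ) χ →
             Σ (SF k) λ ψ → Σ (PF k) λ Ψ → (ψ , Ψ) ∈ˡ dec Φ × χ ≡ compM μ ψ Ψ
gammaComp⁻ (dia A) (gcD _ i) = _ , _ , i , refl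
gammaComp⁻ (box A) (gcB _ i) = _ , _ , i , refl

-- `norm` turns a box into a diamond exactly for the full coalition, the only successor formula
-- whose component is again a successor formula.
compsM : Mod k → PF k → List (SF k)
compsM μ Φ with nextView Φ
... | isNext φ with norm μ | μ
...   | dia _ | box _ = [ ⟪ empty ⟫ (○ φ) ]
...   | _ | _ = [ φ ]
compsM μ Φ | notNext _ = map (uncurry (compM μ)) (dec Φ)

comps : SF k → List (SF k)
comps (lit _) = []
comps (φ ∨ₛ ψ) = φ ∷ ψ ∷ []
comps (φ ∧ₛ ψ) = φ ∷ ψ ∷ []
comps (⟪ A ⟫ Φ) = compsM (dia A) Φ
comps (⟦ A ⟧ Φ) = compsM (box A) Φ

comps⁺ : {φ ψ : SF k} → Comp φ ψ → ψ ∈ˡ comps φ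
comps⁺ αˡ = here refl
comps⁺ αʳ = there (here refl)
comps⁺ {k} α𝔸 with full {k} ≟C full
... | yes _ = here refl
... | no ¬p = ⊥-elim (¬p refl)
comps⁺ βˡ = here refl
comps⁺ βʳ = there (here refl)
comps⁺ (γc (gcD {Φ = Φ} nn i)) with nextView Φ
... | isNext _ = ⊥-elim nn
... | notNext _ = ∈-map⁺ _ i
comps⁺ (γc (gcB {Φ = Φ} nn i)) with nextView Φ
... | isNext _ = ⊥-elim nn
... | notNext _ = ∈-map⁺ _ i
comps⁺ sD = here refl
comps⁺ (sB {A} A≢) with A ≟C full
... | yes p = ⊥-elim (A≢ p)
... | no _ = here refl

comps⁻ : (φ : SF k) {ψ : SF k} → ψ ∈ˡ comps φ → Comp φ ψ
comps⁻ (φ ∨ₛ ψ) (here refl) = βˡ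
comps⁻ (φ ∨ₛ ψ) (there (here refl)) = βʳ
comps⁻ (φ ∧ₛ ψ) (here refl) = αˡ
comps⁻ (φ ∧ₛ ψ) (there (here refl)) = αʳ
comps⁻ (⟪ A ⟫ Φ) i with nextView Φ
comps⁻ (⟪ A ⟫ _) (here refl) | isNext φ = sD
... | notNext nn with ∈-map⁻ _ i
...   | _ , j , refl = γc (gcD nn j)
comps⁻ (⟦ A ⟧ Φ) i with nextView Φ
comps⁻ (⟦ A ⟧ _) i | isNext φ with A ≟C full
comps⁻ (⟦ A ⟧ _) (here refl) | isNext φ | yes refl = α𝔸
comps⁻ (⟦ A ⟧ _) (here refl) | isNext φ | no A≢ = sB A≢
comps⁻ (⟦ A ⟧ _) i | notNext nn with ∈-map⁻ _ i
...   | _ , j , refl = γc (gcB nn j)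

-- Finiteness of the closure

Closed : List (SF k) → Set
Closed L = ∀ {φ ψ} → φ ∈ˡ L → Comp φ ψ → ψ ∈ˡ L

Closed-++ : ∀ {L M : List (SF k)} → Closed L → Closed M → Closed (L ++ M)
Closed-++ {L = L} cL cM i c with ∈-++⁻ L i
... | inj₁ j = ∈-++⁺ˡ (cL j c)
... | inj₂ j = ∈-++⁺ʳ L (cM j c)

Cl⊆ : ∀ {Γ : SF k → Set} {L} → Closed L → ⊤ₛ ∈ˡ L → ⊥ₛ ∈ˡ L → (∀ φ → Γ φ → φ ∈ˡ L) →
      ∀ {φ} → Cl Γ φ → φ ∈ˡ L
Cl⊆ cL t b Γ⊆ (base x) = Γ⊆ _ x
Cl⊆ cL t b Γ⊆ top = t
Cl⊆ cL t b Γ⊆ bot = b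
Cl⊆ cL t b Γ⊆ (comp x c) = cL (Cl⊆ cL t b Γ⊆ x) c

dec-∧⁻ : ∀ (Φ₁ Φ₂ : PF k) {x} → x ∈ˡ dec (Φ₁ ∧ₚ Φ₂) →
         Σ (SF k × PF k) λ x₁ → Σ (SF k × PF k) λ x₂ → x₁ ∈ˡ dec Φ₁ × x₂ ∈ˡ dec Φ₂ ×
         x ≡ (proj₁ x₁ ∧ₛ proj₁ x₂ , proj₂ x₁ ∧ₚ proj₂ x₂)
dec-∧⁻ Φ₁ Φ₂ i with find (∈-concatMap⁻ (λ x → map (pair x) (dec Φ₂)) {dec Φ₁} i)
  where
  pair : SF _ × PF _ → SF _ × PF _ → SF _ × PF _
  pair x y = proj₁ x ∧ₛ proj₁ y , proj₂ x ∧ₚ proj₂ y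
... | x₁ , i₁ , j with ∈-map⁻ _ j
...   | x₂ , i₂ , eq = x₁ , x₂ , i₁ , i₂ , eq

dec-∧⁺ : ∀ (Φ₁ Φ₂ : PF k) {x₁ x₂} → x₁ ∈ˡ dec Φ₁ → x₂ ∈ˡ dec Φ₂ →
         (proj₁ x₁ ∧ₛ proj₁ x₂ , proj₂ x₁ ∧ₚ proj₂ x₂) ∈ˡ dec (Φ₁ ∧ₚ Φ₂)
dec-∧⁺ Φ₁ Φ₂ i₁ i₂ = ∈-concat⁺′ (∈-map⁺ _ i₂) (∈-map⁺ _ i₁)

data Dec∨ {k} (Φ₁ Φ₂ : PF k) : SF k × PF k → Set where
  left  : ∀ {x} → x ∈ˡ dec Φ₁ → Dec∨ Φ₁ Φ₂ x
  right : ∀ {x} → x ∈ˡ dec Φ₂ → Dec∨ Φ₁ Φ₂ x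
  mixed : ∀ {x₁ x₂} → x₁ ∈ˡ dec Φ₁ → x₂ ∈ˡ dec Φ₂ →
          Dec∨ Φ₁ Φ₂ (proj₁ x₁ ∧ₛ proj₁ x₂ , proj₂ x₁ ∨ₚ proj₂ x₂)

dec-∨⁻ : ∀ (Φ₁ Φ₂ : PF k) {x} → x ∈ˡ dec (Φ₁ ∨ₚ Φ₂) → Dec∨ Φ₁ Φ₂ x
dec-∨⁻ Φ₁ Φ₂ i with ∈-++⁻ (dec Φ₁) i
... | inj₁ j = left j
... | inj₂ j with ∈-++⁻ (dec Φ₂) j
...   | inj₁ l = right l
...   | inj₂ l with find (∈-concatMap⁻ (λ x → concatMap (pick x) (dec Φ₂)) {dec Φ₁} l)
  where
  pick : SF _ × PF _ → SF _ × PF _ → List (SF _ × PF _)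
  pick x y = if isTopP (proj₂ x) ∨ isTopP (proj₂ y) then []
             else [ (proj₁ x ∧ₛ proj₁ y , proj₂ x ∨ₚ proj₂ y) ]
...     | x₁ , i₁ , l₁ with find (∈-concatMap⁻ _ {dec Φ₂} l₁)
...       | x₂ , i₂ , l₂ with isTopP (proj₂ x₁) ∨ isTopP (proj₂ x₂) | l₂
...         | false | here refl = mixed i₁ i₂

dec-∨ˡ : ∀ (Φ₁ Φ₂ : PF k) {x} → x ∈ˡ dec Φ₁ → x ∈ˡ dec (Φ₁ ∨ₚ Φ₂)
dec-∨ˡ Φ₁ Φ₂ i = ∈-++⁺ˡ i

dec-∨ʳ : ∀ (Φ₁ Φ₂ : PF k) {x} → x ∈ˡ dec Φ₂ → x ∈ˡ dec (Φ₁ ∨ₚ Φ₂)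
dec-∨ʳ Φ₁ Φ₂ i = ∈-++⁺ʳ (dec Φ₁) (∈-++⁺ˡ i)

isTopP-⊤ : (Φ : PF k) → T (isTopP Φ) → Φ ≡ ⊤ₚ
isTopP-⊤ (st (lit (pos zero) ∨ₛ lit (neg zero))) _ = refl

dec-notNext : ∀ (Φ : PF k) {ψ Ψ} → (ψ , Ψ) ∈ˡ dec Φ → NotNext Ψ
dec-notNext (st x) (here refl) = tt
dec-notNext (○ x) (here refl) = tt
dec-notNext (□ x) (here refl) = tt
dec-notNext (x U x₁) (here refl) = tt
dec-notNext (x U x₁) (there (here refl)) = tt
dec-notNext (Φ₁ ∨ₚ Φ₂) i with dec-∨⁻ Φ₁ Φ₂ i
... | left j = dec-notNext Φ₁ j
... | right j = dec-notNext Φ₂ j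
... | mixed _ _ = tt
dec-notNext (Φ₁ ∧ₚ Φ₂) i with dec-∧⁻ Φ₁ Φ₂ i
... | _ , _ , _ , _ , refl = tt

record Closure (φ : SF k) : Set where
  field
    list   : List (SF k)
    self   : φ ∈ˡ list
    closed : Closed list
open Closure

-- Decomposition never looks at the quantifier in front of Φ. So the remainders of Φ and the state
-- formulae split off on the way are collected once, and `Modal` adds a quantifier afterwards.
record PathClosure (Φ : PF k) : Set where
  field
    states    : List (SF k)
    paths     : List (PF k)
    selfₚ     : Φ ∈ˡ paths
    closedₚ   : Closed states
    dec-state : ∀ {Ψ ψ Ψ′} → Ψ ∈ˡ paths → (ψ , Ψ′) ∈ˡ dec Ψ → ψ ∈ˡ states
    dec-path  : ∀ {Ψ ψ Ψ′} → Ψ ∈ˡ paths → (ψ , Ψ′) ∈ˡ dec Ψ → Ψ′ ∈ˡ paths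
    next      : ∀ {φ} → (○ φ) ∈ˡ paths → φ ∈ˡ states

module _ (L M : List (SF k)) where
  private
    J : List (SF k)
    J = cartesianProductWith _∧ₛ_ L M

  joined : List (SF k)
  joined = L ++ M ++ J

  joined-L : ∀ {φ} → φ ∈ˡ L → φ ∈ˡ joined
  joined-L = ∈-++⁺ˡ

  joined-M : ∀ {φ} → φ ∈ˡ M → φ ∈ˡ joined
  joined-M i = ∈-++⁺ʳ L (∈-++⁺ˡ i)

  joined-∧ : ∀ {φ ψ} → φ ∈ˡ L → ψ ∈ˡ M → (φ ∧ₛ ψ) ∈ˡ joined
  joined-∧ i j = ∈-++⁺ʳ L (∈-++⁺ʳ M (∈-cartesianProductWith⁺ _∧ₛ_ i j))

  joined-closed : Closed L → Closed M → Closed joined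
  joined-closed cL cM i c with ∈-++⁻ L i
  ... | inj₁ j = joined-L (cL j c)
  ... | inj₂ j with ∈-++⁻ M j
  ...   | inj₁ l = joined-M (cM l c)
  ...   | inj₂ l with ∈-cartesianProductWith⁻ _∧ₛ_ L M l
  joined-closed cL cM i αˡ | inj₂ j | inj₂ l | _ , _ , x , y , refl = joined-L x
  joined-closed cL cM i αʳ | inj₂ j | inj₂ l | _ , _ , x , y , refl = joined-M y
  joined-closed cL cM i (γc ()) | inj₂ j | inj₂ l | _ , _ , x , y , refl

module Modal (μ : Mod k) {Φ : PF k} (pc : PathClosure Φ) where
  open PathClosure pc

  -- The shapes that components of `mk μ Φ` can take. `all` and `allM` arise from the α-rule for the
  -- full coalition; admitting them for every μ spares a case distinction on it.
  data Member : SF k → Set where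
    old  : ∀ {φ} → φ ∈ˡ states → Member φ
    all  : ∀ {φ} → φ ∈ˡ states → Member (⟪ empty ⟫ (○ φ))
    mod  : ∀ {Ψ} → Ψ ∈ˡ paths → Member (mk μ Ψ)
    step : ∀ {Ψ} → Ψ ∈ˡ paths → Member (nxt μ Ψ)
    allM : ∀ {Ψ} → Ψ ∈ˡ paths → Member (⟪ empty ⟫ (○ (mk μ Ψ)))
    conj : ∀ {ψ Ψ} → ψ ∈ˡ states → Ψ ∈ˡ paths → Member (ψ ∧ₛ nxt μ Ψ)

  private
    L₁ L₂ L₃ L₄ L₅ L₆ : List (SF k)
    L₁ = states
    L₂ = map (λ φ → ⟪ empty ⟫ (○ φ)) states
    L₃ = map (mk μ) paths
    L₄ = map (nxt μ) paths
    L₅ = map (λ Ψ → ⟪ empty ⟫ (○ (mk μ Ψ))) paths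
    L₆ = cartesianProductWith (λ ψ Ψ → ψ ∧ₛ nxt μ Ψ) states paths

  modal : List (SF k)
  modal = L₁ ++ L₂ ++ L₃ ++ L₄ ++ L₅ ++ L₆

  member⁺ : ∀ {φ} → Member φ → φ ∈ˡ modal
  member⁺ (old i) = ∈-++⁺ˡ i
  member⁺ (all i) = ∈-++⁺ʳ L₁ (∈-++⁺ˡ (∈-map⁺ _ i))
  member⁺ (mod i) = ∈-++⁺ʳ L₁ (∈-++⁺ʳ L₂ (∈-++⁺ˡ (∈-map⁺ _ i)))
  member⁺ (step i) = ∈-++⁺ʳ L₁ (∈-++⁺ʳ L₂ (∈-++⁺ʳ L₃ (∈-++⁺ˡ (∈-map⁺ _ i))))
  member⁺ (allM i) = ∈-++⁺ʳ L₁ (∈-++⁺ʳ L₂ (∈-++⁺ʳ L₃ (∈-++⁺ʳ L₄ (∈-++⁺ˡ (∈-map⁺ _ i)))))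
  member⁺ (conj i j) = ∈-++⁺ʳ L₁ (∈-++⁺ʳ L₂ (∈-++⁺ʳ L₃ (∈-++⁺ʳ L₄ (∈-++⁺ʳ L₅
    (∈-cartesianProductWith⁺ _ i j)))))

  member⁻ : ∀ {φ} → φ ∈ˡ modal → Member φ
  member⁻ i with ∈-++⁻ L₁ i
  ... | inj₁ j = old j
  ... | inj₂ i with ∈-++⁻ L₂ i
  ... | inj₁ j with ∈-map⁻ _ j
  ...   | _ , l , refl = all l
  member⁻ _ | inj₂ _ | inj₂ i with ∈-++⁻ L₃ i
  ... | inj₁ j with ∈-map⁻ _ j
  ...   | _ , l , refl = mod l
  member⁻ _ | inj₂ _ | inj₂ _ | inj₂ i with ∈-++⁻ L₄ i
  ... | inj₁ j with ∈-map⁻ _ j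
  ...   | _ , l , refl = step l
  member⁻ _ | inj₂ _ | inj₂ _ | inj₂ _ | inj₂ i with ∈-++⁻ L₅ i
  ... | inj₁ j with ∈-map⁻ _ j
  ...   | _ , l , refl = allM l
  member⁻ _ | inj₂ _ | inj₂ _ | inj₂ _ | inj₂ _ | inj₂ i
    with ∈-cartesianProductWith⁻ _ states paths i
  ... | _ , _ , x , y , refl = conj x y

  private
    compM-member : ∀ {Ψ ψ Ψ′} → Ψ ∈ˡ paths → (ψ , Ψ′) ∈ˡ dec Ψ → Member (compM μ ψ Ψ′)
    compM-member {Ψ′ = Ψ′} i j with isTopP Ψ′
    ... | true = old (dec-state i j)
    ... | false = conj (dec-state i j) (dec-path i j)

    -- μ is a module parameter; the copy μ′ can be split into cases.
    mod-step : ∀ μ′ → μ′ ≡ μ → ∀ {Ψ χ} → Ψ ∈ˡ paths → Comp (mk μ′ Ψ) χ → Member χ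
    mod-step (dia A) refl i (γc (gcD _ j)) = compM-member i j
    mod-step (dia A) refl i sD = old (next i)
    mod-step (box A) refl i α𝔸 = all (next i)
    mod-step (box A) refl i (γc (gcB _ j)) = compM-member i j
    mod-step (box A) refl i (sB _) = old (next i)

    nxt-step : ∀ μ′ → μ′ ≡ μ → ∀ {Ψ χ} → Ψ ∈ˡ paths → Comp (nxt μ′ Ψ) χ → Member χ
    nxt-step (dia A) refl i (γc (gcD () _))
    nxt-step (dia A) refl i sD = mod i
    nxt-step (box A) refl i α𝔸 = allM i
    nxt-step (box A) refl i (γc (gcB () _))
    nxt-step (box A) refl i (sB _) = mod i

    member-closed : ∀ {φ ψ} → Member φ → Comp φ ψ → Member ψ
    member-closed (old i) c = old (closedₚ i c)
    member-closed (all i) (γc (gcD () _))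
    member-closed (all i) sD = old i
    member-closed (mod i) c = mod-step μ refl i c
    member-closed (step i) c = nxt-step μ refl i c
    member-closed (allM i) (γc (gcD () _))
    member-closed (allM i) sD = mod i
    member-closed (conj i j) αˡ = old i
    member-closed (conj i j) αʳ = step j
    member-closed (conj i j) (γc ())

  modal-closure : Closure (mk μ Φ)
  modal-closure .list = modal
  modal-closure .self = member⁺ (mod selfₚ)
  modal-closure .closed i c = member⁺ (member-closed (member⁻ i) c)

private
  ⊤-closed : ∀ {φ ψ : SF k} → φ ∈ˡ (⊤ₛ ∷ lit (pos 0) ∷ lit (neg 0) ∷ []) → Comp φ ψ →
             ψ ∈ˡ (⊤ₛ ∷ lit (pos 0) ∷ lit (neg 0) ∷ [])
  ⊤-closed (here refl) βˡ = there (here refl)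
  ⊤-closed (here refl) βʳ = there (there (here refl))
  ⊤-closed (here refl) (γc ())
  ⊤-closed (there (here refl)) (γc ())
  ⊤-closed (there (there (here refl))) (γc ())

  ⊤-parts : List (SF k)
  ⊤-parts = ⊤ₛ ∷ lit (pos 0) ∷ lit (neg 0) ∷ []

mutual
  closure : (φ : SF k) → Closure φ
  closure (lit x) = record { list = lit x ∷ [] ; self = here refl ; closed = λ { (here refl) (γc ()) } }
  closure (φ ∨ₛ ψ) = record
    { list = (φ ∨ₛ ψ) ∷ L ; self = here refl
    ; closed = λ { (here refl) βˡ → there (∈-++⁺ˡ (self cφ))
                 ; (here refl) βʳ → there (∈-++⁺ʳ (list cφ) (self cψ))
                 ; (here refl) (γc ())
                 ; (there i) c → there (Closed-++ (closed cφ) (closed cψ) i c) } }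
    where cφ = closure φ ; cψ = closure ψ ; L = list cφ ++ list cψ
  closure (φ ∧ₛ ψ) = record
    { list = joined (list cφ) (list cψ) ; self = joined-∧ _ _ (self cφ) (self cψ)
    ; closed = joined-closed _ _ (closed cφ) (closed cψ) }
    where cφ = closure φ ; cψ = closure ψ
  closure (⟪ A ⟫ Φ) = Modal.modal-closure (dia A) (pathClosure Φ)
  closure (⟦ A ⟧ Φ) = Modal.modal-closure (box A) (pathClosure Φ)

  pathClosure : (Φ : PF k) → PathClosure Φ
  pathClosure (st φ) = record
    { states = ⊤-parts ++ list cφ ; paths = st φ ∷ ⊤ₚ ∷ [] ; selfₚ = here refl
    ; closedₚ = Closed-++ ⊤-closed (closed cφ)
    ; dec-state = λ { (here refl) (here refl) → ∈-++⁺ʳ ⊤-parts (self cφ)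
                    ; (there (here refl)) (here refl) → here refl }
    ; dec-path = λ { (here refl) (here refl) → there (here refl)
                   ; (there (here refl)) (here refl) → there (here refl) }
    ; next = λ { (there (here ())) ; (there (there ())) } }
    where cφ = closure φ
  pathClosure (○ φ) = record
    { states = ⊤-parts ++ list cφ ; paths = (○ φ) ∷ st φ ∷ ⊤ₚ ∷ [] ; selfₚ = here refl
    ; closedₚ = Closed-++ ⊤-closed (closed cφ)
    ; dec-state = λ { (here refl) (here refl) → here refl
                    ; (there (here refl)) (here refl) → ∈-++⁺ʳ ⊤-parts (self cφ)
                    ; (there (there (here refl))) (here refl) → here refl }
    ; dec-path = λ { (here refl) (here refl) → there (here refl)
                   ; (there (here refl)) (here refl) → there (there (here refl))
                   ; (there (there (here refl))) (here refl) → there (there (here refl)) }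
    ; next = λ { (here refl) → ∈-++⁺ʳ ⊤-parts (self cφ) ; (there (there (here ()))) } }
    where cφ = closure φ
  pathClosure (□ φ) = record
    { states = list cφ ; paths = (□ φ) ∷ [] ; selfₚ = here refl ; closedₚ = closed cφ
    ; dec-state = λ { (here refl) (here refl) → self cφ }
    ; dec-path = λ { (here refl) (here refl) → here refl }
    ; next = λ { (here ()) ; (there ()) } }
    where cφ = closure φ
  pathClosure (φ U ψ) = record
    { states = ⊤-parts ++ list cφ ++ list cψ ; paths = (φ U ψ) ∷ ⊤ₚ ∷ [] ; selfₚ = here refl
    ; closedₚ = Closed-++ ⊤-closed (Closed-++ (closed cφ) (closed cψ))
    ; dec-state = λ { (here refl) (here refl) → ∈-++⁺ʳ ⊤-parts (∈-++⁺ˡ (self cφ))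
                    ; (here refl) (there (here refl)) → ∈-++⁺ʳ ⊤-parts (∈-++⁺ʳ (list cφ) (self cψ))
                    ; (there (here refl)) (here refl) → here refl }
    ; dec-path = λ { (here refl) (here refl) → here refl
                   ; (here refl) (there (here refl)) → there (here refl)
                   ; (there (here refl)) (here refl) → there (here refl) }
    ; next = λ { (there (here ())) ; (there (there ())) } }
    where cφ = closure φ ; cψ = closure ψ
  pathClosure (Φ₁ ∧ₚ Φ₂) = record
    { states = joined C₁.states C₂.states ; paths = cartesianProductWith _∧ₚ_ C₁.paths C₂.paths
    ; selfₚ = ∈-cartesianProductWith⁺ _∧ₚ_ C₁.selfₚ C₂.selfₚ
    ; closedₚ = joined-closed _ _ C₁.closedₚ C₂.closedₚ
    ; dec-state = dec-state ; dec-path = dec-path ; next = next }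
    where
    module C₁ = PathClosure (pathClosure Φ₁)
    module C₂ = PathClosure (pathClosure Φ₂)
    paths = cartesianProductWith _∧ₚ_ C₁.paths C₂.paths
    dec-state : ∀ {Ψ ψ Ψ′} → Ψ ∈ˡ paths → (ψ , Ψ′) ∈ˡ dec Ψ → ψ ∈ˡ joined C₁.states C₂.states
    dec-state i j with ∈-cartesianProductWith⁻ _∧ₚ_ C₁.paths C₂.paths i
    ... | Ψ₁ , Ψ₂ , i₁ , i₂ , refl with dec-∧⁻ Ψ₁ Ψ₂ j
    ...   | _ , _ , j₁ , j₂ , refl = joined-∧ _ _ (C₁.dec-state i₁ j₁) (C₂.dec-state i₂ j₂)
    dec-path : ∀ {Ψ ψ Ψ′} → Ψ ∈ˡ paths → (ψ , Ψ′) ∈ˡ dec Ψ → Ψ′ ∈ˡ paths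
    dec-path i j with ∈-cartesianProductWith⁻ _∧ₚ_ C₁.paths C₂.paths i
    ... | Ψ₁ , Ψ₂ , i₁ , i₂ , refl with dec-∧⁻ Ψ₁ Ψ₂ j
    ...   | _ , _ , j₁ , j₂ , refl = ∈-cartesianProductWith⁺ _∧ₚ_ (C₁.dec-path i₁ j₁) (C₂.dec-path i₂ j₂)
    next : ∀ {φ} → (○ φ) ∈ˡ paths → φ ∈ˡ joined C₁.states C₂.states
    next i with ∈-cartesianProductWith⁻ _∧ₚ_ C₁.paths C₂.paths i
    ... | _ , _ , _ , _ , ()
  pathClosure (Φ₁ ∨ₚ Φ₂) = record
    { states = joined C₁.states C₂.states ; paths = paths
    ; selfₚ = mix⁺ C₁.selfₚ C₂.selfₚ
    ; closedₚ = joined-closed _ _ C₁.closedₚ C₂.closedₚ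
    ; dec-state = dec-state ; dec-path = dec-path ; next = next }
    where
    module C₁ = PathClosure (pathClosure Φ₁)
    module C₂ = PathClosure (pathClosure Φ₂)
    paths = C₁.paths ++ C₂.paths ++ cartesianProductWith _∨ₚ_ C₁.paths C₂.paths
    mix⁺ : ∀ {Ψ₁ Ψ₂} → Ψ₁ ∈ˡ C₁.paths → Ψ₂ ∈ˡ C₂.paths → (Ψ₁ ∨ₚ Ψ₂) ∈ˡ paths
    mix⁺ i j = ∈-++⁺ʳ C₁.paths (∈-++⁺ʳ C₂.paths (∈-cartesianProductWith⁺ _∨ₚ_ i j))
    data Member : PF _ → Set where
      left  : ∀ {Ψ} → Ψ ∈ˡ C₁.paths → Member Ψ
      right : ∀ {Ψ} → Ψ ∈ˡ C₂.paths → Member Ψ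
      mix   : ∀ {Ψ₁ Ψ₂} → Ψ₁ ∈ˡ C₁.paths → Ψ₂ ∈ˡ C₂.paths → Member (Ψ₁ ∨ₚ Ψ₂)
    member : ∀ {Ψ} → Ψ ∈ˡ paths → Member Ψ
    member i with ∈-++⁻ C₁.paths i
    ... | inj₁ j = left j
    ... | inj₂ j with ∈-++⁻ C₂.paths j
    ...   | inj₁ l = right l
    ...   | inj₂ l with ∈-cartesianProductWith⁻ _∨ₚ_ C₁.paths C₂.paths l
    ...     | _ , _ , x , y , refl = mix x y
    dec-state : ∀ {Ψ ψ Ψ′} → Ψ ∈ˡ paths → (ψ , Ψ′) ∈ˡ dec Ψ → ψ ∈ˡ joined C₁.states C₂.states
    dec-state i j with member i
    ... | left l = joined-L _ _ (C₁.dec-state l j)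
    ... | right l = joined-M C₁.states C₂.states (C₂.dec-state l j)
    ... | mix {Ψ₁} {Ψ₂} l₁ l₂ with dec-∨⁻ Ψ₁ Ψ₂ j
    ...   | left m = joined-L _ _ (C₁.dec-state l₁ m)
    ...   | right m = joined-M C₁.states C₂.states (C₂.dec-state l₂ m)
    ...   | mixed m₁ m₂ = joined-∧ _ _ (C₁.dec-state l₁ m₁) (C₂.dec-state l₂ m₂)
    dec-path : ∀ {Ψ ψ Ψ′} → Ψ ∈ˡ paths → (ψ , Ψ′) ∈ˡ dec Ψ → Ψ′ ∈ˡ paths
    dec-path i j with member i
    ... | left l = ∈-++⁺ˡ (C₁.dec-path l j)
    ... | right l = ∈-++⁺ʳ C₁.paths (∈-++⁺ˡ (C₂.dec-path l j))
    ... | mix {Ψ₁} {Ψ₂} l₁ l₂ with dec-∨⁻ Ψ₁ Ψ₂ j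
    ...   | left m = ∈-++⁺ˡ (C₁.dec-path l₁ m)
    ...   | right m = ∈-++⁺ʳ C₁.paths (∈-++⁺ˡ (C₂.dec-path l₂ m))
    ...   | mixed m₁ m₂ = mix⁺ (C₁.dec-path l₁ m₁) (C₂.dec-path l₂ m₂)
    next : ∀ {φ} → (○ φ) ∈ˡ paths → φ ∈ˡ joined C₁.states C₂.states
    next i with member i
    ... | left l = joined-L _ _ (C₁.next l)
    ... | right l = joined-M C₁.states C₂.states (C₂.next l)

-- Decompositions

-- Chosen so that a remainder is either the formula itself or of smaller rank. `○` weighs 2 because
-- its remainder `st φ` may weigh 1 and has still to fall to `⊤ₚ`, which weighs 0; the extra 1 of
-- `∨ₚ` makes dropping a disjunct of rank 0 a decrease too.
rank : PF k → ℕ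
rank (st φ) = if isTopP (st φ) then 0 else 1
rank (○ _) = 2
rank (□ _) = 0
rank (_ U _) = 1
rank (Φ ∨ₚ Ψ) = suc (rank Φ + rank Ψ)
rank (Φ ∧ₚ Ψ) = rank Φ + rank Ψ

rank-st : (φ : SF k) → rank (st φ) ≤ 1
rank-st φ with isTopP (st φ)
... | true = z≤n
... | false = ℕₚ.≤-refl

dec-rank : ∀ (Φ : PF k) {ψ Ψ} → (ψ , Ψ) ∈ˡ dec Φ → Ψ ≡ Φ ⊎ rank Ψ < rank Φ
dec-rank (st φ) (here refl) with isTopP (st φ) in eq
... | true = inj₁ (sym (isTopP-⊤ (st φ) (subst T (sym eq) tt)))
... | false = inj₂ (s≤s z≤n)
dec-rank (○ φ) (here refl) = inj₂ (s≤s (rank-st φ))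
dec-rank (□ φ) (here refl) = inj₁ refl
dec-rank (φ U ψ) (here refl) = inj₁ refl
dec-rank (φ U ψ) (there (here refl)) = inj₂ (s≤s z≤n)
dec-rank (Φ₁ ∨ₚ Φ₂) i with dec-∨⁻ Φ₁ Φ₂ i
dec-rank (Φ₁ ∨ₚ Φ₂) i | left j with dec-rank Φ₁ j
... | inj₁ refl = inj₂ (s≤s (ℕₚ.m≤m+n _ _))
... | inj₂ lt = inj₂ (ℕₚ.m≤n⇒m≤1+n (ℕₚ.≤-trans lt (ℕₚ.m≤m+n _ _)))
dec-rank (Φ₁ ∨ₚ Φ₂) i | right j with dec-rank Φ₂ j
... | inj₁ refl = inj₂ (s≤s (ℕₚ.m≤n+m _ _))
... | inj₂ lt = inj₂ (ℕₚ.m≤n⇒m≤1+n (ℕₚ.≤-trans lt (ℕₚ.m≤n+m _ _)))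
dec-rank (Φ₁ ∨ₚ Φ₂) i | mixed j₁ j₂ with dec-rank Φ₁ j₁ | dec-rank Φ₂ j₂
... | inj₁ refl | inj₁ refl = inj₁ refl
... | inj₁ refl | inj₂ lt = inj₂ (s≤s (ℕₚ.+-monoʳ-< (rank Φ₁) lt))
... | inj₂ lt | inj₁ refl = inj₂ (s≤s (ℕₚ.+-monoˡ-< (rank Φ₂) lt))
... | inj₂ lt₁ | inj₂ lt₂ = inj₂ (s≤s (ℕₚ.+-mono-< lt₁ lt₂))
dec-rank (Φ₁ ∧ₚ Φ₂) i with dec-∧⁻ Φ₁ Φ₂ i
... | _ , _ , j₁ , j₂ , refl with dec-rank Φ₁ j₁ | dec-rank Φ₂ j₂
... | inj₁ refl | inj₁ refl = inj₁ refl
... | inj₁ refl | inj₂ lt = inj₂ (ℕₚ.+-monoʳ-< (rank Φ₁) lt)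
... | inj₂ lt | inj₁ refl = inj₂ (ℕₚ.+-monoˡ-< (rank Φ₂) lt)
... | inj₂ lt₁ | inj₂ lt₂ = inj₂ (ℕₚ.+-mono-< lt₁ lt₂)

dec-rank-≤ : ∀ (Φ : PF k) {ψ Ψ} → (ψ , Ψ) ∈ˡ dec Φ → rank Ψ ≤ rank Φ
dec-rank-≤ Φ i with dec-rank Φ i
... | inj₁ refl = ℕₚ.≤-refl
... | inj₂ lt = ℕₚ.<⇒≤ lt

∨-free : PF k → Set
∨-free (Φ ∨ₚ Ψ) = ⊥
∨-free (Φ ∧ₚ Ψ) = ∨-free Φ × ∨-free Ψ
∨-free _ = ⊤

∨-free? : (Φ : PF k) → Dec (∨-free Φ)
∨-free? (st _) = yes tt
∨-free? (○ _) = yes tt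
∨-free? (□ _) = yes tt
∨-free? (_ U _) = yes tt
∨-free? (_ ∨ₚ _) = no λ ()
∨-free? (Φ ∧ₚ Ψ) = ∨-free? Φ ×-dec ∨-free? Ψ

dec-∨-free : ∀ (Φ : PF k) {ψ Ψ} → ∨-free Φ → (ψ , Ψ) ∈ˡ dec Φ → ∨-free Ψ
dec-∨-free (st _) _ (here refl) = tt
dec-∨-free (○ _) _ (here refl) = tt
dec-∨-free (□ _) _ (here refl) = tt
dec-∨-free (_ U _) _ (here refl) = tt
dec-∨-free (_ U _) _ (there (here refl)) = tt
dec-∨-free (Φ₁ ∧ₚ Φ₂) (f₁ , f₂) i with dec-∧⁻ Φ₁ Φ₂ i
... | _ , _ , j₁ , j₂ , refl = dec-∨-free Φ₁ f₁ j₁ , dec-∨-free Φ₂ f₂ j₂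

-- Reduced components are conjunctions assembled anew: their conjuncts come from the label, but the
-- conjunction itself may be missing from it. Truth is therefore proved from this weaker form of
-- membership.
ConjIn : (SF k → Set) → SF k → Set
ConjIn S (φ ∧ₛ ψ) = S (φ ∧ₛ ψ) ⊎ (ConjIn S φ × ConjIn S ψ)
ConjIn S φ = S φ

conjIn⁺ : ∀ {S : SF k → Set} φ → S φ → ConjIn S φ
conjIn⁺ (lit _) s = s
conjIn⁺ (_ ∨ₛ _) s = s
conjIn⁺ (_ ∧ₛ _) s = inj₁ s
conjIn⁺ (⟪ _ ⟫ _) s = s
conjIn⁺ (⟦ _ ⟧ _) s = s

conjIn-map : ∀ {S S′ : SF k → Set} → (∀ φ → S φ → S′ φ) → ∀ φ → ConjIn S φ → ConjIn S′ φ
conjIn-map f (lit _) s = f _ s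
conjIn-map f (_ ∨ₛ _) s = f _ s
conjIn-map f (φ ∧ₛ ψ) (inj₁ s) = inj₁ (f _ s)
conjIn-map f (φ ∧ₛ ψ) (inj₂ (s , t)) = inj₂ (conjIn-map f φ s , conjIn-map f ψ t)
conjIn-map f (⟪ _ ⟫ _) s = f _ s
conjIn-map f (⟦ _ ⟧ _) s = f _ s

conjIn? : ∀ {S : SF k → Set} → (∀ φ → Dec (S φ)) → ∀ φ → Dec (ConjIn S φ)
conjIn? S? (lit _) = S? _
conjIn? S? (_ ∨ₛ _) = S? _
conjIn? S? (φ ∧ₛ ψ) = S? _ ⊎-dec (conjIn? S? φ ×-dec conjIn? S? ψ)
conjIn? S? (⟪ _ ⟫ _) = S? _
conjIn? S? (⟦ _ ⟧ _) = S? _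

-- A mixed component of Φ₁ ∨ Φ₂ may be replaced by one of its two sides, using fewer conjuncts.
reduce : ∀ {S : SF k → Set} → (∀ φ ψ → S (φ ∧ₛ ψ) → S φ × S ψ) →
         ∀ (Φ : PF k) {ψ Ψ} → (ψ , Ψ) ∈ˡ dec Φ → ConjIn S ψ →
         Σ (SF k) λ ψ′ → Σ (PF k) λ Ψ′ → (ψ′ , Ψ′) ∈ˡ dec Φ × ∨-free Ψ′ × ConjIn S ψ′
reduce andC (st φ) (here refl) c = _ , _ , here refl , tt , c
reduce andC (○ φ) (here refl) c = _ , _ , here refl , tt , c
reduce andC (□ φ) (here refl) c = _ , _ , here refl , tt , c
reduce andC (φ U ψ) (here refl) c = _ , _ , here refl , tt , c
reduce andC (φ U ψ) (there (here refl)) c = _ , _ , there (here refl) , tt , c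
reduce {S = S} andC (Φ₁ ∨ₚ Φ₂) i c with dec-∨⁻ Φ₁ Φ₂ i
... | left j = let _ , _ , l , f , c′ = reduce andC Φ₁ j c in _ , _ , dec-∨ˡ Φ₁ Φ₂ l , f , c′
... | right j = let _ , _ , l , f , c′ = reduce andC Φ₂ j c in _ , _ , dec-∨ʳ Φ₁ Φ₂ l , f , c′
... | mixed {x₁} {x₂} j₁ j₂ =
  let _ , _ , l , f , c′ = reduce andC Φ₁ j₁ (part c) in _ , _ , dec-∨ˡ Φ₁ Φ₂ l , f , c′
  where
  part : ConjIn S (proj₁ x₁ ∧ₛ proj₁ x₂) → ConjIn S (proj₁ x₁)
  part (inj₁ s) = conjIn⁺ {S = S} (proj₁ x₁) (proj₁ (andC _ _ s))
  part (inj₂ (s , t)) = s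
reduce {S = S} andC (Φ₁ ∧ₚ Φ₂) i c with dec-∧⁻ Φ₁ Φ₂ i
... | x₁ , x₂ , j₁ , j₂ , refl =
  let p , q = parts c
      _ , _ , l₁ , f₁ , c₁ = reduce andC Φ₁ j₁ p
      _ , _ , l₂ , f₂ , c₂ = reduce andC Φ₂ j₂ q
  in _ , _ , dec-∧⁺ Φ₁ Φ₂ l₁ l₂ , (f₁ , f₂) , inj₂ (c₁ , c₂)
  where
  parts : ConjIn S (proj₁ x₁ ∧ₛ proj₁ x₂) → ConjIn S (proj₁ x₁) × ConjIn S (proj₁ x₂)
  parts (inj₁ s) = conjIn⁺ {S = S} (proj₁ x₁) (proj₁ (andC _ _ s)) , conjIn⁺ {S = S} (proj₁ x₂) (proj₂ (andC _ _ s))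
  parts (inj₂ s) = s

Real-map : ∀ (Φ : PF k) {S S′ : SF k → Set} → (∀ φ → S φ → S′ φ) → Real Φ S → Real Φ S′
Real-map (st φ) f r = f _ r
Real-map (□ φ) f r = f _ r
Real-map (φ U ψ) f r = f _ r
Real-map (Φ ∨ₚ Ψ) f (inj₁ r) = inj₁ (Real-map Φ f r)
Real-map (Φ ∨ₚ Ψ) f (inj₂ r) = inj₂ (Real-map Ψ f r)
Real-map (Φ ∧ₚ Ψ) f (r , s) = Real-map Φ f r , Real-map Ψ f s

Real? : ∀ {S : SF k → Set} → (∀ φ → Dec (S φ)) → ∀ Φ → Dec (Real Φ S)
Real? S? (st φ) = S? φ
Real? S? (○ φ) = no λ ()
Real? S? (□ φ) = S? φ
Real? S? (φ U ψ) = S? ψ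
Real? S? (Φ ∨ₚ Ψ) = Real? S? Φ ⊎-dec Real? S? Ψ
Real? S? (Φ ∧ₚ Ψ) = Real? S? Φ ×-dec Real? S? Ψ

-- Action profiles over a listing

Unique-lookup : ∀ {A : Set} {xs : List A} → Unique xs → ∀ i j → lookup xs i ≡ lookup xs j → i ≡ j
Unique-lookup {xs = x ∷ xs} (u ∷ us) zero zero eq = refl
Unique-lookup {xs = x ∷ xs} (u ∷ us) zero (suc j) eq = ⊥-elim (All.lookup u (∈-lookup j) eq)
Unique-lookup {xs = x ∷ xs} (u ∷ us) (suc i) zero eq = ⊥-elim (All.lookup u (∈-lookup i) (sym eq))
Unique-lookup {xs = x ∷ xs} (u ∷ us) (suc i) (suc j) eq = cong suc (Unique-lookup us i j eq)

∈-index : ∀ {A : Set} {x : A} {xs} → x ∈ˡ xs → Σ (Fin (length xs)) λ i → lookup xs i ≡ x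
∈-index (here refl) = zero , refl
∈-index (there i) = let j , eq = ∈-index i in suc j , eq

-- Rule Next over a bare listing. Identified labels are not equal but their listings are, so moves
-- can be transported between them. The definitions unfold to those of `Tableau` at `ord Δ`.
module _ {k : ℕ} (o : RawListing k) where
  private
    ds bs : List (Coal k × SF k)
    ds = proj₁ o
    bs = proj₂ o

  size : ℕ
  size = length ds + length bs

  Prof : Set
  Prof = Fin k → Fin size

  contrib : ℕ → ℕ
  contrib x = if length ds ≤ᵇ x then x ∸ length ds else 0

  coL : Prof → ℕ
  coL σ = sum (map (λ a → contrib (toℕ (σ a))) (allFin k)) mod′ length bs

  Plays : Coal k → Fin (length ds) → Prof → Set
  Plays A p σ = ∀ a → a ∈ A → toℕ (σ a) ≡ toℕ p

  CoPlays : Coal k → Fin (length bs) → Prof → Set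
  CoPlays A q σ = coL σ ≡ toℕ q × (∀ a → a ∉ A → length ds ≤ toℕ (σ a))

  Forced₀ : Prof → SF k → Set
  Forced₀ σ φ =
    (Σ (Fin (length ds)) λ p → proj₂ (lookup ds p) ≡ φ × Plays (proj₁ (lookup ds p)) p σ)
    ⊎ (Σ (Fin (length bs)) λ q → proj₂ (lookup bs q) ≡ φ × CoPlays (proj₁ (lookup bs q)) q σ)

  Forced : Prof → SF k → Set
  Forced σ φ = Forced₀ σ φ ⊎ (φ ≡ ⊤ₛ × ¬ Σ (SF k) (Forced₀ σ))

  Follows : Mod k → SF k → Prof → Set
  Follows (dia A) φ σ = Σ (Fin (length ds)) λ p → lookup ds p ≡ (A , φ) × Plays A p σ
  Follows (box A) φ σ = Σ (Fin (length bs)) λ q → lookup bs q ≡ (A , φ) × CoPlays A q σ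

  Plays? : ∀ A p σ → Dec (Plays A p σ)
  Plays? A p σ = Finₚ.all? (λ a → (a ∈? A) →-dec (toℕ (σ a) ℕₚ.≟ toℕ p))

  CoPlays? : ∀ A q σ → Dec (CoPlays A q σ)
  CoPlays? A q σ = (coL σ ℕₚ.≟ toℕ q) ×-dec
    Finₚ.all? (λ a → ¬? (a ∈? A) →-dec (length ds ℕₚ.≤? toℕ (σ a)))

  Follows? : ∀ μ φ σ → Dec (Follows μ φ σ)
  Follows? (dia A) φ σ = Finₚ.any? (λ p → ×ₚ.≡-dec _≟C_ _≟S_ (lookup ds p) (A , φ) ×-dec Plays? A p σ)
  Follows? (box A) φ σ = Finₚ.any? (λ q → ×ₚ.≡-dec _≟C_ _≟S_ (lookup bs q) (A , φ) ×-dec CoPlays? A q σ)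

  follows-forced : ∀ μ φ σ → Follows μ φ σ → Forced₀ σ φ
  follows-forced (dia A) φ σ (p , eq , pl) =
    inj₁ (p , cong proj₂ eq , λ a i → pl a (subst (λ x → a ∈ proj₁ x) eq i))
  follows-forced (box A) φ σ (q , eq , c , pl) =
    inj₂ (q , cong proj₂ eq , c , λ a i → pl a (λ j → i (subst (λ x → a ∈ proj₁ x) (sym eq) j)))

  forced₀ : Prof → List (SF k)
  forced₀ σ = map (λ p → proj₂ (lookup ds p)) (filter (λ p → Plays? (proj₁ (lookup ds p)) p σ) (allFin _))
           ++ map (λ q → proj₂ (lookup bs q)) (filter (λ q → CoPlays? (proj₁ (lookup bs q)) q σ) (allFin _))

  forced₀⁺ : ∀ σ φ → Forced₀ σ φ → φ ∈ˡ forced₀ σ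
  forced₀⁺ σ φ (inj₁ (p , refl , pl)) = ∈-++⁺ˡ (∈-map⁺ _ (∈-filter⁺ _ (∈-allFin p) pl))
  forced₀⁺ σ φ (inj₂ (q , refl , pl)) =
    ∈-++⁺ʳ (map _ (filter _ (allFin _))) (∈-map⁺ _ (∈-filter⁺ _ (∈-allFin q) pl))

  forced₀⁻ : ∀ σ φ → φ ∈ˡ forced₀ σ → Forced₀ σ φ
  forced₀⁻ σ φ i with ∈-++⁻ (map (λ p → proj₂ (lookup ds p)) (filter (λ p → Plays? (proj₁ (lookup ds p)) p σ) (allFin _))) i
  ... | inj₁ j with ∈-map⁻ _ j
  ...   | p , l , refl = inj₁ (p , refl , proj₂ (∈-filter⁻ (λ p → Plays? (proj₁ (lookup ds p)) p σ) {xs = allFin _} l))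
  forced₀⁻ σ φ i | inj₂ j with ∈-map⁻ _ j
  ...   | q , l , refl = inj₂ (q , refl , proj₂ (∈-filter⁻ (λ q → CoPlays? (proj₁ (lookup bs q)) q σ) {xs = allFin _} l))

  orTop : List (SF k) → List (SF k)
  orTop [] = [ ⊤ₛ ]
  orTop (φ ∷ L) = φ ∷ L

  forced : Prof → List (SF k)
  forced σ = orTop (forced₀ σ)

  forced⁺ : ∀ σ φ → Forced σ φ → φ ∈ˡ forced σ
  forced⁺ σ φ (inj₁ f) with forced₀ σ | forced₀⁺ σ φ f
  ... | _ ∷ _ | i = i
  forced⁺ σ φ (inj₂ (refl , none)) with forced₀ σ | forced₀⁻ σ
  ... | [] | _ = here refl
  ... | φ ∷ _ | f = ⊥-elim (none (φ , f φ (here refl)))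

  forced⁻ : ∀ σ φ → φ ∈ˡ forced σ → Forced σ φ
  forced⁻ σ φ i with forced₀ σ | forced₀⁺ σ | forced₀⁻ σ
  forced⁻ σ φ (here refl) | [] | f | _ = inj₂ (refl , λ { (ψ , x) → none (f ψ x) })
    where
    none : ∀ {ψ : SF k} → ψ ∈ˡ [] → ⊥
    none ()
  forced⁻ σ φ i | _ ∷ _ | _ | f = inj₁ (f φ i)

  module _ {σ σ′ : Prof} (eq : ∀ a → σ a ≡ σ′ a) where

    coL-cong : coL σ ≡ coL σ′
    coL-cong = cong (λ xs → sum xs mod′ length bs)
      (map-cong (λ a → cong (λ x → contrib (toℕ x)) (eq a)) (allFin k))

    Plays-cong : ∀ {A p} → Plays A p σ → Plays A p σ′
    Plays-cong pl a i = trans (cong toℕ (sym (eq a))) (pl a i)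

    CoPlays-cong : ∀ {A q} → CoPlays A q σ → CoPlays A q σ′
    CoPlays-cong (c , pl) = trans (sym coL-cong) c , λ a i → subst (λ x → length ds ≤ toℕ x) (eq a) (pl a i)

    Forced₀-cong : ∀ {φ} → Forced₀ σ φ → Forced₀ σ′ φ
    Forced₀-cong (inj₁ (p , e , pl)) = inj₁ (p , e , Plays-cong pl)
    Forced₀-cong (inj₂ (q , e , pl)) = inj₂ (q , e , CoPlays-cong pl)

Forced-cong : ∀ (o : RawListing k) {σ σ′ : Prof o} → (∀ a → σ a ≡ σ′ a) → ∀ {φ} → Forced o σ φ → Forced o σ′ φ
Forced-cong o eq (inj₁ f) = inj₁ (Forced₀-cong o eq f)
Forced-cong o eq (inj₂ (e , none)) =
  inj₂ (e , λ { (φ , f) → none (φ , Forced₀-cong o (λ a → sym (eq a)) f) })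

-- Labels up to identity

≈-refl : (Δ : Label k) → Δ ≈ Δ
≈-refl Δ = (λ φ → (λ x → x) , (λ x → x)) , (λ ξ _ _ → refl)

≈-sym : ∀ {Δ Δ′ : Label k} → Δ ≈ Δ′ → Δ′ ≈ Δ
≈-sym (s , l) = (λ φ → proj₂ (s φ) , proj₁ (s φ)) , λ ξ g x → sym (l ξ g (proj₂ (s ξ) x))

≈-trans : ∀ {Δ Δ′ Δ″ : Label k} → Δ ≈ Δ′ → Δ′ ≈ Δ″ → Δ ≈ Δ″
≈-trans (s , l) (s′ , l′) =
  (λ φ → (λ x → proj₁ (s′ φ) (proj₁ (s φ) x)) , (λ x → proj₂ (s φ) (proj₂ (s′ φ) x))) ,
  λ ξ g x → trans (l ξ g x) (l′ ξ g (proj₁ (s ξ) x))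

-- FullExp without its label field, so that it lives in Set.
record Expands {k} (Γ : SF k → Set) (Δ : Label k) : Set where
  field
    supE  : ∀ φ → Γ φ → set Δ φ
    subE  : ∀ φ → set Δ φ → Cl Γ φ
    no⊥E  : ¬ set Δ ⊥ₛ
    clashE : ∀ p → set Δ (lit (pos p)) → set Δ (lit (neg p)) → ⊥
    andE  : ∀ φ ψ → set Δ (φ ∧ₛ ψ) → set Δ φ × set Δ ψ
    allE  : ∀ ψ → set Δ (⟦ full ⟧ (○ ψ)) → set Δ (⟪ empty ⟫ (○ ψ))
    orE   : ∀ φ ψ → set Δ (φ ∨ₛ ψ) → set Δ φ ⊎ set Δ ψ
    gamE  : ∀ ξ → IsGamma ξ → set Δ ξ → GammaComp ξ (link Δ ξ) × set Δ (link Δ ξ)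
open Expands public

toFullExp : ∀ {Γ : SF k → Set} {Δ} → Expands Γ Δ → FullExp Γ
toFullExp {Δ = Δ} E = record
  { lab = Δ ; sup = supE E ; sub = subE E ; no⊥ = no⊥E E ; noclash = clashE E
  ; andC = andE E ; allA = allE E ; orC = orE E ; gamC = gamE E }

fromFullExp : ∀ {Γ : SF k → Set} (E : FullExp Γ) → Expands Γ (lab E)
fromFullExp E = record
  { supE = sup E ; subE = sub E ; no⊥E = no⊥ E ; clashE = noclash E
  ; andE = andC E ; allE = allA E ; orE = orC E ; gamE = gamC E }

Cl-mono : ∀ {Γ Γ′ : SF k → Set} → (∀ {φ} → Γ φ → Γ′ φ) → ∀ {φ} → Cl Γ φ → Cl Γ′ φ
Cl-mono f (base x) = base (f x)
Cl-mono f top = top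
Cl-mono f bot = bot
Cl-mono f (comp x c) = comp (Cl-mono f x) c

Expands-cong : ∀ {Γ Γ′ : SF k → Set} {Δ Δ′} → (∀ {φ} → Γ φ → Γ′ φ) → (∀ {φ} → Γ′ φ → Γ φ) →
               Δ ≈ Δ′ → Expands Γ Δ → Expands Γ′ Δ′
Expands-cong {Δ = Δ} {Δ′} f g (s , l) E = record
  { supE = λ φ x → to (supE E φ (g x))
  ; subE = λ φ x → Cl-mono f (subE E φ (from x))
  ; no⊥E = λ x → no⊥E E (from x)
  ; clashE = λ p x y → clashE E p (from x) (from y)
  ; andE = λ φ ψ x → let y , z = andE E φ ψ (from x) in to y , to z
  ; allE = λ ψ x → to (allE E ψ (from x))
  ; orE = λ φ ψ x → case-or (orE E φ ψ (from x))
  ; gamE = λ ξ h x → let c , y = gamE E ξ h (from x) in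
      subst (λ χ → GammaComp ξ χ × set Δ′ χ) (l ξ h (from x)) (c , to y) }
  where
  to : ∀ {φ} → set Δ φ → set Δ′ φ
  to {φ} = proj₁ (s φ)
  from : ∀ {φ} → set Δ′ φ → set Δ φ
  from {φ} = proj₂ (s φ)
  case-or : ∀ {φ ψ} → set Δ φ ⊎ set Δ ψ → set Δ′ φ ⊎ set Δ′ ψ
  case-or (inj₁ x) = inj₁ (to x)
  case-or (inj₂ x) = inj₂ (to x)

SRRel-≈ : ∀ {Γ : SF k → Set} (E : FullExp Γ) {Δ Δ′} → SRRel E Δ → Δ ≈ Δ′ → SRRel E Δ′
SRRel-≈ E (inj₁ (n , e)) e′ = inj₁ (n , ≈-trans (≈-sym e′) e)
SRRel-≈ E (inj₂ (n , e)) e′ = inj₂ (n , ≈-trans (≈-sym e′) e)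

-- Successor formulae and their listings

nx : Mod k → SF k → SF k
nx μ φ = mk (norm μ) (○ φ)

nextTop : SF k
nextTop = ⟪ full ⟫ (○ ⊤ₛ)

norm-full : norm (box (full {k})) ≡ dia empty
norm-full {k} with full {k} ≟C full
... | yes _ = refl
... | no ¬p = ⊥-elim (¬p refl)

norm-box : ∀ (μ : Mod k) {A} → norm μ ≡ box A → A ≢ full
norm-box (box A) eq with A ≟C full
norm-box (box A) refl | no A≢ = A≢

all-nx : ∀ (μ : Mod k) Ψ {ψ} → ⟦ full ⟧ (○ ψ) ≡ nxt μ Ψ → nx μ (mk μ Ψ) ≡ ⟪ empty ⟫ (○ ψ)
all-nx (box _) Ψ refl = cong (λ ν → mk ν (○ (⟦ full ⟧ Ψ))) norm-full

¬nx-all : ∀ (μ : Mod k) {φ ψ} → ⟦ full ⟧ (○ ψ) ≢ nx μ φ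
¬nx-all μ eq with norm μ | norm-box μ
¬nx-all μ refl | box _ | ne = ne refl refl

Entry : RawListing k → Mod k → SF k → Set
Entry o (dia A) φ = (A , φ) ∈ˡ proj₁ o
Entry o (box A) φ = (A , φ) ∈ˡ proj₂ o

Entry? : ∀ (o : RawListing k) μ φ → Dec (Entry o μ φ)
Entry? o (dia A) φ = any? (×ₚ.≡-dec _≟C_ _≟S_ (A , φ)) (proj₁ o)
Entry? o (box A) φ = any? (×ₚ.≡-dec _≟C_ _≟S_ (A , φ)) (proj₂ o)

entry⁺ : ∀ (Δ : Label k) {o} → ValidListing Δ o → ∀ μ {φ} → set Δ (nx μ φ) → Entry o (norm μ) φ
entry⁺ Δ (v , w , _) μ s with norm μ | norm-box μ
... | dia A | _ = proj₁ (v A _) s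
... | box A | A≢ = proj₁ (w A _) (A≢ refl , s)

entry⁻ : ∀ (Δ : Label k) {o} → ValidListing Δ o → ∀ μ {φ} → Entry o (norm μ) φ → set Δ (nx μ φ)
entry⁻ Δ (v , w , _) μ s with norm μ
... | dia A = proj₂ (v A _) s
... | box A = proj₂ (proj₂ (w A _) s)

¬gamma-next : ∀ (μ : Mod k) {φ} → ¬ IsGamma (mk μ (○ φ))
¬gamma-next (dia _) (gD ())
¬gamma-next (box _) (gB ())

mk≢nextTop : ∀ (μ : Mod k) {Φ} → NotNext Φ → mk μ Φ ≢ nextTop
mk≢nextTop (dia A) () refl

¬NoNext : ∀ {X : SF k → Set} → NoNext X → ∀ (μ : Mod k) {φ} → ¬ X (mk μ (○ φ))
¬NoNext n (dia A) = proj₁ (n A _)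
¬NoNext n (box A) = proj₂ (n A _)

-- A state with the formula `nextTop` added by rule SR may leave the closure of its prestate and so
-- fail to be an expansion of it. These local conditions survive the addition, and `nextH` makes the
-- listing non-empty.
record Hintikka {k} (Δ : Label k) : Set where
  field
    clashH : ∀ p → set Δ (lit (pos p)) → set Δ (lit (neg p)) → ⊥
    andH  : ∀ φ ψ → set Δ (φ ∧ₛ ψ) → set Δ φ × set Δ ψ
    allH  : ∀ ψ → set Δ (⟦ full ⟧ (○ ψ)) → set Δ (⟪ empty ⟫ (○ ψ))
    orH   : ∀ φ ψ → set Δ (φ ∨ₛ ψ) → set Δ φ ⊎ set Δ ψ
    gamH  : ∀ ξ → IsGamma ξ → set Δ ξ → GammaComp ξ (link Δ ξ) × set Δ (link Δ ξ)
    nextH : Σ (Mod k) λ μ → Σ (SF k) λ φ → set Δ (nx μ φ)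

  nx-in : ∀ μ {φ} → set Δ (mk μ (○ φ)) → set Δ (nx μ φ)
  nx-in (dia A) s = s
  nx-in (box A) s with A ≟C full
  ... | yes refl = allH _ s
  ... | no _ = s

hintikka : ∀ {Γ : SF k → Set} (E : FullExp Γ) {Δ} → SRRel E Δ → Hintikka Δ
hintikka {k} E {Δ} (inj₂ ((A , φ , h) , s , l)) = record
  { clashH = clashE E′ ; andH = andE E′ ; allH = allE E′ ; orH = orE E′ ; gamH = gamE E′ ; nextH = next h }
  where
  E′ = Expands-cong (λ x → x) (λ x → x) (≈-sym {Δ = Δ} {lab E} (s , l)) (fromFullExp E)
  next : _ → Σ (Mod k) λ μ → Σ (SF k) λ φ → set Δ (nx μ φ)
  next (inj₁ h) = dia A , φ , proj₂ (s _) h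
  next (inj₂ h) with A ≟C full
  ... | yes refl = dia empty , φ , allE E′ φ (proj₂ (s _) h)
  ... | no A≢ = box A , φ , subst (λ μ → set Δ (mk μ (○ φ))) (sym normA) (proj₂ (s _) h)
    where
    normA : norm (box A) ≡ box A
    normA with A ≟C full
    ... | yes eq = ⊥-elim (A≢ eq)
    ... | no _ = refl
hintikka {k} E {Δ} (inj₁ (none , s , l)) = record
  { clashH = λ p x y → noclash E p (from (λ ()) x) (from (λ ()) y)
  ; andH = λ φ ψ x → let y , z = andC E φ ψ (from (λ ()) x) in to y , to z
  ; allH = λ ψ x → to (allA E ψ (from (λ ()) x))
  ; orH = λ φ ψ x → case-or (orC E φ ψ (from (λ ()) x))
  ; gamH = λ ξ g x → let c , y = gamC E ξ g (from (λ { refl → ¬gamma-next (dia full) g }) x) in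
      subst (λ χ → GammaComp ξ χ × set Δ χ) (sym (l ξ g x)) (c , to y)
  ; nextH = dia full , ⊤ₛ , proj₂ (s _) (inj₂ refl) }
  where
  to : ∀ {φ} → set (lab E) φ → set Δ φ
  to {φ} x = proj₂ (s φ) (inj₁ x)
  from : ∀ {φ} → φ ≢ nextTop → set Δ φ → set (lab E) φ
  from {φ} ne x with proj₁ (s φ) x
  ... | inj₁ y = y
  ... | inj₂ eq = ⊥-elim (ne eq)
  case-or : ∀ {φ ψ} → set (lab E) φ ⊎ set (lab E) ψ → set Δ φ ⊎ set Δ ψ
  case-or (inj₁ x) = inj₁ (to x)
  case-or (inj₂ x) = inj₂ (to x)

-- Reachable states: invariance, finite closure, excluded middle

module TableauFacts {k : ℕ} (η : SF k) (ord : Label k → RawListing k)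
                    (good : Tableau.GoodOrd η ord) where
  open Tableau η ord

  -- `again` records that a reachable prestate admits all its full expansions. It gives invariance
  -- under identification of labels, and it makes labels invented in the proof reachable.
  record Origin (Δ : Label k) : Set₁ where
    field
      Γ     : SF k → Set
      E     : FullExp Γ
      rel   : SRRel E Δ
      again : ∀ (E′ : FullExp Γ) Δ′ → SRRel E′ Δ′ → StR Δ′

  origin : ∀ {Δ} → StR Δ → Origin Δ
  origin (init E r) = record { Γ = _ ; E = E ; rel = r ; again = λ E′ Δ′ r′ → init E′ r′ }
  origin (next s σ (E , r)) = record { Γ = _ ; E = E ; rel = r ; again = λ E′ Δ′ r′ → next s σ (E′ , r′) }

  StR-hintikka : ∀ {Δ} → StR Δ → Hintikka Δ
  StR-hintikka s = hintikka E rel where open Origin (origin s)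

  StR-≈ : ∀ {Δ Δ′} → StR Δ → Δ ≈ Δ′ → StR Δ′
  StR-≈ s e = again E _ (SRRel-≈ E rel e) where open Origin (origin s)

  ord-≈ : ∀ {Δ Δ′} → StR Δ → Δ ≈ Δ′ → ord Δ ≡ ord Δ′
  ord-≈ s e = proj₂ good _ _ s (StR-≈ s e) e

  valid : ∀ {Δ} → StR Δ → ValidListing Δ (ord Δ)
  valid = proj₁ good _

  private
    Cη = closure η
    Cn = closure (nextTop {k})
    C⊥ = closure (⊥ₛ {k})

  abstract
    -- Besides the components of η, rule SR can introduce `nextTop`, which brings `⊤ₛ` as its
    -- component, and each `Cl` contains `⊥ₛ`.
    cl : List (SF k)
    cl = Closure.list Cη ++ Closure.list Cn ++ Closure.list C⊥

    cl-closed : Closed cl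
    cl-closed = Closed-++ (Closure.closed Cη) (Closed-++ (Closure.closed Cn) (Closure.closed C⊥))

    η∈cl : η ∈ˡ cl
    η∈cl = ∈-++⁺ˡ (Closure.self Cη)

    nextTop∈cl : nextTop ∈ˡ cl
    nextTop∈cl = ∈-++⁺ʳ (Closure.list Cη) (∈-++⁺ˡ (Closure.self Cn))

    ⊥∈cl : ⊥ₛ ∈ˡ cl
    ⊥∈cl = ∈-++⁺ʳ (Closure.list Cη) (∈-++⁺ʳ (Closure.list Cn) (Closure.self C⊥))

  ⊤∈cl : ⊤ₛ ∈ˡ cl
  ⊤∈cl = cl-closed nextTop∈cl sD

  Cl⊆cl : ∀ {Γ : SF k → Set} → (∀ φ → Γ φ → φ ∈ˡ cl) → ∀ {φ} → Cl Γ φ → φ ∈ˡ cl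
  Cl⊆cl = Cl⊆ cl-closed ⊤∈cl ⊥∈cl

  SR⊆cl : ∀ {Γ : SF k → Set} → (∀ φ → Γ φ → φ ∈ˡ cl) → (E : FullExp Γ) → ∀ {Δ} → SRRel E Δ →
          ∀ {φ} → set Δ φ → φ ∈ˡ cl
  SR⊆cl Γ⊆ E (inj₁ (_ , s , _)) {φ} x with proj₁ (s φ) x
  ... | inj₁ y = Cl⊆cl Γ⊆ (sub E φ y)
  ... | inj₂ refl = nextTop∈cl
  SR⊆cl Γ⊆ E (inj₂ (_ , s , _)) {φ} x = Cl⊆cl Γ⊆ (sub E φ (proj₁ (s φ) x))

  mutual
    StR⊆cl : ∀ {Δ} → StR Δ → ∀ {φ} → set Δ φ → φ ∈ˡ cl
    StR⊆cl (init E r) = SR⊆cl (λ { _ refl → η∈cl }) E r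
    StR⊆cl (next s σ (E , r)) = SR⊆cl (Γσ⊆cl s σ) E r

    Γσ⊆cl : ∀ {Δ} → StR Δ → (σ : D Δ) → ∀ φ → Γσ Δ σ φ → φ ∈ˡ cl
    Γσ⊆cl {Δ} s σ φ (inj₁ (inj₁ (p , refl , _))) =
      cl-closed (StR⊆cl s (proj₂ (proj₁ (valid s) _ _) (∈-lookup {xs = dias Δ} p))) sD
    Γσ⊆cl {Δ} s σ φ (inj₁ (inj₂ (q , refl , _))) =
      let A≢ , x = proj₂ (proj₁ (proj₂ (valid s)) _ _) (∈-lookup {xs = boxes Δ} q) in
      cl-closed (StR⊆cl s x) (sB A≢)
    Γσ⊆cl s σ φ (inj₂ (refl , _)) = ⊤∈cl

  -- Adding the reduced component of ξ to a label on condition P keeps it a full expansion,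
  -- and the listing of the resulting state then decides P.
  module Decide {Δ} (s : StR Δ) (μ : Mod k) {Φ : PF k} (x : set Δ (mk μ Φ)) (nn : NotNext Φ)
    (noTop : ∀ {ψ Ψ} → (ψ , Ψ) ∈ˡ dec Φ → T (isTopP Ψ) → ¬ ConjIn (set Δ) ψ)
    (noJump : ∀ {ψ Ψ} → (ψ , Ψ) ∈ˡ dec Φ → ∨-free Ψ → ConjIn (set Δ) ψ → ¬ set Δ (nx μ (mk μ Ψ)))
    (P : Set) where

    open Origin (origin s)

    private
      S : SF k → Set
      S = set (lab E)

      lift : ∀ {φ} → S φ → set Δ φ
      lift {φ} y with rel
      ... | inj₁ (_ , e , _) = proj₂ (e φ) (inj₁ y)
      ... | inj₂ (_ , e , _) = proj₂ (e φ) y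

      xS : S (mk μ Φ)
      xS with rel
      ... | inj₂ (_ , e , _) = proj₁ (e _) x
      ... | inj₁ (_ , e , _) with proj₁ (e _) x
      ...   | inj₁ y = y
      ...   | inj₂ eq = ⊥-elim (mk≢nextTop μ nn eq)

      linked : Σ (SF k) λ ψ → Σ (PF k) λ Ψ → (ψ , Ψ) ∈ˡ dec Φ × S ψ × S (nxt μ Ψ)
      linked with gamC E (mk μ Φ) (gammaM μ nn) xS
      ... | c , y with gammaComp⁻ μ c
      ...   | ψ , Ψ , i , eq with isTopP Ψ in top?
      ...     | true = ⊥-elim (noTop i (subst T (sym top?) tt)
                         (conjIn⁺ {S = set Δ} ψ (lift (subst S eq y))))
      ...     | false = let z , w = andC E _ _ (subst S eq y) in ψ , Ψ , i , z , w

      -- By `noTop` the linked component is not a bare state formula, hence contributes a successor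
      -- formula, and rule SR adds nothing.
      hasNext : HasNext S × Δ ≈ lab E
      hasNext with rel
      ... | inj₂ r = r
      ... | inj₁ (n , _) = ⊥-elim (¬NoNext {X = S} n μ (proj₂ (proj₂ (proj₂ (proj₂ linked)))))

      reduced : Σ (SF k) λ ψ → Σ (PF k) λ Ψ → (ψ , Ψ) ∈ˡ dec Φ × ∨-free Ψ × ConjIn S ψ
      reduced = let ψ , Ψ , i , z , w = linked in reduce (andC E) Φ i (conjIn⁺ {S = S} ψ z)

      ψ′ = proj₁ reduced
      Ψ′ = proj₁ (proj₂ reduced)
      i′ = proj₁ (proj₂ (proj₂ reduced))
      c′ = proj₂ (proj₂ (proj₂ (proj₂ reduced)))

      -- The new formulae are a successor formula and its normal form. Neither is a γ-formula, so no
      -- new link has to be designated; the normal form answers the α-rule when the coalition is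
      -- full.
      S′ : SF k → Set
      S′ φ = S φ ⊎ (φ ≡ nxt μ Ψ′ ⊎ φ ≡ nx μ (mk μ Ψ′))

      -- `ConjIn` makes the conditional part closed under conjuncts, and `Cl Γ φ` keeps it inside
      -- the closure. Labels are arbitrary predicates, so P may occur in one.
      Δᴾ : Label k
      Δᴾ = ⟨ (λ φ → S φ ⊎ (P × Cl Γ φ × ConjIn S′ φ)) , link (lab E) ⟩

      S′-old : ∀ {φ} → (∀ ν {Ψ} → φ ≢ mk ν Ψ) → S′ φ → S φ
      S′-old ne (inj₁ y) = y
      S′-old ne (inj₂ (inj₁ eq)) = ⊥-elim (ne μ eq)
      S′-old ne (inj₂ (inj₂ eq)) = ⊥-elim (ne (norm μ) eq)

      S′-lit : ∀ {p} → S′ (lit p) → S (lit p)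
      S′-lit = S′-old λ { (dia _) () ; (box _) () }

      S′-∧ : ∀ {φ ψ} → S′ (φ ∧ₛ ψ) → S (φ ∧ₛ ψ)
      S′-∧ = S′-old λ { (dia _) () ; (box _) () }

      S′-∨ : ∀ {φ ψ} → S′ (φ ∨ₛ ψ) → S (φ ∨ₛ ψ)
      S′-∨ = S′-old λ { (dia _) () ; (box _) () }

      S′-gamma : ∀ {ξ} → IsGamma ξ → S′ ξ → S ξ
      S′-gamma g (inj₁ y) = y
      S′-gamma g (inj₂ (inj₁ refl)) = ⊥-elim (¬gamma-next μ g)
      S′-gamma g (inj₂ (inj₂ refl)) = ⊥-elim (¬gamma-next (norm μ) g)

      conjIn-gamma : ∀ {ξ} → IsGamma ξ → ConjIn S′ ξ → S ξ
      conjIn-gamma (gD n) c = S′-gamma (gD n) c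
      conjIn-gamma (gB n) c = S′-gamma (gB n) c

      expands : Expands Γ Δᴾ
      expands .supE φ y = inj₁ (sup E φ y)
      expands .subE φ (inj₁ y) = sub E φ y
      expands .subE φ (inj₂ (_ , c , _)) = c
      expands .no⊥E (inj₁ y) = no⊥ E y
      expands .no⊥E (inj₂ (_ , _ , inj₁ y)) = no⊥ E (S′-∧ y)
      expands .no⊥E (inj₂ (_ , _ , inj₂ (y , z))) = noclash E 0 (S′-lit y) (S′-lit z)
      expands .clashE p y z = noclash E p (lits y) (lits z)
        where
        lits : ∀ {p} → set Δᴾ (lit p) → S (lit p)
        lits (inj₁ y) = y
        lits (inj₂ (_ , _ , y)) = S′-lit y
      expands .andE φ ψ (inj₁ y) = let z , w = andC E φ ψ y in inj₁ z , inj₁ w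
      expands .andE φ ψ (inj₂ (_ , _ , inj₁ y)) = let z , w = andC E φ ψ (S′-∧ y) in inj₁ z , inj₁ w
      expands .andE φ ψ (inj₂ (p , c , inj₂ (y , z))) = inj₂ (p , comp c αˡ , y) , inj₂ (p , comp c αʳ , z)
      expands .allE ψ (inj₁ y) = inj₁ (allA E ψ y)
      expands .allE ψ (inj₂ (p , c , inj₁ y)) = inj₁ (allA E ψ y)
      expands .allE ψ (inj₂ (p , c , inj₂ (inj₁ eq))) =
        inj₂ (p , comp c α𝔸 , inj₂ (inj₂ (sym (all-nx μ Ψ′ eq))))
      expands .allE ψ (inj₂ (p , c , inj₂ (inj₂ eq))) = ⊥-elim (¬nx-all μ eq)
      expands .orE φ ψ y with orC E φ ψ (ors y)
        where
        ors : set Δᴾ (φ ∨ₛ ψ) → S (φ ∨ₛ ψ)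
        ors (inj₁ y) = y
        ors (inj₂ (_ , _ , y)) = S′-∨ y
      ... | inj₁ z = inj₁ (inj₁ z)
      ... | inj₂ z = inj₂ (inj₁ z)
      expands .gamE ξ g y = let c , z = gamC E ξ g (gams y) in c , inj₁ z
        where
        gams : set Δᴾ ξ → S ξ
        gams (inj₁ y) = y
        gams (inj₂ (_ , _ , y)) = conjIn-gamma g y

      StRᴾ : StR Δᴾ
      StRᴾ = again (toFullExp expands) Δᴾ (inj₂ (has (proj₁ hasNext) , ≈-refl Δᴾ))
        where
        has : HasNext S → HasNext (set Δᴾ)
        has (A , φ , inj₁ y) = A , φ , inj₁ (inj₁ y)
        has (A , φ , inj₂ y) = A , φ , inj₂ (inj₁ y)

      noTop′ : isTopP Ψ′ ≡ false
      noTop′ with isTopP Ψ′ in top?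
      ... | true = ⊥-elim (noTop i′ (subst T (sym top?) tt) (conjIn-map (λ _ → lift) ψ′ c′))
      ... | false = refl

      Cl-nxt : Cl Γ (nxt μ Ψ′)
      Cl-nxt = comp (subst (Cl Γ) eq (comp (sub E _ xS) (γc (gammaComp μ nn i′)))) αʳ
        where
        eq : compM μ ψ′ Ψ′ ≡ (ψ′ ∧ₛ nxt μ Ψ′)
        eq = cong (λ b → if b then ψ′ else (ψ′ ∧ₛ nxt μ Ψ′)) noTop′

      Cl-nx : ∀ μ′ {φ} → Cl Γ (mk μ′ (○ φ)) → Cl Γ (nx μ′ φ)
      Cl-nx (dia A) c = c
      Cl-nx (box A) c with A ≟C full
      ... | yes refl = comp c α𝔸
      ... | no _ = c

    decide : P ⊎ ¬ P
    decide with Entry? (ord Δᴾ) (norm μ) (mk μ Ψ′)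
    ... | no ¬e = inj₂ λ p → ¬e (entry⁺ Δᴾ (valid StRᴾ) μ
                    (inj₂ (p , Cl-nx μ Cl-nxt , conjIn⁺ (nx μ (mk μ Ψ′)) (inj₂ (inj₂ refl)))))
    ... | yes e with entry⁻ Δᴾ (valid StRᴾ) μ e
    ...   | inj₂ (p , _) = inj₁ p
    -- Membership independent of P would say nothing about P; it would be an available jump, which
    -- is excluded.
    ...   | inj₁ y = ⊥-elim (noJump i′ (proj₁ (proj₂ (proj₂ (proj₂ reduced))))
                       (conjIn-map (λ _ → lift) ψ′ c′) (lift y))

-- Finite codes for labels

_∈S?_ : (φ : SF k) (L : List (SF k)) → Dec (φ ∈ˡ L)
φ ∈S? L = any? (φ ≟S_) L

-- Up to identity of labels only the links of γ-formulae in the label count, so a finite table can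
-- replace the link function.
Code : ℕ → Set
Code k = List (SF k) × List (SF k × SF k)

tableLink : List (SF k × SF k) → SF k → SF k
tableLink [] ξ = ξ
tableLink ((ξ′ , χ) ∷ t) ξ with ξ ≟S ξ′
... | yes _ = χ
... | no _ = tableLink t ξ

tableLink-∈ : ∀ (t : List (SF k × SF k)) {ξ χ} → (ξ , χ) ∈ˡ t → (ξ , tableLink t ξ) ∈ˡ t
tableLink-∈ ((ξ′ , χ) ∷ t) {ξ} i with ξ ≟S ξ′
tableLink-∈ ((ξ′ , χ) ∷ t) i | yes refl = here refl
tableLink-∈ ((ξ′ , χ) ∷ t) (here refl) | no ne = ⊥-elim (ne refl)
tableLink-∈ ((ξ′ , χ) ∷ t) (there i) | no ne = there (tableLink-∈ t i)

IsSucc : SF k → Set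
IsSucc {k} ξ = Σ (Mod k) λ μ → Σ (SF k) λ φ → ξ ≡ mk μ (○ φ)

isSucc? : (ξ : SF k) → Dec (IsSucc ξ)
isSucc? {k} ξ = go ξ
  where
  modal : ∀ (μ : Mod k) Φ → Dec (IsSucc (mk μ Φ))
  modal μ Φ with nextView Φ
  ... | isNext φ = yes (μ , φ , refl)
  ... | notNext nn = no λ { (ν , φ , eq) → ¬gamma-next ν (subst IsGamma eq (gammaM μ nn)) }
  go : (ξ : SF k) → Dec (IsSucc ξ)
  go (lit _) = no λ { (dia _ , _ , ()) ; (box _ , _ , ()) }
  go (_ ∨ₛ _) = no λ { (dia _ , _ , ()) ; (box _ , _ , ()) }
  go (_ ∧ₛ _) = no λ { (dia _ , _ , ()) ; (box _ , _ , ()) }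
  go (⟪ A ⟫ Φ) = modal (dia A) Φ
  go (⟦ A ⟧ Φ) = modal (box A) Φ

hasNext? : (L : List (SF k)) → Dec (HasNext (_∈ˡ L))
hasNext? {k} L = map′ to from (any? isSucc? L)
  where
  to : Any IsSucc L → HasNext (_∈ˡ L)
  to x with find x
  ... | _ , i , dia A , φ , refl = A , φ , inj₁ i
  ... | _ , i , box A , φ , refl = A , φ , inj₂ i
  from : HasNext (_∈ˡ L) → Any IsSucc L
  from (A , φ , inj₁ i) = lose i (dia A , φ , refl)
  from (A , φ , inj₂ i) = lose i (box A , φ , refl)

-- A code stands for a full expansion; stateLabel is the state that rule SR makes of it.
expLabel : Code k → Label k
expLabel e = ⟨ (_∈ˡ proj₁ e) , tableLink (proj₂ e) ⟩

stateSet : Code k → List (SF k)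
stateSet (X , _) with hasNext? X
... | yes _ = X
... | no _ = nextTop ∷ X

stateLabel : Code k → Label k
stateLabel e = ⟨ (_∈ˡ stateSet e) , tableLink (proj₂ e) ⟩

¬HasNext : ∀ {X : SF k → Set} → ¬ HasNext X → NoNext X
¬HasNext n A φ = (λ x → n (A , φ , inj₁ x)) , (λ x → n (A , φ , inj₂ x))

stateLabel-SR : ∀ {Γ : SF k → Set} (e : Code k) (E : Expands Γ (expLabel e)) →
                SRRel (toFullExp E) (stateLabel e)
stateLabel-SR e@(X , t) E with hasNext? X
... | yes h = inj₂ (h , ≈-refl (expLabel e))
... | no ¬h = inj₁ (¬HasNext {X = _∈ˡ X} ¬h ,
  (λ φ → (λ { (here eq) → inj₂ eq ; (there i) → inj₁ i }) , (λ { (inj₁ i) → there i ; (inj₂ eq) → here eq })) ,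
  λ _ _ _ → refl)

SR-stateLabel : ∀ {Γ : SF k → Set} (E : FullExp Γ) {Δ} → SRRel E Δ → (e : Code k) →
                lab E ≈ expLabel e → Δ ≈ stateLabel e
SR-stateLabel E {Δ} rel e@(X , t) eq with hasNext? X
SR-stateLabel E {Δ} (inj₂ (_ , r)) e@(X , t) eq | yes _ = ≈-trans r eq
SR-stateLabel E {Δ} (inj₁ (n , _)) e@(X , t) (s , l) | yes (A , φ , inj₁ i) =
  ⊥-elim (proj₁ (n A φ) (proj₂ (s _) i))
SR-stateLabel E {Δ} (inj₁ (n , _)) e@(X , t) (s , l) | yes (A , φ , inj₂ i) =
  ⊥-elim (proj₂ (n A φ) (proj₂ (s _) i))
SR-stateLabel E {Δ} (inj₂ ((A , φ , inj₁ x) , _)) e@(X , t) (s , l) | no ¬h =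
  ⊥-elim (¬h (A , φ , inj₁ (proj₁ (s _) x)))
SR-stateLabel E {Δ} (inj₂ ((A , φ , inj₂ x) , _)) e@(X , t) (s , l) | no ¬h =
  ⊥-elim (¬h (A , φ , inj₂ (proj₁ (s _) x)))
SR-stateLabel E {Δ} (inj₁ (n , s′ , l′)) e@(X , t) (s , l) | no ¬h =
  (λ φ → to φ , from φ) , λ ξ g x → trans (l′ ξ g x) (l ξ g (gam ξ g (proj₁ (s′ ξ) x)))
  where
  to : ∀ φ → set Δ φ → φ ∈ˡ (nextTop ∷ X)
  to φ x with proj₁ (s′ φ) x
  ... | inj₁ y = there (proj₁ (s φ) y)
  ... | inj₂ eq = here eq
  from : ∀ φ → φ ∈ˡ (nextTop ∷ X) → set Δ φ
  from φ (here eq) = proj₂ (s′ φ) (inj₂ eq)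
  from φ (there i) = proj₂ (s′ φ) (inj₁ (proj₂ (s φ) i))
  gam : ∀ ξ → IsGamma ξ → set (lab E) ξ ⊎ ξ ≡ nextTop → set (lab E) ξ
  gam ξ g (inj₁ y) = y
  gam ξ g (inj₂ refl) = ⊥-elim (¬gamma-next (dia full) g)

-- On a member with a successor main operator the demand is trivial unless the modality is
-- `⟦ full ⟧`, where it is the α-rule.
LocalM : Code k → Mod k → PF k → Set
LocalM e μ Φ with nextView Φ
... | isNext φ = nx μ φ ∈ˡ proj₁ e
... | notNext _ = tableLink (proj₂ e) (mk μ Φ) ∈ˡ map (uncurry (compM μ)) (dec Φ) ×
                  tableLink (proj₂ e) (mk μ Φ) ∈ˡ proj₁ e

Local : Code k → SF k → Set
Local e (lit (pos p)) = ¬ (lit (neg p) ∈ˡ proj₁ e)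
Local e (lit (neg p)) = ⊤
Local e (φ ∨ₛ ψ) = φ ∈ˡ proj₁ e ⊎ ψ ∈ˡ proj₁ e
Local e (φ ∧ₛ ψ) = φ ∈ˡ proj₁ e × ψ ∈ˡ proj₁ e
Local e (⟪ A ⟫ Φ) = LocalM e (dia A) Φ
Local e (⟦ A ⟧ Φ) = LocalM e (box A) Φ

LocalM? : ∀ (e : Code k) μ Φ → Dec (LocalM e μ Φ)
LocalM? e μ Φ with nextView Φ
... | isNext φ = nx μ φ ∈S? proj₁ e
... | notNext _ = (_ ∈S? _) ×-dec (_ ∈S? _)

Local? : ∀ (e : Code k) φ → Dec (Local e φ)
Local? e (lit (pos p)) = ¬? (_ ∈S? _)
Local? e (lit (neg p)) = yes tt
Local? e (φ ∨ₛ ψ) = (_ ∈S? _) ⊎-dec (_ ∈S? _)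
Local? e (φ ∧ₛ ψ) = (_ ∈S? _) ×-dec (_ ∈S? _)
Local? e (⟪ A ⟫ Φ) = LocalM? e (dia A) Φ
Local? e (⟦ A ⟧ Φ) = LocalM? e (box A) Φ

-- Deciding expansion and reachability of codes

module Codes {k : ℕ} (η : SF k) (ord : Label k → RawListing k)
             (good : Tableau.GoodOrd η ord) where
  open Tableau η ord
  open TableauFacts η ord good

  -- A full expansion must stay in the closure of its own prestate G, which can be smaller than
  -- `cl`; so this closure is computed for each G, inside `cl`.
  module ClApprox (G : List (SF k)) where
    F : (SF k → Set) → SF k → Set
    F P φ = φ ∈ˡ G ⊎ (φ ≡ ⊤ₛ ⊎ (φ ≡ ⊥ₛ ⊎ Any (λ φ′ → P φ′ × φ ∈ˡ comps φ′) cl))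

    mono : ∀ {P Q : SF k → Set} → (∀ x → P x → Q x) → ∀ x → F P x → F Q x
    mono f x (inj₁ i) = inj₁ i
    mono f x (inj₂ (inj₁ i)) = inj₂ (inj₁ i)
    mono f x (inj₂ (inj₂ (inj₁ i))) = inj₂ (inj₂ (inj₁ i))
    mono f x (inj₂ (inj₂ (inj₂ i))) = inj₂ (inj₂ (inj₂ (Any.map (λ { (p , j) → f _ p , j }) i)))

    F? : ∀ {P : SF k → Set} → (∀ x → Dec (P x)) → ∀ x → Dec (F P x)
    F? P? φ = (φ ∈S? G) ⊎-dec ((φ ≟S ⊤ₛ) ⊎-dec ((φ ≟S ⊥ₛ) ⊎-dec
                any? (λ φ′ → P? φ′ ×-dec (φ ∈S? comps φ′)) cl))

    open Approximants F mono F? cl public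

    It-sound : ∀ n {φ} → It n φ → Cl (_∈ˡ G) φ
    It-sound (suc n) (inj₁ i) = base i
    It-sound (suc n) (inj₂ (inj₁ refl)) = top
    It-sound (suc n) (inj₂ (inj₂ (inj₁ refl))) = bot
    It-sound (suc n) (inj₂ (inj₂ (inj₂ i))) with find i
    ... | φ′ , _ , x , j = comp (It-sound n x) (comps⁻ φ′ j)

    module _ (G⊆ : ∀ φ → φ ∈ˡ G → φ ∈ˡ cl) where
      It-complete : ∀ {φ} → Cl (_∈ˡ G) φ → It stage φ
      It-complete c = stage-closed _ (Cl⊆cl G⊆ c) (step c)
        where
        step : ∀ {φ} → Cl (_∈ˡ G) φ → It (suc stage) φ
        step (base i) = inj₁ i
        step top = inj₂ (inj₁ refl)
        step bot = inj₂ (inj₂ (inj₁ refl))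
        step (comp c d) = inj₂ (inj₂ (inj₂ (lose (Cl⊆cl G⊆ c) (It-complete c , comps⁺ d))))

  ExpandsC : List (SF k) → Code k → Set
  ExpandsC G e@(X , _) = All (_∈ˡ X) G × All (ClApprox.It G (ClApprox.stage G)) X ×
                         (¬ (⊥ₛ ∈ˡ X)) × All (Local e) X

  ExpandsC? : ∀ G e → Dec (ExpandsC G e)
  ExpandsC? G e@(X , _) = all? (_∈S? X) G ×-dec (all? (ClApprox.It? G (ClApprox.stage G)) X ×-dec
                          (¬? (⊥ₛ ∈S? X) ×-dec all? (Local? e) X))

  expandsC-sound : ∀ G e → ExpandsC G e → Expands (_∈ˡ G) (expLabel e)
  expandsC-sound G e@(X , t) (sups , subs , n⊥ , loc) = record
    { supE = λ φ i → All.lookup sups i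
    ; subE = λ φ i → ClApprox.It-sound G (ClApprox.stage G) (All.lookup subs i)
    ; no⊥E = n⊥
    ; clashE = λ p i j → All.lookup loc i j
    ; andE = λ φ ψ i → All.lookup loc i
    ; allE = λ ψ i → subst (λ μ → mk μ (○ ψ) ∈ˡ X) norm-full (All.lookup loc i)
    ; orE = λ φ ψ i → All.lookup loc i
    ; gamE = λ { ξ (gD nn) i → gam (dia _) nn (All.lookup loc i)
               ; ξ (gB nn) i → gam (box _) nn (All.lookup loc i) } }
    where
    gam : ∀ μ {Φ} → NotNext Φ → LocalM e μ Φ →
          GammaComp (mk μ Φ) (tableLink t (mk μ Φ)) × tableLink t (mk μ Φ) ∈ˡ X
    gam μ {Φ} nn l with nextView Φ
    ... | isNext _ = ⊥-elim nn
    ... | notNext _ with ∈-map⁻ _ (proj₁ l)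
    ...   | _ , j , eq = subst (GammaComp (mk μ Φ)) (sym eq) (gammaComp μ nn j) , proj₂ l

  expandsC-complete : ∀ G e → (∀ φ → φ ∈ˡ G → φ ∈ˡ cl) → Expands (_∈ˡ G) (expLabel e) → ExpandsC G e
  expandsC-complete G e@(X , t) G⊆ E =
    All.tabulate (λ i → supE E _ i) ,
    All.tabulate (λ i → ClApprox.It-complete G G⊆ (subE E _ i)) ,
    no⊥E E , All.tabulate (λ {φ} → local φ)
    where
    modal : ∀ μ Φ → mk μ Φ ∈ˡ X → LocalM e μ Φ
    modal μ Φ i with nextView Φ
    ... | notNext nn with gamE E (mk μ Φ) (gammaM μ nn) i
    ...   | c , j with gammaComp⁻ μ c
    ...     | ψ , Ψ , l , eq = subst (_∈ˡ _) (sym eq) (∈-map⁺ (uncurry (compM μ)) l) , j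
    modal (dia A) _ i | isNext φ = i
    modal (box A) _ i | isNext φ with A ≟C full
    ... | yes refl = allE E φ i
    ... | no _ = i
    local : ∀ φ → φ ∈ˡ X → Local e φ
    local (lit (pos p)) i = clashE E p i
    local (lit (neg p)) i = tt
    local (φ ∨ₛ ψ) i = orE E φ ψ i
    local (φ ∧ₛ ψ) i = andE E φ ψ i
    local (⟪ A ⟫ Φ) i = modal (dia A) Φ i
    local (⟦ A ⟧ Φ) i = modal (box A) Φ i

  listing : Code k → RawListing k
  listing e = ord (stateLabel e)

  Moves : Code k → Set
  Moves e = Vec (Fin (size (listing e))) k

  codes : List (Code k)
  codes = cartesianProduct (sublists cl) (sublists (cartesianProduct cl cl))

  -- The counterpart of `StR` on codes. It can be iterated because `ord` returns actual lists: the
  -- prestate reached from a code by a given move is computed.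
  module StApprox where
    F : (Code k → Set) → Code k → Set
    F P e′ = ExpandsC [ η ] e′ ⊎
      Any (λ e → P e × Σ (Moves e) λ v → ExpandsC (forced (listing e) (vlookup v)) e′) codes

    mono : ∀ {P Q : Code k → Set} → (∀ x → P x → Q x) → ∀ x → F P x → F Q x
    mono f x (inj₁ i) = inj₁ i
    mono f x (inj₂ i) = inj₂ (Any.map (λ { (p , j) → f _ p , j }) i)

    F? : ∀ {P : Code k → Set} → (∀ x → Dec (P x)) → ∀ x → Dec (F P x)
    F? P? e′ = ExpandsC? [ η ] e′ ⊎-dec
      any? (λ e → P? e ×-dec ∃Vec? k (λ v → ExpandsC? (forced (listing e) (vlookup v)) e′)) codes

    open Approximants F mono F? codes public

  Reachable : Code k → Set
  Reachable = StApprox.It StApprox.stage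

  reachable? : ∀ e → Dec (Reachable e)
  reachable? = StApprox.It? StApprox.stage

  reachable-sound : ∀ {e} → Reachable e → StR (stateLabel e)
  reachable-sound = go StApprox.stage
    where
    go : ∀ n {e} → StApprox.It n e → StR (stateLabel e)
    go (suc n) {e} (inj₁ x) = init (toFullExp E) (stateLabel-SR e E)
      where
      E : Expands (_≡ η) (expLabel e)
      E = Expands-cong (λ { (here eq) → eq ; (there ()) }) here (≈-refl (expLabel e)) (expandsC-sound [ η ] e x)
    go (suc n) {e′} (inj₂ i) = step (find i)
      where
      step : Σ (Code k) (λ e → e ∈ˡ codes × StApprox.It n e ×
               Σ (Moves e) λ v → ExpandsC (forced (listing e) (vlookup v)) e′) → StR (stateLabel e′)
      step (e , _ , x , v , y) = next (go n x) (vlookup v) (toFullExp E , stateLabel-SR e′ E)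
        where
        E : Expands (Forced (listing e) (vlookup v)) (expLabel e′)
        E = Expands-cong (forced⁻ (listing e) (vlookup v) _) (forced⁺ (listing e) (vlookup v) _)
              (≈-refl (expLabel e′)) (expandsC-sound (forced (listing e) (vlookup v)) e′ y)

  -- Two comprehensions, for the set and for the graph of the link on its members. The graph lies in
  -- `cl × cl` because a linked component belongs to the label.
  encode : ∀ {Γ : SF k → Set} {Δ} → (∀ φ → Γ φ → φ ∈ˡ cl) → Expands Γ Δ →
           ¬ ¬ Σ (Code k) λ e → e ∈ˡ codes × Δ ≈ expLabel e
  encode {Δ = Δ} Γ⊆ E = do
    X , X∈ , Xeq ← comprehension (set Δ) cl
    t , t∈ , teq ← comprehension (λ { (ξ , χ) → set Δ ξ × link Δ ξ ≡ χ }) (cartesianProduct cl cl)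
    return ((X , t) , ∈-cartesianProduct⁺ X∈ t∈ ,
      (λ φ → (λ x → proj₂ (Xeq φ) (inCl x) x) , (λ i → proj₂ (proj₁ (Xeq φ) i))) ,
      λ ξ g x → proj₂ (proj₂ (proj₁ (teq _) (tableLink-∈ t (proj₂ (teq (ξ , link Δ ξ))
        (∈-cartesianProduct⁺ (inCl x) (inCl (proj₂ (gamE E ξ g x)))) (x , refl))))))
    where
    inCl : ∀ {φ} → set Δ φ → φ ∈ˡ cl
    inCl {φ} x = Cl⊆cl Γ⊆ (subE E φ x)

  -- The type of a move depends on the listing, so what the move forces has to be carried along with
  -- it.
  transport : ∀ {o o′ : RawListing k} → o ≡ o′ → (σ : Prof o) →
              Σ (Prof o′) λ σ′ → ∀ φ → (Forced o σ φ → Forced o′ σ′ φ) × (Forced o′ σ′ φ → Forced o σ φ)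
  transport refl σ = σ , λ φ → (λ x → x) , (λ x → x)

  reachable-complete : ∀ {Δ} → StR Δ → ¬ ¬ Σ (Code k) λ e → e ∈ˡ codes × Reachable e × Δ ≈ stateLabel e
  reachable-complete (init E r) = do
    e , e∈ , eq ← encode (λ { _ refl → η∈cl }) (fromFullExp E)
    let x = expandsC-complete [ η ] e (λ { _ (here refl) → η∈cl ; _ (there ()) })
              (Expands-cong here (λ { (here p) → p ; (there ()) }) eq (fromFullExp E))
    return (e , e∈ , StApprox.stage-closed e e∈ (inj₁ x) , SR-stateLabel E r e eq)
  reachable-complete (next {Δ} s σ (E , r)) = do
    e , e∈ , re , Δ≈ ← reachable-complete s
    e′ , e′∈ , eq ← encode (Γσ⊆cl s σ) (fromFullExp E)
    let σ′ , tr = transport (ord-≈ s Δ≈) σ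
        o = listing e
        v = vtabulate σ′
        to : ∀ {φ} → Forced (ord Δ) σ φ → φ ∈ˡ forced o (vlookup v)
        to x = forced⁺ o (vlookup v) _ (Forced-cong o (λ a → sym (lookup∘tabulate σ′ a)) (proj₁ (tr _) x))
        from : ∀ {φ} → φ ∈ˡ forced o (vlookup v) → Forced (ord Δ) σ φ
        from i = proj₂ (tr _) (Forced-cong o (lookup∘tabulate σ′) (forced⁻ o (vlookup v) _ i))
        x = expandsC-complete (forced o (vlookup v)) e′ (λ φ i → Γσ⊆cl s σ φ (from i))
              (Expands-cong to from eq (fromFullExp E))
    return (e′ , e′∈ , StApprox.stage-closed e′ e′∈ (inj₂ (lose e∈ (re , v , x))) , SR-stateLabel E r e′ eq)

-- Tracking a path formula along a play

-- `jump` and `follow` both continue with a remainder, but only `follow` goes along the link and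
-- thus agrees with the realisation given by the tableau.
data Track (k : ℕ) : Set where
  done : Track k
  jump follow : PF k → Track k

module _ (e : Code k) (μ : Mod k) (Φ : PF k) where
  private
    S : SF k → Set
    S = _∈ˡ stateSet e

    S? : ∀ φ → Dec (S φ)
    S? φ = φ ∈S? stateSet e

  TopOption JumpOption LinkOption : SF k × PF k → Set
  TopOption (ψ , Ψ) = T (isTopP Ψ) × ConjIn S ψ
  JumpOption (ψ , Ψ) = ∨-free Ψ × ConjIn S ψ × S (nx μ (mk μ Ψ))
  LinkOption (ψ , Ψ) = tableLink (proj₂ e) (mk μ Φ) ≡ (ψ ∧ₛ nxt μ Ψ) × S ψ × S (nx μ (mk μ Ψ))

  linkTo : Dec (Any LinkOption (dec Φ)) → Track k
  linkTo (yes x) = follow (proj₂ (proj₁ (find x)))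
  linkTo (no _) = done

  choose : Dec (Any TopOption (dec Φ)) → Dec (∨-free Φ) → Dec (Any JumpOption (dec Φ)) →
           Dec (Any LinkOption (dec Φ)) → Track k
  choose (yes _) _ _ _ = done
  choose (no _) (no _) (yes x) _ = jump (proj₂ (proj₁ (find x)))
  choose (no _) (no _) (no _) l = linkTo l
  choose (no _) (yes _) _ l = linkTo l

  topOption? : Dec (Any TopOption (dec Φ))
  topOption? = any? (λ x → T? (isTopP (proj₂ x)) ×-dec conjIn? S? (proj₁ x)) (dec Φ)

  jumpOption? : Dec (Any JumpOption (dec Φ))
  jumpOption? = any? (λ x → ∨-free? (proj₂ x) ×-dec (conjIn? S? (proj₁ x) ×-dec S? (nx μ (mk μ (proj₂ x))))) (dec Φ)

  linkOption? : Dec (Any LinkOption (dec Φ))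
  linkOption? = any? (λ x → (tableLink (proj₂ e) (mk μ Φ) ≟S (proj₁ x ∧ₛ nxt μ (proj₂ x))) ×-dec
                            (S? (proj₁ x) ×-dec S? (nx μ (mk μ (proj₂ x))))) (dec Φ)

  -- The negative premises of `isFollow` are what `Decide` asks for when the formula contains `∨ₚ`;
  -- they hold because `choose` tries discharge first and a jump next.
  data TrackSpec : Track k → Set where
    isDone   : ∀ {ψ Ψ} → (ψ , Ψ) ∈ˡ dec Φ → T (isTopP Ψ) → ConjIn S ψ → TrackSpec done
    isJump   : ∀ {ψ Ψ} → ¬ ∨-free Φ → (ψ , Ψ) ∈ˡ dec Φ → ∨-free Ψ → ConjIn S ψ →
               S (nx μ (mk μ Ψ)) → TrackSpec (jump Ψ)
    isFollow : ∀ {ψ Ψ} → ∨-free Φ ⊎ (¬ Any JumpOption (dec Φ)) → ¬ Any TopOption (dec Φ) →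
               (ψ , Ψ) ∈ˡ dec Φ → tableLink (proj₂ e) (mk μ Φ) ≡ (ψ ∧ₛ nxt μ Ψ) → ConjIn S ψ →
               S (nx μ (mk μ Ψ)) → TrackSpec (follow Ψ)

  module _ (H : Hintikka (stateLabel e)) (x : S (mk μ Φ)) (nn : NotNext Φ) where
    open Hintikka H

    private
      mustLink : ¬ Any TopOption (dec Φ) → Any LinkOption (dec Φ)
      mustLink ¬top with gamH (mk μ Φ) (gammaM μ nn) x
      ... | c , y with gammaComp⁻ μ c
      ...   | ψ , Ψ , i , eq with isTopP Ψ in top?
      ...     | true = ⊥-elim (¬top (lose i (subst T (sym top?) tt , conjIn⁺ {S = S} ψ (subst S eq y))))
      ...     | false = let z , w = andH _ _ (subst S eq y) in lose i (eq , z , nx-in μ w)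

      linkTo-spec : ∀ l → ∨-free Φ ⊎ (¬ Any JumpOption (dec Φ)) → ¬ Any TopOption (dec Φ) → TrackSpec (linkTo l)
      linkTo-spec (yes l) f ¬t with find l
      ... | (ψ , Ψ) , i , eq , y , z = isFollow f ¬t i eq (conjIn⁺ {S = S} ψ y) z
      linkTo-spec (no ¬l) f ¬t = ⊥-elim (¬l (mustLink ¬t))

    choose-spec : ∀ t f j l → TrackSpec (choose t f j l)
    choose-spec (yes t) f j l with find t
    ... | _ , i , isTop , c = isDone i isTop c
    choose-spec (no ¬t) (no ¬f) (yes j) l with find j
    ... | _ , i , f , c , y = isJump ¬f i f c y
    choose-spec (no ¬t) (no ¬f) (no ¬j) l = linkTo-spec l (inj₂ ¬j) ¬t
    choose-spec (no ¬t) (yes f) j l = linkTo-spec l (inj₁ f) ¬t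

  abstract
    -- On a formula containing ∨ₚ, an ∨ₚ-free component is preferred to the linked one: it fixes
    -- the disjunct to be satisfied, which cannot be read off finitely many states of a play.
    track : Track k
    track = choose topOption? (∨-free? Φ) jumpOption? linkOption?

    track-spec : Hintikka (stateLabel e) → mk μ Φ ∈ˡ stateSet e → NotNext Φ → TrackSpec track
    track-spec H x nn = choose-spec H x nn topOption? (∨-free? Φ) jumpOption? linkOption?

NotNext? : (Φ : PF k) → Dec (NotNext Φ)
NotNext? Φ with nextView Φ
... | isNext _ = no λ ()
... | notNext nn = yes nn

Goal : ℕ → Set
Goal k = Mod k × PF k

goalsOf : SF k → List (Goal k)
goalsOf (⟪ A ⟫ Φ) = [ dia A , Φ ]
goalsOf (⟦ A ⟧ Φ) = [ box A , Φ ]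
goalsOf _ = []

goalsOf-mk : ∀ (μ : Mod k) Φ → (μ , Φ) ∈ˡ goalsOf (mk μ Φ)
goalsOf-mk (dia A) Φ = here refl
goalsOf-mk (box A) Φ = here refl

norm-proper : ∀ {A : Coal k} → A ≢ full → norm (box A) ≡ box A
norm-proper {A = A} A≢ with A ≟C full
... | yes eq = ⊥-elim (A≢ eq)
... | no _ = refl

∧-next-injective : ∀ (μ : Mod k) {φ ψ ξ Ψ} → (φ ∧ₛ mk μ (○ ξ)) ≡ (ψ ∧ₛ nxt μ Ψ) → ξ ≡ mk μ Ψ
∧-next-injective (dia A) refl = refl
∧-next-injective (box A) refl = refl

transportMove : ∀ {o o′ : RawListing k} → o ≡ o′ → (σ′ : Prof o′) →
  Σ (Prof o) λ σ → (∀ φ → Forced₀ o′ σ′ φ → Forced₀ o σ φ) × (∀ μ φ → Follows o′ μ φ σ′ → Follows o μ φ σ)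
transportMove refl σ = σ , (λ _ x → x) , (λ _ _ x → x)

-- From the final tableau to a finite list of codes

module Realisation {k : ℕ} (η : SF k) (ord : Label k → RawListing k)
                   (good : Tableau.GoodOrd η ord) where
  open Tableau η ord
  open TableauFacts η ord good
  open Codes η ord good

  goals : List (Goal k)
  goals = concatMap goalsOf cl

  ∈-goals : ∀ μ Φ → mk μ Φ ∈ˡ cl → (μ , Φ) ∈ˡ goals
  ∈-goals μ Φ i = ∈-concatMap⁺ goalsOf (lose i (goalsOf-mk μ Φ))

  -- Of an edge only its effect is kept, the arrival of the forced formulae, which is decidable. The
  -- Hintikka conditions of e′ come from its own reachability.
  Succ : (e : Code k) → Moves e → Code k → Set
  Succ e v e′ = All (_∈ˡ stateSet e′) (forced₀ (listing e) (vlookup v))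

  Succ? : ∀ e v e′ → Dec (Succ e v e′)
  Succ? e v e′ = all? (_∈S? stateSet e′) _

  module RealApprox (W : List (Code k)) where
    -- `done` and `jump` end the pursuit successfully: the tracked formula is discharged or replaced
    -- by one of smaller rank, and the induction on rank takes over.
    Later : (Code k × Goal k → Set) → Code k → Mod k → Track k → Set
    Later P e μ done = ⊤
    Later P e μ (jump _) = ⊤
    Later P e μ (follow Ψ) = ∀ (v : Moves e) → Follows (listing e) (norm μ) (mk μ Ψ) (vlookup v) →
      Any (λ e′ → Succ e v e′ × P (e′ , μ , Ψ)) W

    F : (Code k × Goal k → Set) → Code k × Goal k → Set
    F P (e , μ , Φ) = Real Φ (_∈ˡ stateSet e) ⊎ Later P e μ (track e μ Φ)

    mono : ∀ {P Q : Code k × Goal k → Set} → (∀ x → P x → Q x) → ∀ x → F P x → F Q x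
    mono f (e , μ , Φ) (inj₁ r) = inj₁ r
    mono {P} {Q} f (e , μ , Φ) (inj₂ l) = inj₂ (go (track e μ Φ) l)
      where
      go : ∀ t → Later P e μ t → Later Q e μ t
      go done l = tt
      go (jump _) l = tt
      go (follow Ψ) l v fo = Any.map (λ { (s , p) → s , f _ p }) (l v fo)

    Later? : ∀ {P} → (∀ x → Dec (P x)) → ∀ e μ t → Dec (Later P e μ t)
    Later? P? e μ done = yes tt
    Later? P? e μ (jump _) = yes tt
    Later? P? e μ (follow Ψ) = ∀Vec? k (λ v → Follows? (listing e) (norm μ) (mk μ Ψ) (vlookup v) →-dec
      any? (λ e′ → Succ? e v e′ ×-dec P? (e′ , μ , Ψ)) W)

    F? : ∀ {P : Code k × Goal k → Set} → (∀ x → Dec (P x)) → ∀ x → Dec (F P x)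
    F? P? (e , μ , Φ) = Real? (λ φ → φ ∈S? stateSet e) Φ ⊎-dec Later? P? e μ (track e μ Φ)

    open Approximants F mono F? (cartesianProduct codes goals) public

  abstract
    -- All that the game needs, with bounded quantifiers only and without the final tableau T. This
    -- makes it decidable.
    Model : List (Code k) → Set
    Model W = Any (λ e → η ∈ˡ stateSet e) W × All Reachable W ×
      All (λ e → ∀ (v : Moves e) → Any (Succ e v) W) W ×
      All (λ e → All (λ g → uncurry mk g ∈ˡ stateSet e → NotNext (proj₂ g) →
                            RealApprox.It W (RealApprox.stage W) (e , g)) goals) W

    Model? : ∀ W → Dec (Model W)
    Model? W = any? (λ e → η ∈S? stateSet e) W ×-dec (all? reachable? W ×-dec
      (all? (λ e → ∀Vec? k (λ v → any? (Succ? e v) W)) W ×-dec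
       all? (λ e → all? (λ g → (uncurry mk g ∈S? stateSet e) →-dec (NotNext? (proj₂ g) →-dec
         RealApprox.It? W (RealApprox.stage W) (e , g))) goals) W))

    Model-intro : ∀ {W} → Any (λ e → η ∈ˡ stateSet e) W → (∀ {e} → e ∈ˡ W → Reachable e) →
      (∀ {e} → e ∈ˡ W → ∀ (v : Moves e) → Any (Succ e v) W) →
      (∀ {e} → e ∈ˡ W → ∀ μ Φ → mk μ Φ ∈ˡ stateSet e → NotNext Φ →
        RealApprox.It W (RealApprox.stage W) (e , μ , Φ)) → Model W
    Model-intro x r s g = x , All.tabulate r , All.tabulate s ,
      All.tabulate (λ i → All.tabulate (λ {h} _ → g i (proj₁ h) (proj₂ h)))

    Model-initial : ∀ {W} → Model W → Any (λ e → η ∈ˡ stateSet e) W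
    Model-initial = proj₁

    Model-reachable : ∀ {W} → Model W → ∀ {e} → e ∈ˡ W → Reachable e
    Model-reachable M = All.lookup (proj₁ (proj₂ M))

    Model-serial : ∀ {W} → Model W → ∀ {e} → e ∈ˡ W → ∀ (v : Moves e) → Any (Succ e v) W
    Model-serial M = All.lookup (proj₁ (proj₂ (proj₂ M)))

    Model-realised : ∀ {W} → Model W → ∀ {e} → e ∈ˡ W → ∀ {μ Φ} → (μ , Φ) ∈ˡ goals →
      mk μ Φ ∈ˡ stateSet e → NotNext Φ → RealApprox.It W (RealApprox.stage W) (e , μ , Φ)
    Model-realised M i = All.lookup (All.lookup (proj₂ (proj₂ (proj₂ M))) i)

  run⊆StR : ∀ {T} → ElimRun T → ∀ {Δ} → T Δ → StR Δ
  run⊆StR start t = t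
  run⊆StR (del r _ _ _) (t , _) = run⊆StR r t

  -- A deletion removes a whole class of identified labels.
  run-≈ : ∀ {T} → ElimRun T → ∀ {Δ Δ′} → T Δ → Δ ≈ Δ′ → T Δ′
  run-≈ start t e = StR-≈ t e
  run-≈ (del r Δ₀ _ _) (t , n) e = run-≈ r t e , λ e′ → n (≈-trans e e′)

  edge-⊆ : ∀ {Δ σ Δ′} → Edge Δ σ Δ′ → ∀ {φ} → Forced₀ (ord Δ) σ φ → set Δ′ φ
  edge-⊆ (E , inj₁ (_ , s , _)) f = proj₂ (s _) (inj₁ (sup E _ (inj₁ f)))
  edge-⊆ (E , inj₂ (_ , s , _)) f = proj₂ (s _) (sup E _ (inj₁ f))

  module FromFinal (T : Label k → Set₁) (run : ElimRun T) (final : Final T) where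

    module Coded (W : List (Code k)) (W≐ : W ≐ (λ e → Reachable e × T (stateLabel e)) on codes) where
      open RealApprox W

      cover : ∀ {Δ} → T Δ → ¬ ¬ Σ (Code k) λ e → e ∈ˡ W × Δ ≈ stateLabel e
      cover t = do
        e , e∈ , re , eq ← reachable-complete (run⊆StR run t)
        return (e , proj₂ (W≐ e) e∈ (re , run-≈ run t eq) , eq)

      inT : ∀ {e} → e ∈ˡ W → T (stateLabel e)
      inT i = proj₂ (proj₂ (proj₁ (W≐ _) i))

      isReachable : ∀ {e} → e ∈ˡ W → Reachable e
      isReachable i = proj₁ (proj₂ (proj₁ (W≐ _) i))

      hint : ∀ {e} → e ∈ˡ W → Hintikka (stateLabel e)
      hint i = StR-hintikka (reachable-sound (isReachable i))

      edge-succ : ∀ {Δ σ Δ′ e v e′} → Edge Δ σ Δ′ → Δ′ ≈ stateLabel e′ →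
                  (∀ φ → Forced₀ (listing e) (vlookup v) φ → Forced₀ (ord Δ) σ φ) → Succ e v e′
      edge-succ {Δ} {σ} {Δ′} {e} {v} ed (s , _) f = All.tabulate λ i →
        proj₁ (s _) (edge-⊆ {Δ} {σ} {Δ′} ed (f _ (forced₀⁻ (listing e) (vlookup v) _ i)))

      serial : ∀ {e} → e ∈ˡ W → ∀ (v : Moves e) → Any (Succ e v) W
      serial {e} i v = stable (any? (Succ? e v) W) do
        -- That ER1 does not apply is literally the double negation of a successor for this move.
        Δ′ , t′ , ed ← λ ¬s → final _ (inT i) (inj₁ (vlookup v , ¬s))
        e′ , i′ , eq ← cover t′
        return (lose i′ (edge-succ {e = e} {v} {e′} ed eq (λ _ x → x)))

      -- `Realized` continues with an arbitrary formula, recognised as modal only through the link.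
      -- Its induction needs a conclusion that makes sense for every formula.
      R : Code k → SF k → Set
      R e (⟪ A ⟫ Φ) = It stage (e , dia A , Φ)
      R e (⟦ A ⟧ Φ) = It stage (e , box A , Φ)
      R e _ = ⊤

      close : ∀ {e} → e ∈ˡ W → ∀ μ {Φ} → mk μ Φ ∈ˡ stateSet e → It (suc stage) (e , μ , Φ) → It stage (e , μ , Φ)
      close {e} i μ {Φ} x = stage-closed _ (∈-cartesianProduct⁺ (proj₁ (proj₁ (W≐ e) i))
        (∈-goals μ Φ (StR⊆cl (reachable-sound (isReachable i)) x)))

      -- Where tracking leaves the link there is nothing to show; where it follows the link, the
      -- remainder can be compared with the one in `Realized`.
      later : ∀ {e} → e ∈ˡ W → ∀ μ {Φ} → mk μ Φ ∈ˡ stateSet e → NotNext Φ →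
        (∀ ψ Ψ → NotNext Ψ → tableLink (proj₂ e) (mk μ Φ) ≡ (ψ ∧ₛ nxt μ Ψ) → ∀ (v : Moves e) →
          Follows (listing e) (norm μ) (mk μ Ψ) (vlookup v) →
          ¬ ¬ Any (λ e′ → Succ e v e′ × It stage (e′ , μ , Ψ)) W) →
        It stage (e , μ , Φ)
      later {e} i μ {Φ} x nn f = close i μ x (inj₂ (go (track-spec e μ Φ (hint i) x nn)))
        where
        go : ∀ {t} → TrackSpec e μ Φ t → Later (It stage) e μ t
        go (isDone _ _ _) = tt
        go (isJump _ _ _ _ _) = tt
        go (isFollow {ψ} {Ψ} _ _ j eq _ _) v fo =
          stable (any? (λ e′ → Succ? e v e′ ×-dec It? stage (e′ , μ , Ψ)) W)
                 (f ψ Ψ (dec-notNext Φ j) eq v fo)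

      realised : ∀ {ξ Δ} → Realized T ξ Δ → T Δ → ∀ {e} → e ∈ˡ W → Δ ≈ stateLabel e →
                 set Δ ξ → IsGamma ξ → R e ξ
      realised (nowD {A} {Φ} r) t i (s , _) x g =
        close i (dia A) (proj₁ (s _) x) (inj₁ (Real-map Φ (λ φ → proj₁ (s φ)) r))
      realised (nowB {A} {Φ} r) t i (s , _) x g =
        close i (box A) (proj₁ (s _) x) (inj₁ (Real-map Φ (λ φ → proj₁ (s φ)) r))
      realised (laterD {A} {Φ} {Δ} {ψ₀} {ξ′} leq p peq f) t {e} i ≈e@(s , l) x (gD nn) =
        later i (dia A) (proj₁ (s _) x) nn onward
        where
        Δ-StR = run⊆StR run t
        onward : ∀ ψ Ψ → NotNext Ψ → tableLink (proj₂ e) (⟪ A ⟫ Φ) ≡ (ψ ∧ₛ nxt (dia A) Ψ) → ∀ (v : Moves e) →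
                 Follows (listing e) (norm (dia A)) (⟪ A ⟫ Ψ) (vlookup v) →
                 ¬ ¬ Any (λ e′ → Succ e v e′ × It stage (e′ , dia A , Ψ)) W
        onward ψ Ψ nnΨ eq v fo = step (f σ played)
          where
          ξ′≡ : ξ′ ≡ ⟪ A ⟫ Ψ
          ξ′≡ = ∧-next-injective (dia A) (trans (sym leq) (trans (l _ (gD nn) x) eq))
          moved = transportMove (ord-≈ Δ-StR ≈e) (vlookup v)
          σ = proj₁ moved
          followed : Follows (ord Δ) (dia A) ξ′ σ
          followed = subst (λ ξ → Follows (ord Δ) (dia A) ξ σ) (sym ξ′≡) (proj₂ (proj₂ moved) (dia A) (⟪ A ⟫ Ψ)
            fo)
          -- The positions named by `Follows` and by `Realized` hold the same entry; a listing has
          -- no repetitions, so they coincide.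
          played : Plays (ord Δ) A p σ
          played = subst (λ p → Plays (ord Δ) A p σ)
            (Unique-lookup (proj₁ (proj₂ (proj₂ (valid Δ-StR)))) _ p (trans (proj₁ (proj₂ followed)) (sym peq)))
            (proj₂ (proj₂ followed))
          step : (Σ (Label k) λ Δ′ → T Δ′ × Edge Δ σ Δ′ × Realized T ξ′ Δ′) →
                 ¬ ¬ Any (λ e′ → Succ e v e′ × It stage (e′ , dia A , Ψ)) W
          step (Δ′ , t′ , ed , r′) = do
            e′ , i′ , eq′ ← cover t′
            return (lose i′ (edge-succ {e = e} {v} {e′} ed eq′ (proj₁ (proj₂ moved)) ,
              subst (R e′) ξ′≡ (realised r′ t′ i′ eq′
                (edge-⊆ {Δ} {σ} {Δ′} ed (follows-forced (ord Δ) (dia A) _ σ followed))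
                (subst IsGamma (sym ξ′≡) (gD nnΨ)))))
      realised (laterB {A} {Φ} {Δ} {ψ₀} {ξ′} leq q qeq f) t {e} i ≈e@(s , l) x (gB nn) =
        later i (box A) (proj₁ (s _) x) nn onward
        where
        Δ-StR = run⊆StR run t
        A≢ : A ≢ full
        A≢ = proj₁ (proj₂ (proj₁ (proj₂ (valid Δ-StR)) A ξ′) (subst (_∈ˡ boxes Δ) qeq (∈-lookup q)))
        onward : ∀ ψ Ψ → NotNext Ψ → tableLink (proj₂ e) (⟦ A ⟧ Φ) ≡ (ψ ∧ₛ nxt (box A) Ψ) → ∀ (v : Moves e) →
                 Follows (listing e) (norm (box A)) (⟦ A ⟧ Ψ) (vlookup v) →
                 ¬ ¬ Any (λ e′ → Succ e v e′ × It stage (e′ , box A , Ψ)) W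
        onward ψ Ψ nnΨ eq v fo = step (f σ (proj₁ played) (proj₂ played))
          where
          ξ′≡ : ξ′ ≡ ⟦ A ⟧ Ψ
          ξ′≡ = ∧-next-injective (box A) (trans (sym leq) (trans (l _ (gB nn) x) eq))
          moved = transportMove (ord-≈ Δ-StR ≈e) (vlookup v)
          σ = proj₁ moved
          followed : Follows (ord Δ) (box A) ξ′ σ
          followed = subst (λ ξ → Follows (ord Δ) (box A) ξ σ) (sym ξ′≡) (proj₂ (proj₂ moved) (box A) (⟦ A ⟧ Ψ)
            (subst (λ μ → Follows (listing e) μ (⟦ A ⟧ Ψ) (vlookup v)) (norm-proper A≢) fo))
          played : CoPlays (ord Δ) A q σ
          played = subst (λ q → CoPlays (ord Δ) A q σ)
            (Unique-lookup (proj₂ (proj₂ (proj₂ (valid Δ-StR)))) _ q (trans (proj₁ (proj₂ followed)) (sym qeq)))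
            (proj₂ (proj₂ followed))
          step : (Σ (Label k) λ Δ′ → T Δ′ × Edge Δ σ Δ′ × Realized T ξ′ Δ′) →
                 ¬ ¬ Any (λ e′ → Succ e v e′ × It stage (e′ , box A , Ψ)) W
          step (Δ′ , t′ , ed , r′) = do
            e′ , i′ , eq′ ← cover t′
            return (lose i′ (edge-succ {e = e} {v} {e′} ed eq′ (proj₁ (proj₂ moved)) ,
              subst (R e′) ξ′≡ (realised r′ t′ i′ eq′
                (edge-⊆ {Δ} {σ} {Δ′} ed (follows-forced (ord Δ) (box A) _ σ followed))
                (subst IsGamma (sym ξ′≡) (gB nnΨ)))))

      R-mk : ∀ {e} μ {Φ} → R e (mk μ Φ) → It stage (e , μ , Φ)
      R-mk (dia A) r = r
      R-mk (box A) r = r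

      eventualities : ∀ {e} → e ∈ˡ W → ∀ μ Φ → mk μ Φ ∈ˡ stateSet e → NotNext Φ → It stage (e , μ , Φ)
      eventualities {e} i μ Φ x nn = stable (It? stage (e , μ , Φ)) λ ¬it →
        final (stateLabel e) (inT i) (inj₂ (mk μ Φ , gammaM μ nn , x , λ r →
          ¬it (R-mk μ (realised r (inT i) i (≈-refl (stateLabel e)) x (gammaM μ nn)))))

      model : Any (λ e → η ∈ˡ stateSet e) W → Model W
      model x = Model-intro x isReachable serial eventualities

      initial : Open T → ¬ ¬ Any (λ e → η ∈ˡ stateSet e) W
      initial (Δ , t , x) = do
        e , i , eq ← cover t
        return (lose i (proj₁ (proj₁ eq η) x))

    -- The list W of all reachable codes whose states lie in T exists only under double negation,
    -- but it is one of the candidates, so the search cannot fail. The list found need not be W.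
    model-exists : Open T → Σ (List (Code k)) Model
    model-exists open-T = Any.satisfied (stable (any? Model? (sublists codes)) (
      comprehension (λ e → Reachable e × T (stateLabel e)) codes >>= λ (W , W∈ , W≐) →
      Coded.initial W W≐ open-T >>= λ x →
      return (lose W∈ (Coded.model W W≐ x))))

-- The game built from a finite set of codes

entry-size : ∀ (o : RawListing k) μ {φ} → Entry o μ φ → NonZero (size o)
entry-size (_ ∷ _ , _) (dia A) _ = _
entry-size (ds , _ ∷ bs) (box A) _ = subst NonZero (sym (ℕₚ.+-suc (length ds) (length bs))) _

just-injective : ∀ {Φ Ψ : PF k} → just Φ ≡ just Ψ → Φ ≡ Ψ
just-injective refl = refl

module Game {k : ℕ} (η : SF k) (ord : Label k → RawListing k) (good : Tableau.GoodOrd η ord)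
            (W : List (Code k)) (M : Realisation.Model η ord good W) where
  open Tableau η ord using (StR)
  open TableauFacts η ord good
  open Codes η ord good
  open Realisation η ord good
  open RealApprox W

  -- The fuel bounds the distance at which the current goal gets realised; the goals of the queue
  -- are served next.
  record State : Set where
    constructor state
    field
      code  : Code k
      mem   : code ∈ˡ W
      fuel  : ℕ
      goal  : Goal k
      queue : List (Goal k)
  open State public

  atoms : State → SF k → Set
  atoms s φ = φ ∈ˡ stateSet (code s)

  abstract
    StR-state : ∀ s → StR (stateLabel (code s))
    StR-state s = reachable-sound (Model-reachable M (mem s))

    hintikka-state : ∀ s → Hintikka (stateLabel (code s))
    hintikka-state s = StR-hintikka (StR-state s)

    entry-state : ∀ s μ {φ} → atoms s (nx μ φ) → Entry (listing (code s)) (norm μ) φ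
    entry-state s μ x = entry⁺ (stateLabel (code s)) (valid (StR-state s)) μ x

  abstract
    size-nonZero : ∀ s → NonZero (size (listing (code s)))
    size-nonZero s = let μ , φ , x = Hintikka.nextH (hintikka-state s) in
      entry-size (listing (code s)) (norm μ) (entry-state s μ x)

  -- Every number is an available action; it is read modulo the number of moves.
  clamp : (s : State) → ℕ → Fin (size (listing (code s)))
  clamp s n = _mod_ n (size (listing (code s))) {{size-nonZero s}}

  move : (s : State) → (Fin k → ℕ) → Moves (code s)
  move s σ = vtabulate (λ a → clamp s (σ a))

  Schedule : Set
  Schedule = ℕ × Goal k × List (Goal k)

  schedule : State → Schedule
  schedule s = fuel s , goal s , queue s

  -- A dummy goal without fuel separates two rounds.
  nextGoal : List (Goal k) → Schedule
  nextGoal [] = 0 , (dia empty , ⊤ₚ) , goals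
  nextGoal (g ∷ q) = stage , g , q

  restart : (e : Code k) → e ∈ˡ W → Moves e → List (Goal k) → State
  restart e i v q = let e′ , i′ , _ = find (Model-serial M i v)
                        n , g , q′ = nextGoal q
                    in state e′ i′ n g q′

  Onward : (e : Code k) → Moves e → ℕ → Mod k → PF k → Set
  Onward e v n μ Ψ = Any (λ e′ → Succ e v e′ × It n (e′ , μ , Ψ)) W

  onward? : ∀ e v n μ Ψ → Dec (Onward e v n μ Ψ)
  onward? e v n μ Ψ = any? (λ e′ → Succ? e v e′ ×-dec It? n (e′ , μ , Ψ)) W

  -- The negative case covers moves against the goal: realisation promises a suitable successor only
  -- for moves that follow the listed formula.
  continue : ∀ (e : Code k) → e ∈ˡ W → (v : Moves e) → ∀ n μ Ψ → List (Goal k) → Dec (Onward e v n μ Ψ) → State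
  continue e i v n μ Ψ q (yes x) = let e′ , i′ , _ = find x in state e′ i′ n (μ , Ψ) q
  continue e i v n μ Ψ q (no _) = restart e i v q

  advance : ∀ (e : Code k) → e ∈ˡ W → Moves e → ℕ → Mod k → List (Goal k) → Track k → State
  advance e i v (suc n) μ q (follow Ψ) = continue e i v n μ Ψ q (onward? e v n μ Ψ)
  advance e i v (suc n) μ q done = restart e i v q
  advance e i v (suc n) μ q (jump _) = restart e i v q
  advance e i v zero μ q t = restart e i v q

  restart-succ : ∀ e i v q → Succ e v (code (restart e i v q))
  restart-succ e i v q = proj₂ (proj₂ (find (Model-serial M i v)))

  continue-succ : ∀ e i v n μ Ψ q d → Succ e v (code (continue e i v n μ Ψ q d))
  continue-succ e i v n μ Ψ q (yes x) = proj₁ (proj₂ (proj₂ (find x)))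
  continue-succ e i v n μ Ψ q (no _) = restart-succ e i v q

  advance-succ : ∀ e i v n μ q t → Succ e v (code (advance e i v n μ q t))
  advance-succ e i v (suc n) μ q (follow Ψ) = continue-succ e i v n μ Ψ q (onward? e v n μ Ψ)
  advance-succ e i v (suc n) μ q done = restart-succ e i v q
  advance-succ e i v (suc n) μ q (jump _) = restart-succ e i v q
  advance-succ e i v zero μ q t = restart-succ e i v q

  -- This is all that fairness rests on: no pursuit outlasts its fuel, whether it succeeds or not.
  Scheduled : ℕ → List (Goal k) → State → Set
  Scheduled n q s = (Σ ℕ λ m → n ≡ suc m × fuel s ≡ m × queue s ≡ q) ⊎ schedule s ≡ nextGoal q

  continue-scheduled : ∀ e i v n μ Ψ q d → Scheduled (suc n) q (continue e i v n μ Ψ q d)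
  continue-scheduled e i v n μ Ψ q (yes x) = inj₁ (n , refl , refl , refl)
  continue-scheduled e i v n μ Ψ q (no _) = inj₂ refl

  advance-scheduled : ∀ e i v n μ q t → Scheduled n q (advance e i v n μ q t)
  advance-scheduled e i v (suc n) μ q (follow Ψ) = continue-scheduled e i v n μ Ψ q (onward? e v n μ Ψ)
  advance-scheduled e i v (suc n) μ q done = inj₂ refl
  advance-scheduled e i v (suc n) μ q (jump _) = inj₂ refl
  advance-scheduled e i v zero μ q t = inj₂ refl

  Pursues : ℕ → Mod k → PF k → State → Set
  Pursues n μ Φ s = fuel s ≡ n × goal s ≡ (μ , Φ) × It n (code s , μ , Φ)

  continue-pursues : ∀ e i v n μ Ψ q d → Onward e v n μ Ψ → Pursues n μ Ψ (continue e i v n μ Ψ q d)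
  continue-pursues e i v n μ Ψ q (yes x) _ = refl , refl , proj₂ (proj₂ (proj₂ (find x)))
  continue-pursues e i v n μ Ψ q (no ¬x) x = ⊥-elim (¬x x)

  abstract
    outcome : State → (Fin k → ℕ) → State
    outcome s@(state e i n (μ , Φ) q) σ = advance e i (move s σ) n μ q (track e μ Φ)

    outcome-succ : ∀ s σ → Succ (code s) (move s σ) (code (outcome s σ))
    outcome-succ s@(state e i n (μ , Φ) q) σ = advance-succ e i (move s σ) n μ q (track e μ Φ)

    outcome-scheduled : ∀ s σ → Scheduled (fuel s) (queue s) (outcome s σ)
    outcome-scheduled s@(state e i n (μ , Φ) q) σ = advance-scheduled e i (move s σ) n μ q (track e μ Φ)

    outcome-pursues : ∀ s σ {n μ Φ Ψ} → fuel s ≡ suc n → goal s ≡ (μ , Φ) → track (code s) μ Φ ≡ follow Ψ →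
                      Onward (code s) (move s σ) n μ Ψ → Pursues n μ Ψ (outcome s σ)
    outcome-pursues s@(state e i _ _ q) σ {n} {μ} {Φ} {Ψ} refl refl eq x =
      subst (λ t → Pursues n μ Ψ (advance e i (move s σ) (suc n) μ q t)) (sym eq)
            (continue-pursues e i (move s σ) n μ Ψ q (onward? e (move s σ) n μ Ψ) x)

  arena : CGM k
  arena = record
    { St = State ; Act = λ _ → ℕ ; act = λ _ _ _ → ⊤ ; act-ne = λ _ _ → 0 , tt
    ; out = outcome ; L = λ s p → atoms s (lit (pos p)) }

  open Sem arena using (_⊨_; _⊨ₚ_)

  -- `⊤ₛ` is excluded middle for an atom, available because codes have decidable membership.
  ⊨⊤ : ∀ s → s ⊨ ⊤ₛ
  ⊨⊤ s with lit (pos 0) ∈S? stateSet (code s)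
  ... | yes x = inj₁ x
  ... | no ¬x = inj₂ ¬x

  Truth : SF k → Set
  Truth φ = ∀ s → ConjIn (atoms s) φ → s ⊨ φ

  -- The induction hypothesis of the truth lemma at Φ, taken as a hypothesis so that the argument
  -- about plays can come before that induction.
  Truths : PF k → Set
  Truths (st φ) = Truth φ
  Truths (○ φ) = Truth φ
  Truths (□ φ) = Truth φ
  Truths (φ U ψ) = Truth φ × Truth ψ
  Truths (Φ ∨ₚ Ψ) = Truths Φ × Truths Ψ
  Truths (Φ ∧ₚ Ψ) = Truths Φ × Truths Ψ

  Truth-∧ : ∀ {φ ψ} → Truth φ → Truth ψ → Truth (φ ∧ₛ ψ)
  Truth-∧ {φ} {ψ} t u s (inj₁ x) = let y , z = Hintikka.andH (hintikka-state s) φ ψ x in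
    t s (conjIn⁺ {S = atoms s} φ y) , u s (conjIn⁺ {S = atoms s} ψ z)
  Truth-∧ t u s (inj₂ (x , y)) = t s x , u s y

  dec-truth : ∀ Φ {ψ Ψ} → Truths Φ → (ψ , Ψ) ∈ˡ dec Φ → Truth ψ × Truths Ψ
  dec-truth (st φ) t (here refl) = t , λ s _ → ⊨⊤ s
  dec-truth (○ φ) t (here refl) = (λ s _ → ⊨⊤ s) , t
  dec-truth (□ φ) t (here refl) = t , t
  dec-truth (φ U ψ) t (here refl) = proj₁ t , t
  dec-truth (φ U ψ) t (there (here refl)) = proj₂ t , λ s _ → ⊨⊤ s
  dec-truth (Φ ∨ₚ Ψ) (t , u) i with dec-∨⁻ Φ Ψ i
  ... | left j = dec-truth Φ t j
  ... | right j = dec-truth Ψ u j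
  ... | mixed {x₁} {x₂} j l = let a , b = dec-truth Φ t j
                                  c , d = dec-truth Ψ u l in Truth-∧ {proj₁ x₁} {proj₁ x₂} a c , (b , d)
  dec-truth (Φ ∧ₚ Ψ) (t , u) i with dec-∧⁻ Φ Ψ i
  ... | x₁ , x₂ , j , l , refl = let a , b = dec-truth Φ t j
                                     c , d = dec-truth Ψ u l in Truth-∧ {proj₁ x₁} {proj₁ x₂} a c , (b , d)

  -- Both sides of a disjunction are required, as long as it is not resolved.
  Boxes : State → PF k → Set
  Boxes s (□ φ) = s ⊨ φ
  Boxes s (Φ ∨ₚ Ψ) = Boxes s Φ × Boxes s Ψ
  Boxes s (Φ ∧ₚ Ψ) = Boxes s Φ × Boxes s Ψ
  Boxes s _ = ⊤

  -- A disjunction can return itself only through a mixed component, since one-sided remainders have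
  -- smaller rank. Hence both sides were decomposed into themselves, and the bodies of all □-parts
  -- are among the conjuncts of ψ.
  boxes-stay : ∀ s Φ {ψ Ψ} → (ψ , Ψ) ∈ˡ dec Φ → Ψ ≡ Φ → s ⊨ ψ → Boxes s Φ
  boxes-stay s (st _) i eq x = tt
  boxes-stay s (○ _) i eq x = tt
  boxes-stay s (□ _) (here refl) eq x = x
  boxes-stay s (_ U _) i eq x = tt
  boxes-stay s (Φ₁ ∨ₚ Φ₂) i eq x with dec-∨⁻ Φ₁ Φ₂ i
  boxes-stay s (Φ₁ ∨ₚ Φ₂) i refl x | left j =
    ⊥-elim (ℕₚ.<-irrefl refl (ℕₚ.≤-trans (s≤s (ℕₚ.m≤m+n _ _)) (dec-rank-≤ Φ₁ j)))
  boxes-stay s (Φ₁ ∨ₚ Φ₂) i refl x | right j =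
    ⊥-elim (ℕₚ.<-irrefl refl (ℕₚ.≤-trans (s≤s (ℕₚ.m≤n+m _ _)) (dec-rank-≤ Φ₂ j)))
  boxes-stay s (Φ₁ ∨ₚ Φ₂) i refl (x , y) | mixed j l = boxes-stay s Φ₁ j refl x , boxes-stay s Φ₂ l refl y
  boxes-stay s (Φ₁ ∧ₚ Φ₂) i eq x with dec-∧⁻ Φ₁ Φ₂ i
  boxes-stay s (Φ₁ ∧ₚ Φ₂) i refl (x , y) | _ , _ , j , l , refl = boxes-stay s Φ₁ j refl x , boxes-stay s Φ₂ l refl y

  -- Without `∨ₚ` no component can avoid a □-part, so nothing has to be known about how Φ evolves.
  boxes-now : ∀ s Φ {ψ Ψ} → ∨-free Φ → (ψ , Ψ) ∈ˡ dec Φ → s ⊨ ψ → Boxes s Φ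
  boxes-now s (st _) f i x = tt
  boxes-now s (○ _) f i x = tt
  boxes-now s (□ _) f (here refl) x = x
  boxes-now s (_ U _) f i x = tt
  boxes-now s (Φ₁ ∧ₚ Φ₂) (f , g) i x with dec-∧⁻ Φ₁ Φ₂ i
  boxes-now s (Φ₁ ∧ₚ Φ₂) (f , g) i (x , y) | _ , _ , j , l , refl = boxes-now s Φ₁ f j x , boxes-now s Φ₂ g l y

  boxes-keep : ∀ s Φ {ψ Ψ} → ∨-free Φ → (ψ , Ψ) ∈ˡ dec Φ → Boxes s Ψ → Boxes s Φ
  boxes-keep s (st _) f i x = tt
  boxes-keep s (○ _) f i x = tt
  boxes-keep s (□ _) f (here refl) x = x
  boxes-keep s (_ U _) f i x = tt
  boxes-keep s (Φ₁ ∧ₚ Φ₂) (f , g) i x with dec-∧⁻ Φ₁ Φ₂ i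
  boxes-keep s (Φ₁ ∧ₚ Φ₂) (f , g) i (x , y) | _ , _ , j , l , refl = boxes-keep s Φ₁ f j x , boxes-keep s Φ₂ g l y

  after : Track k → Maybe (PF k)
  after done = nothing
  after (jump Ψ) = just Ψ
  after (follow Ψ) = just Ψ

  obligation : State → Mod k → Maybe (PF k) → Maybe (PF k)
  obligation s μ nothing = nothing
  obligation s μ (just Φ) with nextView Φ
  ... | isNext _ = nothing
  ... | notNext _ = after (track (code s) μ Φ)

  -- Differs from `obligation` at `○ φ`: the next state must contain φ, but no path formula remains
  -- to be tracked.
  target : State → Mod k → Maybe (PF k) → Maybe (SF k)
  target s μ nothing = nothing
  target s μ (just Φ) with nextView Φ
  ... | isNext φ = just φ
  ... | notNext _ = Maybe.map (mk μ) (after (track (code s) μ Φ))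

  obligation-notNext : ∀ s μ {Φ} → NotNext Φ → obligation s μ (just Φ) ≡ after (track (code s) μ Φ)
  obligation-notNext s μ {Φ} nn with nextView Φ
  ... | isNext _ = ⊥-elim nn
  ... | notNext _ = refl

  target-notNext : ∀ s μ {Φ} → NotNext Φ → target s μ (just Φ) ≡ Maybe.map (mk μ) (after (track (code s) μ Φ))
  target-notNext s μ {Φ} nn with nextView Φ
  ... | isNext _ = ⊥-elim nn
  ... | notNext _ = refl

  obligations : (ℕ → State) → Mod k → PF k → ℕ → Maybe (PF k)
  obligations π μ Φ zero = just Φ
  obligations π μ Φ (suc i) = obligation (π i) μ (obligations π μ Φ i)

  -- Truth of a tracked path formula along a play

  module OnPlay (π : ℕ → State) where
    Holds : ℕ → PF k → Set
    Holds i (st φ) = π i ⊨ φ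
    Holds i (○ φ) = π (suc i) ⊨ φ
    Holds i (□ φ) = ∀ j → i ≤ j → π j ⊨ φ
    Holds i (φ U ψ) = Σ ℕ λ j → i ≤ j × π j ⊨ ψ × (∀ j′ → i ≤ j′ → j′ < j → π j′ ⊨ φ)
    Holds i (Φ ∨ₚ Ψ) = Holds i Φ ⊎ Holds i Ψ
    Holds i (Φ ∧ₚ Ψ) = Holds i Φ × Holds i Ψ

    holds-play : ∀ Φ → Holds 0 Φ → π ⊨ₚ Φ
    holds-play (st φ) h = h
    holds-play (○ φ) h = h
    holds-play (□ φ) h i = h i z≤n
    holds-play (φ U ψ) (j , _ , x , f) = j , x , λ j′ → f j′ z≤n
    holds-play (Φ ∨ₚ Ψ) (inj₁ h) = inj₁ (holds-play Φ h)
    holds-play (Φ ∨ₚ Ψ) (inj₂ h) = inj₂ (holds-play Ψ h)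
    holds-play (Φ ∧ₚ Ψ) (h , h′) = holds-play Φ h , holds-play Ψ h′

    -- The expansion laws of LTL, read from the unfolded side to the folded one.
    dec-sound : ∀ i Φ {ψ Ψ} → (ψ , Ψ) ∈ˡ dec Φ → π i ⊨ ψ → Holds (suc i) Ψ → Holds i Φ
    dec-sound i (st φ) (here refl) x h = x
    dec-sound i (○ φ) (here refl) x h = h
    dec-sound i (□ φ) (here refl) x h j le with ℕₚ.m≤n⇒m<n∨m≡n le
    ... | inj₁ lt = h j lt
    ... | inj₂ refl = x
    dec-sound i (φ U ψ) (here refl) x (j , le , y , f) = j , ℕₚ.<⇒≤ le , y , before
      where
      before : ∀ j′ → i ≤ j′ → j′ < j → π j′ ⊨ φ
      before j′ le′ lt with ℕₚ.m≤n⇒m<n∨m≡n le′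
      ... | inj₁ lt′ = f j′ lt′ lt
      ... | inj₂ refl = x
    dec-sound i (φ U ψ) (there (here refl)) x h =
      i , ℕₚ.≤-refl , x , λ j le lt → ⊥-elim (ℕₚ.<-irrefl refl (ℕₚ.<-≤-trans lt le))
    dec-sound i (Φ ∨ₚ Ψ) m x h with dec-∨⁻ Φ Ψ m
    ... | left j = inj₁ (dec-sound i Φ j x h)
    ... | right j = inj₂ (dec-sound i Ψ j x h)
    dec-sound i (Φ ∨ₚ Ψ) m (x , y) (inj₁ h) | mixed j l = inj₁ (dec-sound i Φ j x h)
    dec-sound i (Φ ∨ₚ Ψ) m (x , y) (inj₂ h) | mixed j l = inj₂ (dec-sound i Ψ l y h)
    dec-sound i (Φ ∧ₚ Ψ) m x h with dec-∧⁻ Φ Ψ m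
    dec-sound i (Φ ∧ₚ Ψ) m (x , y) (h , h′) | _ , _ , j , l , refl = dec-sound i Φ j x h , dec-sound i Ψ l y h′

    -- `Real` fulfils state and until parts on the spot, but of a □-part it shows only the present;
    -- the future is the last hypothesis.
    real-holds : ∀ i Φ → Truths Φ → Real Φ (atoms (π i)) → (∀ j → i ≤ j → Boxes (π j) Φ) → Holds i Φ
    real-holds i (st φ) t r b = t (π i) (conjIn⁺ {S = atoms (π i)} φ r)
    real-holds i (□ φ) t r b = b
    real-holds i (φ U ψ) t r b =
      i , ℕₚ.≤-refl , proj₂ t (π i) (conjIn⁺ {S = atoms (π i)} ψ r) ,
      λ j le lt → ⊥-elim (ℕₚ.<-irrefl refl (ℕₚ.<-≤-trans lt le))
    real-holds i (Φ ∨ₚ Ψ) t (inj₁ r) b = inj₁ (real-holds i Φ (proj₁ t) r (λ j le → proj₁ (b j le)))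
    real-holds i (Φ ∨ₚ Ψ) t (inj₂ r) b = inj₂ (real-holds i Ψ (proj₂ t) r (λ j le → proj₂ (b j le)))
    real-holds i (Φ ∧ₚ Ψ) t (r , r′) b = real-holds i Φ (proj₁ t) r (λ j le → proj₁ (b j le)) ,
                                         real-holds i Ψ (proj₂ t) r′ (λ j le → proj₂ (b j le))

    module _ (σ : ℕ → Fin k → ℕ) (steps : ∀ i → outcome (π i) (σ i) ≡ π (suc i)) where

      scheduled : ∀ i → Scheduled (fuel (π i)) (queue (π i)) (π (suc i))
      scheduled i = subst (Scheduled (fuel (π i)) (queue (π i))) (steps i) (outcome-scheduled (π i) (σ i))

      next-goal : ∀ n i → fuel (π i) ≡ n → Σ ℕ λ j → i ≤ j × schedule (π j) ≡ nextGoal (queue (π i))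
      next-goal n i eq with scheduled i
      ... | inj₂ x = suc i , ℕₚ.n≤1+n i , x
      next-goal zero i eq | inj₁ (m , eq₁ , _) with trans (sym eq) eq₁
      ... | ()
      next-goal (suc n) i eq | inj₁ (m , eq₁ , eq₂ , eq₃) with trans (sym eq) eq₁
      ... | refl = let j , le , x = next-goal n (suc i) eq₂ in
        j , ℕₚ.<⇒≤ le , trans x (cong nextGoal eq₃)

      reset : ∀ q i → queue (π i) ≡ q → Σ ℕ λ j → i ≤ j × queue (π j) ≡ goals
      reset q i eq with next-goal _ i refl
      reset [] i eq | j , le , x = j , le , cong (λ p → proj₂ (proj₂ p)) (trans x (cong nextGoal eq))
      reset (g ∷ q) i eq | j , le , x =
        let j′ , le′ , y = reset q j (cong (λ p → proj₂ (proj₂ p)) (trans x (cong nextGoal eq)))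
        in j′ , ℕₚ.≤-trans le le′ , y

      scheduled-from : ∀ q i {g} → queue (π i) ≡ q → g ∈ˡ q →
                       Σ ℕ λ j → i ≤ j × fuel (π j) ≡ stage × goal (π j) ≡ g
      scheduled-from (g ∷ q) i eq m with next-goal _ i refl
      scheduled-from (g ∷ q) i eq (here refl) | j , le , x =
        let y = trans x (cong nextGoal eq) in j , le , cong proj₁ y , cong (λ p → proj₁ (proj₂ p)) y
      scheduled-from (g ∷ q) i eq (there m) | j , le , x =
        let j′ , le′ , y = scheduled-from q j (cong (λ p → proj₂ (proj₂ p)) (trans x (cong nextGoal eq))) m
        in j′ , ℕₚ.≤-trans le le′ , y

      -- The goal may already have been passed in the current round; after the next refill of the
      -- queue it is still to come.
      fair : ∀ i {g} → g ∈ˡ goals → Σ ℕ λ j → i ≤ j × fuel (π j) ≡ stage × goal (π j) ≡ g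
      fair i m = let j , le , eq = reset _ i refl
                     j′ , le′ , x = scheduled-from goals j eq m in j′ , ℕₚ.≤-trans le le′ , x

      forced-next : ∀ i μ {φ} → Follows (listing (code (π i))) (norm μ) φ (vlookup (move (π i) (σ i))) →
                    atoms (π (suc i)) φ
      forced-next i μ {φ} fo = subst (λ s → atoms s φ) (steps i)
        (All.lookup (outcome-succ (π i) (σ i))
          (forced₀⁺ o v φ (follows-forced o (norm μ) φ v fo)))
        where
        o = listing (code (π i))
        v = vlookup (move (π i) (σ i))

      -- `follows` is the only fact about the strategy that enters, so both quantifiers share one
      -- argument.
      module Tracked (μ : Mod k) (Φ₀ : PF k) (nn₀ : NotNext Φ₀) (x₀ : atoms (π 0) (mk μ Φ₀)) (t₀ : Truths Φ₀)
        (follows : ∀ i φ → target (π i) μ (obligations π μ Φ₀ i) ≡ just φ → atoms (π i) (nx μ φ) →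
          Follows (listing (code (π i))) (norm μ) φ (vlookup (move (π i) (σ i)))) where

        τ : ℕ → Maybe (PF k)
        τ = obligations π μ Φ₀

        Invariant : ℕ → PF k → Set
        Invariant i Φ = NotNext Φ × atoms (π i) (mk μ Φ) × Truths Φ

        NoJump : ℕ → PF k → Set
        NoJump i Φ = ¬ Any (JumpOption (code (π i)) μ Φ) (dec Φ)

        NoTop : ℕ → PF k → Set
        NoTop i Φ = ¬ Any (TopOption (code (π i)) μ Φ) (dec Φ)

        data Step (i : ℕ) (Φ : PF k) : Set where
          stop : ∀ {ψ Ψ} → (ψ , Ψ) ∈ˡ dec Φ → T (isTopP Ψ) → π i ⊨ ψ → τ (suc i) ≡ nothing → Step i Φ
          leap : ∀ {ψ Ψ} → ¬ ∨-free Φ → (ψ , Ψ) ∈ˡ dec Φ → ∨-free Ψ → π i ⊨ ψ → τ (suc i) ≡ just Ψ →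
                 Invariant (suc i) Ψ → Step i Φ
          keep : ∀ {ψ Ψ} → ∨-free Φ ⊎ NoJump i Φ → NoTop i Φ → (ψ , Ψ) ∈ˡ dec Φ → π i ⊨ ψ →
                 track (code (π i)) μ Φ ≡ follow Ψ → τ (suc i) ≡ just Ψ → Invariant (suc i) Ψ → Step i Φ

        abstract
          -- Takes the invariant as a premise because the invariant at `suc i` is itself obtained
          -- from the step at i.
          step₀ : ∀ i {Φ} → τ i ≡ just Φ → Invariant i Φ → Step i Φ
          step₀ i {Φ} eq (nn , x , t) =
            go refl (track-spec (code (π i)) μ Φ (hintikka-state (π i)) x nn)
            where
            τ-next : ∀ {u} → track (code (π i)) μ Φ ≡ u → τ (suc i) ≡ after u
            τ-next teq = trans (cong (obligation (π i) μ) eq)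
                               (trans (obligation-notNext (π i) μ nn) (cong after teq))
            invariant : ∀ {u ψ Ψ} → track (code (π i)) μ Φ ≡ u → after u ≡ just Ψ → (ψ , Ψ) ∈ˡ dec Φ →
                        atoms (π i) (nx μ (mk μ Ψ)) → Invariant (suc i) Ψ
            invariant {Ψ = Ψ} teq ueq j y = dec-notNext Φ j ,
              forced-next i μ (follows i (mk μ Ψ) (trans (cong (target (π i) μ) eq)
                (trans (target-notNext (π i) μ nn) (cong (Maybe.map (mk μ)) (trans (cong after teq) ueq)))) y) ,
              proj₂ (dec-truth Φ t j)
            go : ∀ {u} → track (code (π i)) μ Φ ≡ u → TrackSpec (code (π i)) μ Φ u → Step i Φ
            go teq (isDone j top? c) = stop j top? (proj₁ (dec-truth Φ t j) (π i) c) (τ-next teq)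
            go teq (isJump ¬f j f c y) =
              leap ¬f j f (proj₁ (dec-truth Φ t j) (π i) c) (τ-next teq) (invariant teq refl j y)
            go teq (isFollow f ¬t j _ c y) =
              keep f ¬t j (proj₁ (dec-truth Φ t j) (π i) c) teq (τ-next teq) (invariant teq refl j y)

          invariant : ∀ i {Φ} → τ i ≡ just Φ → Invariant i Φ
          invariant zero refl = nn₀ , x₀ , t₀
          invariant (suc i) {Φ} eq = previous (τ i) refl
            where
            from : ∀ {Φ′} → Step i Φ′ → Invariant (suc i) Φ
            from (stop _ _ _ eq′) with trans (sym eq) eq′
            ... | ()
            from (leap _ _ _ _ eq′ inv) = subst (Invariant (suc i)) (sym (just-injective (trans (sym eq) eq′))) inv
            from (keep _ _ _ _ _ eq′ inv) = subst (Invariant (suc i)) (sym (just-injective (trans (sym eq) eq′))) inv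
            previous : ∀ u → τ i ≡ u → Invariant (suc i) Φ
            previous nothing eq′ with trans (sym eq) (cong (obligation (π i) μ) eq′)
            ... | ()
            previous (just Φ′) eq′ = from (step₀ i eq′ (invariant i eq′))

          step : ∀ i {Φ} → τ i ≡ just Φ → Step i Φ
          step i eq = step₀ i eq (invariant i eq)

        stop-holds : ∀ i Φ {ψ Ψ} → (ψ , Ψ) ∈ˡ dec Φ → T (isTopP Ψ) → π i ⊨ ψ → Holds i Φ
        stop-holds i Φ {Ψ = Ψ} j top? x =
          dec-sound i Φ j x (subst (Holds (suc i)) (sym (isTopP-⊤ Ψ top?)) (⊨⊤ (π (suc i))))

        boxes-∨-free : ∀ d i {Φ} → τ i ≡ just Φ → ∨-free Φ → Boxes (π (d + i)) Φ
        boxes-∨-free zero i {Φ} eq f with step i eq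
        ... | stop j _ x _ = boxes-now (π i) Φ f j x
        ... | leap ¬f _ _ _ _ _ = ⊥-elim (¬f f)
        ... | keep _ _ j x _ _ _ = boxes-now (π i) Φ f j x
        boxes-∨-free (suc d) i {Φ} eq f with step i eq
        -- A remainder `⊤ₚ` has no □-part, so Φ had none either.
        ... | stop {Ψ = Ψ} j top? _ _ = boxes-keep (π (suc d + i)) Φ f j
                (subst (Boxes (π (suc d + i))) (sym (isTopP-⊤ Ψ top?)) tt)
        ... | leap ¬f _ _ _ _ _ = ⊥-elim (¬f f)
        ... | keep {Ψ = Ψ} _ _ j _ _ eq′ _ = boxes-keep (π (suc d + i)) Φ f j
                (subst (λ n → Boxes (π n) Ψ) (ℕₚ.+-suc d i) (boxes-∨-free d (suc i) eq′ (dec-∨-free Φ f j)))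

        holds-back : ∀ d i {Φ Ψ} → τ i ≡ just Φ → τ (d + i) ≡ just Ψ → Holds (d + i) Ψ → Holds i Φ
        holds-back zero i eq eq′ h = subst (Holds i) (just-injective (trans (sym eq′) eq)) h
        holds-back (suc d) i {Φ} {Ψ} eq eq′ h with step i eq
        ... | stop j top? x _ = stop-holds i Φ j top? x
        ... | leap _ j _ x eq″ _ = dec-sound i Φ j x (holds-back d (suc i) eq″
                (subst (λ n → τ n ≡ just Ψ) (sym (ℕₚ.+-suc d i)) eq′)
                (subst (λ n → Holds n Ψ) (sym (ℕₚ.+-suc d i)) h))
        ... | keep _ _ j x _ eq″ _ = dec-sound i Φ j x (holds-back d (suc i) eq″
                (subst (λ n → τ n ≡ just Ψ) (sym (ℕₚ.+-suc d i)) eq′)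
                (subst (λ n → Holds n Ψ) (sym (ℕₚ.+-suc d i)) h))

        module _ (Φ : PF k) (smaller : ∀ i {Ψ} → rank Ψ < rank Φ → τ i ≡ just Ψ → Holds i Ψ) where

          -- Locates the first step at which Φ is given up. There it is discharged or passes to
          -- smaller rank, and truth travels back through the steps at which it was unchanged.
          holds-change : ∀ d i → τ i ≡ just Φ → τ (d + i) ≢ just Φ → Holds i Φ
          holds-change zero i eq ne = ⊥-elim (ne eq)
          holds-change (suc d) i eq ne with step i eq
          ... | stop j top? x _ = stop-holds i Φ j top? x
          ... | leap ¬f j f x eq′ _ = dec-sound i Φ j x (smaller (suc i) (lt f (dec-rank Φ j)) eq′)
            where
            lt : ∀ {Ψ} → ∨-free Ψ → Ψ ≡ Φ ⊎ rank Ψ < rank Φ → rank Ψ < rank Φ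
            lt f (inj₁ eq) = ⊥-elim (¬f (subst ∨-free eq f))
            lt f (inj₂ l) = l
          ... | keep {Ψ = Ψ} _ _ j x _ eq′ _ = dec-sound i Φ j x (next-holds (dec-rank Φ j))
            where
            next-holds : Ψ ≡ Φ ⊎ rank Ψ < rank Φ → Holds (suc i) Ψ
            next-holds (inj₂ l) = smaller (suc i) l eq′
            next-holds (inj₁ Ψ≡Φ) = subst (Holds (suc i)) (sym Ψ≡Φ)
              (holds-change d (suc i) (trans eq′ (cong just Ψ≡Φ))
                (λ p → ne (subst (λ n → τ n ≡ just Φ) (ℕₚ.+-suc d i) p)))

          _≟M_ : (x y : Maybe (PF k)) → Dec (x ≡ y)
          _≟M_ = Maybeₚ.≡-dec _≟P_

          real-case : ∀ i → τ i ≡ just Φ → Real Φ (atoms (π i)) → Holds i Φ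
          real-case i eq r with step i eq
          ... | stop j top? x _ = stop-holds i Φ j top? x
          ... | leap ¬f j f x eq′ _ = holds-change 1 i eq λ p →
                  ¬f (subst ∨-free (just-injective (trans (sym eq′) p)) f)
          ... | keep (inj₁ f) _ _ _ _ _ _ = real-holds i Φ (proj₂ (proj₂ (invariant i eq))) r λ j le →
                  subst (λ n → Boxes (π n) Φ) (ℕₚ.m∸n+n≡m le) (boxes-∨-free (j ∸ i) i eq f)
          -- The proposition decided is whether the obligation ever changes. If it never does, every
          -- later step keeps Φ, so its □-parts hold at every state from i on.
          ... | keep (inj₂ ¬j) ¬t _ _ _ _ _ = byCases (Decide.decide (StR-state (π i)) μ
                  (proj₁ (proj₂ (invariant i eq))) (proj₁ (invariant i eq))
                  (λ m top? c → ¬t (lose m (top? , c))) (λ m f c y → ¬j (lose m (f , c , y)))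
                  (Σ ℕ λ d → τ (d + i) ≢ just Φ))
            where
            byCases : (Σ ℕ λ d → τ (d + i) ≢ just Φ) ⊎ ¬ (Σ ℕ λ d → τ (d + i) ≢ just Φ) → Holds i Φ
            byCases (inj₁ (d , ne)) = holds-change d i eq ne
            byCases (inj₂ never) = real-holds i Φ (proj₂ (proj₂ (invariant i eq))) r boxes
              where
              constant : ∀ j → i ≤ j → τ j ≡ just Φ
              constant j le = stable (τ j ≟M just Φ) λ ne →
                never (j ∸ i , subst (λ n → τ n ≢ just Φ) (sym (ℕₚ.m∸n+n≡m le)) ne)
              boxes : ∀ j → i ≤ j → Boxes (π j) Φ
              boxes j le with step j (constant j le) | constant (suc j) (ℕₚ.m≤n⇒m≤1+n le)
              ... | stop _ _ _ eq′ | p = ⊥-elim (absurd (trans (sym eq′) p))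
                where
                absurd : ∀ {Ψ : PF k} → nothing ≡ just Ψ → ⊥
                absurd ()
              ... | leap _ m _ x eq′ _ | p = boxes-stay (π j) Φ m (just-injective (trans (sym eq′) p)) x
              ... | keep _ _ m x _ eq′ _ | p = boxes-stay (π j) Φ m (just-injective (trans (sym eq′) p)) x

          Settled : ℕ → PF k → Set
          Settled i Ψ = Real Ψ (atoms (π i)) ⊎ (∀ Ψ′ → track (code (π i)) μ Ψ ≢ follow Ψ′)

          settled-case : ∀ i → τ i ≡ just Φ → Settled i Φ → Holds i Φ
          settled-case i eq (inj₁ r) = real-case i eq r
          settled-case i eq (inj₂ ¬fo) with step i eq
          ... | stop j top? x _ = stop-holds i Φ j top? x
          ... | leap ¬f j f x eq′ _ = holds-change 1 i eq λ p →
                  ¬f (subst ∨-free (just-injective (trans (sym eq′) p)) f)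
          ... | keep _ _ _ _ teq _ _ = ⊥-elim (¬fo _ teq)

          -- The scheduler and the strategy read the same `track`. Since the play follows the
          -- target, goal and obligation stay equal while the realisation distance decreases.
          pursue : ∀ n i {Ψ} → τ i ≡ just Ψ → Pursues n μ Ψ (π i) →
                   Σ ℕ λ d → Σ (PF k) λ Ψ′ → τ (d + i) ≡ just Ψ′ × Settled (d + i) Ψ′
          pursue (suc n) i {Ψ} eq (feq , geq , inj₁ r) = 0 , Ψ , eq , inj₁ r
          pursue (suc n) i {Ψ} eq (feq , geq , inj₂ l) = go (track (code (π i)) μ Ψ) refl
            where
            go : ∀ u → track (code (π i)) μ Ψ ≡ u →
                 Σ ℕ λ d → Σ (PF k) λ Ψ′ → τ (d + i) ≡ just Ψ′ × Settled (d + i) Ψ′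
            go done teq = 0 , Ψ , eq , inj₂ (λ Ψ′ p → absurd (trans (sym teq) p))
              where
              absurd : ∀ {Ψ′ : PF k} → done ≡ follow Ψ′ → ⊥
              absurd ()
            go (jump _) teq = 0 , Ψ , eq , inj₂ (λ Ψ′ p → absurd (trans (sym teq) p))
              where
              absurd : ∀ {Ψ₁ Ψ₂ : PF k} → jump Ψ₁ ≡ follow Ψ₂ → ⊥
              absurd ()
            go (follow Ψ₁) teq =
              let nn , _ , _ = invariant i eq
                  τeq = trans (cong (obligation (π i) μ) eq)
                              (trans (obligation-notNext (π i) μ nn) (cong after teq))
                  fo = follows i (mk μ Ψ₁) (trans (cong (target (π i) μ) eq)
                         (trans (target-notNext (π i) μ nn) (cong (λ u → Maybe.map (mk μ) (after u)) teq)))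
                         nx∈
                  on = subst (Later (It n) (code (π i)) μ) teq l (move (π i) (σ i)) fo
                  d , Ψ′ , p , q = pursue n (suc i) τeq
                    (subst (Pursues n μ Ψ₁) (steps i) (outcome-pursues (π i) (σ i) feq geq teq on))
              in suc d , Ψ′ , subst (λ m → τ m ≡ just Ψ′) (ℕₚ.+-suc d i) p ,
                 subst (λ m → Settled m Ψ′) (ℕₚ.+-suc d i) q
              where
              nx∈ : atoms (π i) (nx μ (mk μ Ψ₁))
              nx∈ = found (track-spec (code (π i)) μ Ψ (hintikka-state (π i))
                (proj₁ (proj₂ (invariant i eq))) (proj₁ (invariant i eq))) teq
                where
                found : ∀ {u} → TrackSpec (code (π i)) μ Ψ u → u ≡ follow Ψ₁ → atoms (π i) (nx μ (mk μ Ψ₁))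
                found (isFollow _ _ _ _ _ y) refl = y

          settle : ∀ i → τ i ≡ just Φ → Holds i Φ
          settle i eq with fair i (∈-goals μ Φ (StR⊆cl (StR-state (π i)) (proj₁ (proj₂ (invariant i eq)))))
          ... | j , le , feq , geq with τ j ≟M just Φ
          ...   | no ne = holds-change (j ∸ i) i eq (subst (λ n → τ n ≢ just Φ) (sym (ℕₚ.m∸n+n≡m le)) ne)
          -- A goal enters service with `stage` fuel, which is also the realisation bound guaranteed
          -- by `Model`.
          ...   | yes eqⱼ = onwards (pursue stage j eqⱼ (feq , geq ,
                    Model-realised M (mem (π j))
                      (∈-goals μ Φ (StR⊆cl (StR-state (π j)) (proj₁ (proj₂ (invariant j eqⱼ)))))
                      (proj₁ (proj₂ (invariant j eqⱼ))) (proj₁ (invariant j eqⱼ))))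
            where
            fromJ : Holds j Φ → Holds i Φ
            fromJ h = holds-back (j ∸ i) i eq (subst (λ n → τ n ≡ just Φ) (sym (ℕₚ.m∸n+n≡m le)) eqⱼ)
                        (subst (λ n → Holds n Φ) (sym (ℕₚ.m∸n+n≡m le)) h)
            onwards : (Σ ℕ λ d → Σ (PF k) λ Ψ′ → τ (d + j) ≡ just Ψ′ × Settled (d + j) Ψ′) → Holds i Φ
            onwards (d , Ψ′ , p , s) with τ (d + j) ≟M just Φ
            ... | no ne = fromJ (holds-change d j eqⱼ ne)
            ... | yes q = fromJ (holds-back d j eqⱼ q (settled-case (d + j) q
                    (subst (Settled (d + j)) (just-injective (trans (sym p) q)) s)))

        holds : ∀ i {Φ} → Acc _<_ (rank Φ) → τ i ≡ just Φ → Holds i Φ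
        holds i {Φ} (acc rs) eq = settle Φ (λ j lt eq′ → holds j (rs lt) eq′) i eq

      play-truth : ∀ μ Φ → atoms (π 0) (mk μ Φ) → Truths Φ →
        (∀ i φ → target (π i) μ (obligations π μ Φ i) ≡ just φ → atoms (π i) (nx μ φ) →
          Follows (listing (code (π i))) (norm μ) φ (vlookup (move (π i) (σ i)))) → π ⊨ₚ Φ
      play-truth μ Φ x t follows = byView (nextView Φ) refl
        where
        byView : ∀ {Ψ} → NextView Ψ → Ψ ≡ Φ → π ⊨ₚ Φ
        byView (notNext nn) refl =
          holds-play Φ (Tracked.holds μ Φ nn x t follows 0 (<-wellFounded (rank Φ)) refl)
        byView (isNext φ) refl =
          t (π 1) (conjIn⁺ {S = atoms (π 1)} φ (forced-next 0 μ
            (follows 0 φ refl (Hintikka.nx-in (hintikka-state (π 0)) μ x))))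

-- Completing the opponents' actions to a prescribed sum

-- The residue of q - t modulo l; `l ∸ t % l` represents -t and is an honest subtraction.
tuning : ℕ → ℕ → (l : ℕ) → .{{NonZero l}} → ℕ
tuning q t l = (q + (l ∸ t % l)) % l

tuning-correct : ∀ q t l .{{_ : NonZero l}} → q < l → (t + tuning q t l) % l ≡ q
tuning-correct q t l q<l = begin
  (t + (q + (l ∸ t % l)) % l) % l              ≡⟨ %-distribˡ-+ t _ l ⟩
  (t % l + (q + (l ∸ t % l)) % l % l) % l      ≡⟨ cong (λ x → (t % l + x) % l) (m%n%n≡m%n (q + (l ∸ t % l)) l) ⟩
  (t % l + (q + (l ∸ t % l)) % l) % l          ≡⟨ cong (λ x → (x + (q + (l ∸ t % l)) % l) % l) (sym (m%n%n≡m%n t l)) ⟩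
  (t % l % l + (q + (l ∸ t % l)) % l) % l      ≡⟨ sym (%-distribˡ-+ (t % l) (q + (l ∸ t % l)) l) ⟩
  (t % l + (q + (l ∸ t % l))) % l              ≡⟨ cong (_% l) rearrange ⟩
  (q + l) % l                                  ≡⟨ [m+n]%n≡m%n q l ⟩
  q % l                                        ≡⟨ m<n⇒m%n≡m q<l ⟩
  q                                            ∎
  where
  open ≡-Reasoning
  rearrange : t % l + (q + (l ∸ t % l)) ≡ q + l
  rearrange = begin
    t % l + (q + (l ∸ t % l)) ≡⟨ sym (ℕₚ.+-assoc (t % l) q _) ⟩
    t % l + q + (l ∸ t % l)   ≡⟨ cong (_+ (l ∸ t % l)) (ℕₚ.+-comm (t % l) q) ⟩
    q + t % l + (l ∸ t % l)   ≡⟨ ℕₚ.+-assoc q (t % l) _ ⟩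
    q + (t % l + (l ∸ t % l)) ≡⟨ cong (q +_) (ℕₚ.m+[n∸m]≡n (ℕₚ.<⇒≤ (m%n<n t l))) ⟩
    q + l                     ∎

sum-tabulate-+ : ∀ {n} (f g : Fin n → ℕ) → sum (tabulate (λ a → f a + g a)) ≡ sum (tabulate f) + sum (tabulate g)
sum-tabulate-+ {zero} f g = refl
sum-tabulate-+ {suc n} f g = begin
  f zero + g zero + sum (tabulate (λ a → f (suc a) + g (suc a))) ≡⟨ cong (f zero + g zero +_) (sum-tabulate-+ (f ∘ suc) (g ∘ suc)) ⟩
  f zero + g zero + (F + G)   ≡⟨ ℕₚ.+-assoc (f zero) (g zero) _ ⟩
  f zero + (g zero + (F + G)) ≡⟨ cong (f zero +_) (sym (ℕₚ.+-assoc (g zero) F G)) ⟩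
  f zero + (g zero + F + G)   ≡⟨ cong (λ x → f zero + (x + G)) (ℕₚ.+-comm (g zero) F) ⟩
  f zero + (F + g zero + G)   ≡⟨ cong (f zero +_) (ℕₚ.+-assoc F (g zero) G) ⟩
  f zero + (F + (g zero + G)) ≡⟨ sym (ℕₚ.+-assoc (f zero) F _) ⟩
  f zero + F + (g zero + G)   ∎
  where
  open ≡-Reasoning
  F = sum (tabulate (f ∘ suc))
  G = sum (tabulate (g ∘ suc))

sum-tabulate-0 : ∀ {n} (f : Fin n → ℕ) → (∀ a → f a ≡ 0) → sum (tabulate f) ≡ 0
sum-tabulate-0 {zero} f z = refl
sum-tabulate-0 {suc n} f z = cong₂ _+_ (z zero) (sum-tabulate-0 (f ∘ suc) (z ∘ suc))

sum-tabulate-single : ∀ {n} (f : Fin n → ℕ) b → (∀ a → a ≢ b → f a ≡ 0) → sum (tabulate f) ≡ f b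
sum-tabulate-single f zero z = trans (cong (f zero +_) (sum-tabulate-0 (f ∘ suc) (λ a → z (suc a) (λ ()))))
                                     (ℕₚ.+-identityʳ _)
sum-tabulate-single f (suc b) z = trans (cong (_+ sum (tabulate (f ∘ suc))) (z zero (λ ())))
  (sum-tabulate-single (f ∘ suc) b (λ a ne → z (suc a) (λ eq → ne (Finₚ.suc-injective eq))))

module _ {k} (o : RawListing k) where
  contrib-≥ : ∀ t → contrib o (length (proj₁ o) + t) ≡ t
  contrib-≥ t with length (proj₁ o) ≤ᵇ length (proj₁ o) + t | ℕₚ.≤⇒≤ᵇ (ℕₚ.m≤m+n (length (proj₁ o)) t)
  ... | true | _ = ℕₚ.m+n∸m≡n (length (proj₁ o)) t

not-full : ∀ {k} {A : Coal k} → A ≢ full → Σ (Fin k) (_∉ A)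
not-full {zero} {[]} ne = ⊥-elim (ne refl)
not-full {suc k} {false ∷ A} ne = zero , λ ()
not-full {suc k} {true ∷ A} ne =
  let b , b∉ = not-full {k} {A} (λ eq → ne (cong (true ∷_) eq))
  in suc b , λ { (there i) → b∉ i }

mod′-% : ∀ x l .{{_ : NonZero l}} → x mod′ l ≡ x % l
mod′-% x (suc l) = refl

-- Strategies, co-strategies and the truth lemma

module Strategies {k : ℕ} (η : SF k) (ord : Label k → RawListing k) (good : Tableau.GoodOrd η ord)
                  (W : List (Code k)) (M : Realisation.Model η ord good W) where
  open TableauFacts η ord good
  open Codes η ord good
  open Realisation η ord good
  open Game η ord good W M
  open Sem arena

  toℕ-clamp : ∀ s {n} → n < size (listing (code s)) → toℕ (clamp s n) ≡ n
  toℕ-clamp s lt = trans (Finₚ.toℕ-fromℕ< _) (m<n⇒m%n≡m {{size-nonZero s}} lt)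

  toℕ-move : ∀ s σ a → toℕ (vlookup (move s σ) a) ≡ toℕ (clamp s (σ a))
  toℕ-move s σ a = cong toℕ (lookup∘tabulate (λ a → clamp s (σ a)) a)

  entryIndex : ∀ {A : Coal k} {φ} {xs : List (Coal k × SF k)} → Dec ((A , φ) ∈ˡ xs) → Maybe (Fin (length xs))
  entryIndex (yes i) = just (proj₁ (∈-index i))
  entryIndex (no _) = nothing

  entryIndex-∈ : ∀ {A : Coal k} {φ} {xs : List (Coal k × SF k)} (d : Dec ((A , φ) ∈ˡ xs)) → (A , φ) ∈ˡ xs →
                 Σ (Fin (length xs)) λ p → entryIndex d ≡ just p × lookup xs p ≡ (A , φ)
  entryIndex-∈ (yes i) _ = proj₁ (∈-index i) , refl , proj₂ (∈-index i)
  entryIndex-∈ (no ¬i) i = ⊥-elim (¬i i)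

  current : Mod k → Maybe (PF k) → State → List State → State × Maybe (PF k)
  current μ t s [] = s , t
  current μ t s (s′ ∷ ss) = current μ (obligation s μ t) s′ ss

  current-∷ʳ : ∀ μ t s ss s′ → current μ t s (ss ++ [ s′ ]) ≡
    (s′ , obligation (proj₁ (current μ t s ss)) μ (proj₂ (current μ t s ss)))
  current-∷ʳ μ t s [] s′ = refl
  current-∷ʳ μ t s (s″ ∷ ss) s′ = current-∷ʳ μ (obligation s μ t) s″ ss s′

  current⁺ : Mod k → PF k → List⁺ State → State × Maybe (PF k)
  current⁺ μ Φ (s ∷ ss) = current μ (just Φ) s ss

  current-pre : ∀ μ Φ π i → current⁺ μ Φ (pre π i) ≡ (π i , obligations π μ Φ i)
  current-pre μ Φ π zero = refl
  current-pre μ Φ π (suc i) with pre π i | current-pre μ Φ π i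
  ... | s ∷ ss | eq = trans (current-∷ʳ μ (just Φ) s ss (π (suc i)))
                            (cong (λ x → π (suc i) , obligation (proj₁ x) μ (proj₂ x)) eq)

  chain-∷ʳ : ∀ μ t s ss s′ → Chain s ss → Step (proj₁ (current μ t s ss)) s′ → Chain s (ss ++ [ s′ ])
  chain-∷ʳ μ t s [] s′ _ step = step , tt
  chain-∷ʳ μ t s (s″ ∷ ss) s′ (step′ , c) step = step′ , chain-∷ʳ μ (obligation s μ t) s″ ss s′ c step

  hist-suc : ∀ π i → IsHist (pre π i) → Step (π i) (π (suc i)) → IsHist (pre π (suc i))
  -- Modality and formula are arbitrary here: `current` serves only to name the last state of the
  -- history.
  hist-suc π i h step with pre π i | current-pre (dia empty) ⊤ₚ π i
  ... | s ∷ ss | eq = chain-∷ʳ (dia empty) (just ⊤ₚ) s ss (π (suc i)) h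
                        (subst (λ x → Step x (π (suc i))) (cong proj₁ (sym eq)) step)

  diaAct : Coal k → State × Maybe (PF k) → ℕ
  diaAct A (s , t) = fromTarget (target s (dia A) t)
    where
    fromIndex : ∀ {n} → Maybe (Fin n) → ℕ
    fromIndex (just p) = toℕ p
    fromIndex nothing = 0
    fromTarget : Maybe (SF k) → ℕ
    fromTarget (just φ) = fromIndex (entryIndex (Entry? (listing (code s)) (dia A) φ))
    fromTarget nothing = 0

  diaAct-entry : ∀ A s t {φ} → target s (dia A) t ≡ just φ → Entry (listing (code s)) (dia A) φ →
    Σ (Fin (length (proj₁ (listing (code s))))) λ p →
      diaAct A (s , t) ≡ toℕ p × lookup (proj₁ (listing (code s))) p ≡ (A , φ)
  diaAct-entry A s t {φ} eq x with target s (dia A) t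
  diaAct-entry A s t {φ} refl x | just _
    with entryIndex (Entry? (listing (code s)) (dia A) φ) | entryIndex-∈ (Entry? (listing (code s)) (dia A) φ) x
  ... | just p | .p , refl , eq = p , refl , eq

  diaStrategy : ∀ A → PF k → Strategy A
  diaStrategy A Φ h _ a _ = diaAct A (current⁺ (dia A) Φ h) , tt

  dia-follows : ∀ A s t σ {φ} → target s (dia A) t ≡ just φ → atoms s (nx (dia A) φ) →
    (∀ a → a ∈ A → σ a ≡ diaAct A (s , t)) → Follows (listing (code s)) (dia A) φ (vlookup (move s σ))
  dia-follows A s t σ teq x acts with diaAct-entry A s t teq (entry-state s (dia A) x)
  ... | p , eq , leq = p , leq , λ a i → trans (toℕ-move s σ a)
    (trans (cong (λ n → toℕ (clamp s n)) (trans (acts a i) eq))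
           (toℕ-clamp s (ℕₚ.<-≤-trans (Finₚ.toℕ<n p) (ℕₚ.m≤m+n _ _))))

  truth-dia : ∀ A Φ → Truths Φ → ∀ s → atoms s (⟪ A ⟫ Φ) → s ⊨ (⟪ A ⟫ Φ)
  truth-dia A Φ t s x = diaStrategy A Φ , λ π (π₀ , cons) →
    let hist : ∀ i → IsHist (pre π i)
        hist = λ i → hists π cons i
        σ = λ i → proj₁ (cons i (hist i))
    in OnPlay.play-truth π σ (λ i → proj₂ (proj₂ (proj₂ (cons i (hist i))))) (dia A) Φ
         (subst (λ s → atoms s (⟪ A ⟫ Φ)) (sym π₀) x) t
         (λ i φ teq y → dia-follows A (π i) (obligations π (dia A) Φ i) (σ i) teq y
           (λ a j → trans (proj₁ (proj₂ (proj₂ (cons i (hist i)))) a j)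
                          (cong (diaAct A) (current-pre (dia A) Φ π i))))
    where
    Cons : Play → Set
    Cons π = ∀ i → (ih : IsHist (pre π i)) → Σ Profile λ σ → Avail (π i) σ ×
      (∀ a (p : a ∈ A) → σ a ≡ proj₁ (diaStrategy A Φ (pre π i) ih a p)) × outcome (π i) σ ≡ π (suc i)
    -- Consistency yields a step only once its prefix is known to be a history, so the two are built
    -- up together.
    hists : ∀ π → Cons π → ∀ i → IsHist (pre π i)
    hists π cons zero = tt
    hists π cons (suc i) = let h = hists π cons i
                               σ , av , _ , eq = cons i h in hist-suc π i h (σ , av , eq)

  -- The share of A in the sum behind `co`. The opponents can compute it because a co-strategy is
  -- handed the strategy of A.
  given : ∀ (A : Coal k) → State → ((a : Fin k) → a ∈ A → ℕ) → Fin k → ℕ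
  given A s f a with a ∈? A
  ... | yes i = contrib (listing (code s)) (toℕ (clamp s (f a i)))
  ... | no _ = 0

  offset : ∀ (A : Coal k) s → ((a : Fin k) → a ∈ A → ℕ) → Fin (length (proj₂ (listing (code s)))) → ℕ
  offset A s f q = tuning (toℕ q) (sum (tabulate (given A s f))) (length (proj₂ (listing (code s)))) {{Finₚ.nonZeroIndex q}}

  only : ∀ {P : Set} → Dec P → ℕ → ℕ
  only (yes _) n = n
  only (no _) n = 0

  -- One opponent outside A tunes the sum; the others contribute nothing to it.
  boxPlay : ∀ (A : Coal k) s → ((a : Fin k) → a ∈ A → ℕ) → Dec (A ≡ full) →
            Maybe (Fin (length (proj₂ (listing (code s))))) → Fin k → ℕ
  boxPlay A s f (no A≢) (just q) a =
    length (proj₁ (listing (code s))) + only (a Finₚ.≟ proj₁ (not-full A≢)) (offset A s f q)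
  boxPlay A s f _ _ a = 0

  boxAct : ∀ (A : Coal k) → State × Maybe (PF k) → ((a : Fin k) → a ∈ A → ℕ) → Fin k → ℕ
  boxAct A (s , t) f = fromTarget (target s (box A) t)
    where
    fromTarget : Maybe (SF k) → Fin k → ℕ
    fromTarget (just φ) = boxPlay A s f (A ≟C full) (entryIndex (Entry? (listing (code s)) (box A) φ))
    fromTarget nothing a = 0

  BoxMove : (A : Coal k) (s : State) → ((a : Fin k) → a ∈ A → ℕ) → (Fin k → ℕ) → SF k → Set
  BoxMove A s f act φ = Σ (Fin (length (proj₂ (listing (code s))))) λ q →
    lookup (proj₂ (listing (code s))) q ≡ (A , φ) × Σ (Fin k) λ b → b ∉ A ×
    (∀ a → act a ≡ length (proj₁ (listing (code s))) + only (a Finₚ.≟ b) (offset A s f q))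

  boxMove : ∀ A s t f {φ} → A ≢ full → target s (box A) t ≡ just φ → Entry (listing (code s)) (box A) φ →
            BoxMove A s f (boxAct A (s , t) f) φ
  boxMove A s t f {φ} A≢ eq x with target s (box A) t
  boxMove A s t f {φ} A≢ refl x | just _
    with A ≟C full | entryIndex (Entry? (listing (code s)) (box A) φ) | entryIndex-∈ (Entry? (listing (code s)) (box A) φ) x
  ... | yes A≡ | _ | _ = ⊥-elim (A≢ A≡)
  ... | no A≢′ | just q | .q , refl , eq = q , eq , proj₁ (not-full A≢′) , proj₂ (not-full A≢′) , λ a → refl

  boxStrategy : ∀ A → PF k → CoStrategy A
  boxStrategy A Φ h ih F a _ =
    boxAct A (current⁺ (box A) Φ h) (λ b i → proj₁ (F h ih b i)) a , tt

  module _ (A : Coal k) (s : State) (f : (a : Fin k) → a ∈ A → ℕ) (act σ : Fin k → ℕ)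
           (σ-in : ∀ a (i : a ∈ A) → σ a ≡ f a i) (σ-out : ∀ a → a ∉ A → σ a ≡ act a) where
    private
      o = listing (code s)
      ds = proj₁ o
      bs = proj₂ o
      v : Prof o
      v = vlookup (move s σ)

    coPlays : ∀ q b → b ∉ A → (∀ a → act a ≡ length ds + only (a Finₚ.≟ b) (offset A s f q)) → CoPlays o A q v
    coPlays q b b∉ acts = co≡ , λ a a∉ → subst (length ds ≤_) (sym (outside a a∉)) (ℕₚ.m≤m+n _ _)
      where
      instance
        l≢0 : NonZero (length bs)
        l≢0 = Finₚ.nonZeroIndex q
      n : ℕ
      n = offset A s f q
      -- Keeps each opposing action below `size`, so that `clamp` leaves it unchanged.
      only-< : ∀ {P : Set} (d : Dec P) → only d n < length bs
      only-< (yes _) = m%n<n (toℕ q + (length bs ∸ sum (tabulate (given A s f)) % length bs)) (length bs)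
      only-< (no _) = ℕₚ.≤-<-trans z≤n (Finₚ.toℕ<n q)
      outside : ∀ a → a ∉ A → toℕ (v a) ≡ length ds + only (a Finₚ.≟ b) n
      outside a a∉ = trans (toℕ-move s σ a)
        (trans (cong (λ x → toℕ (clamp s x)) (trans (σ-out a a∉) (acts a)))
               (toℕ-clamp s (ℕₚ.+-monoʳ-< (length ds) (only-< (a Finₚ.≟ b)))))
      contribution : ∀ a → contrib o (toℕ (v a)) ≡ given A s f a + only (a Finₚ.≟ b) n
      contribution a with a ∈? A
      ... | no a∉ = trans (cong (contrib o) (outside a a∉)) (contrib-≥ o (only (a Finₚ.≟ b) n))
      ... | yes a∈ with a Finₚ.≟ b
      ...   | yes refl = ⊥-elim (b∉ a∈)
      ...   | no _ = trans (cong (contrib o) (trans (toℕ-move s σ a) (cong (λ x → toℕ (clamp s x)) (σ-in a a∈))))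
                           (sym (ℕₚ.+-identityʳ _))
      single : sum (tabulate (λ a → only (a Finₚ.≟ b) n)) ≡ n
      single = trans (sum-tabulate-single (λ a → only (a Finₚ.≟ b) n) b others) itself
        where
        others : ∀ a → a ≢ b → only (a Finₚ.≟ b) n ≡ 0
        others a a≢ with a Finₚ.≟ b
        ... | yes a≡ = ⊥-elim (a≢ a≡)
        ... | no _ = refl
        itself : only (b Finₚ.≟ b) n ≡ n
        itself with b Finₚ.≟ b
        ... | yes _ = refl
        ... | no b≢ = ⊥-elim (b≢ refl)
      total : sum (map (λ a → contrib o (toℕ (v a))) (allFin k)) ≡ sum (tabulate (given A s f)) + n
      total = begin
        sum (map (λ a → contrib o (toℕ (v a))) (allFin k))        ≡⟨ cong sum (map-tabulate id (λ a → contrib o (toℕ (v a)))) ⟩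
        sum (tabulate (λ a → contrib o (toℕ (v a))))              ≡⟨ cong sum (tabulate-cong contribution) ⟩
        sum (tabulate (λ a → given A s f a + only (a Finₚ.≟ b) n)) ≡⟨ sum-tabulate-+ (given A s f) (λ a → only (a Finₚ.≟ b) n) ⟩
        sum (tabulate (given A s f)) + sum (tabulate (λ a → only (a Finₚ.≟ b) n)) ≡⟨ cong (sum (tabulate (given A s f)) +_) single ⟩
        sum (tabulate (given A s f)) + n                          ∎
        where open ≡-Reasoning
      co≡ : coL o v ≡ toℕ q
      co≡ = trans (cong (_mod′ length bs) total)
        (trans (mod′-% (sum (tabulate (given A s f)) + n) (length bs))
               (tuning-correct (toℕ q) (sum (tabulate (given A s f))) (length bs) (Finₚ.toℕ<n q)))

    box-follows : ∀ t {φ} → (∀ a → act a ≡ boxAct A (s , t) f a) → target s (box A) t ≡ just φ →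
                  atoms s (nx (box A) φ) → Follows o (norm (box A)) φ v
    box-follows t {φ} acts teq x = byCases (A ≟C full)
      where
      byCases : Dec (A ≡ full) → Follows o (norm (box A)) φ v
      -- There are no opponents left; the normal form has the empty coalition, which every profile
      -- follows.
      byCases (yes refl) = subst (λ ν → Follows o ν φ v) (sym norm-full)
        (let p , eq = ∈-index (subst (λ ν → Entry o ν φ) norm-full (entry-state s (box A) x))
         in p , eq , λ a i → ⊥-elim (∉⊥ i))
      byCases (no A≢) = subst (λ ν → Follows o ν φ v) (sym (norm-proper A≢))
        (let q , eq , b , b∉ , play = boxMove A s t f A≢ teq
                                        (subst (λ ν → Entry o ν φ) (norm-proper A≢) (entry-state s (box A) x))
         in q , eq , coPlays q b b∉ (λ a → trans (acts a) (play a)))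

  truth-box : ∀ A Φ → Truths Φ → ∀ s → atoms s (⟦ A ⟧ Φ) → s ⊨ (⟦ A ⟧ Φ)
  truth-box A Φ t s x = boxStrategy A Φ , λ π (F , π₀ , cons) →
    let hist : ∀ i → IsHist (pre π i)
        hist = λ i → hists F π cons i
        σ = λ i → proj₁ (cons i (hist i))
    in OnPlay.play-truth π σ (λ i → proj₂ (proj₂ (proj₂ (proj₂ (cons i (hist i)))))) (box A) Φ
         (subst (λ s → atoms s (⟦ A ⟧ Φ)) (sym π₀) x) t
         (λ i φ teq y → box-follows A (π i) (λ a j → proj₁ (F (pre π i) (hist i) a j))
           (boxAct A (current⁺ (box A) Φ (pre π i)) (λ a j → proj₁ (F (pre π i) (hist i) a j))) (σ i)
           (proj₁ (proj₂ (proj₂ (cons i (hist i)))))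
           (proj₁ (proj₂ (proj₂ (proj₂ (cons i (hist i))))))
           (obligations π (box A) Φ i)
           (λ a → cong (λ u → boxAct A u (λ a j → proj₁ (F (pre π i) (hist i) a j)) a) (current-pre (box A) Φ π i))
           teq y)
    where
    Cons : Strategy A → Play → Set
    Cons F π = ∀ i → (ih : IsHist (pre π i)) → Σ Profile λ σ → Avail (π i) σ ×
      (∀ a (p : a ∈ A) → σ a ≡ proj₁ (F (pre π i) ih a p)) ×
      (∀ a (p : a ∉ A) → σ a ≡ proj₁ (boxStrategy A Φ (pre π i) ih F a p)) × outcome (π i) σ ≡ π (suc i)
    hists : ∀ F π → Cons F π → ∀ i → IsHist (pre π i)
    hists F π cons zero = tt
    hists F π cons (suc i) = let h = hists F π cons i
                                 σ , av , _ , _ , eq = cons i h in hist-suc π i h (σ , av , eq)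

  mutual
    truth : ∀ φ → Truth φ
    truth (lit (pos p)) s x = x
    truth (lit (neg p)) s x y = Hintikka.clashH (hintikka-state s) p y x
    truth (φ ∨ₛ ψ) s x with Hintikka.orH (hintikka-state s) φ ψ x
    ... | inj₁ y = inj₁ (truth φ s (conjIn⁺ {S = atoms s} φ y))
    ... | inj₂ y = inj₂ (truth ψ s (conjIn⁺ {S = atoms s} ψ y))
    truth (φ ∧ₛ ψ) = Truth-∧ {φ} {ψ} (truth φ) (truth ψ)
    truth (⟪ A ⟫ Φ) s x = truth-dia A Φ (truths Φ) s x
    truth (⟦ A ⟧ Φ) s x = truth-box A Φ (truths Φ) s x

    truths : ∀ Φ → Truths Φ
    truths (st φ) = truth φ
    truths (○ φ) = truth φ
    truths (□ φ) = truth φ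
    truths (φ U ψ) = truth φ , truth ψ
    truths (Φ ∨ₚ Ψ) = truths Φ , truths Ψ
    truths (Φ ∧ₚ Ψ) = truths Φ , truths Ψ

  satisfiable : Satisfiable η
  satisfiable = let e , i , x = find (Model-initial M)
                    -- The truth lemma covers all schedules, so the initial one is arbitrary.
                    s = state e i 0 (dia empty , ⊤ₚ) []
                in arena , s , truth η s (conjIn⁺ {S = atoms s} η x)

theorem5 : (k : ℕ) → 1 ≤ k → (η : SF k) → (ord : Label k → RawListing k) →
    Tableau.GoodOrd η ord →
    (T : Label k → Set₁) → Tableau.ElimRun η ord T → Tableau.Final η ord T →
    Tableau.Open η ord T →
    Satisfiable η
theorem5 k _ η ord good T run final open-T =
  let W , M = Realisation.FromFinal.model-exists η ord good T run final open-T
  in Strategies.satisfiable η ord good W M
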